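{- Let $\mathcal{H}$ be a supersolvable hyperplane arrangement and let $R_0$ be a canonical region of $\mathcal{H}$ (with respect to a fixed recursive supersolvable decomposition). Then the poset of regions $L:=P(\mathcal{H},R_0)$ is a lattice, and for any lattice congruence $\equiv$ on $L$, the cover graph of the quotient lattice $L/\equiv$ has a Hamiltonian path.
   Context: A hyperplane arrangement in $\mathbb{R}^d$ is a finite set $\mathcal{H}$ of linear hyperplanes; its rank is the dimension of the span of the normal vectors. Regions are the connected components of the complement of $\bigcup\mathcal{H}$; the graph of regions $G(\mathcal{H})$ has the regions as vertices, two being adjacent iff separated by exactly one hyperplane of $\mathcal{H}$ ($G(\mathcal{H})$ is connected and bipartite). An arrangement of rank $n$ is supersolvable if $n\le 2$, or $n\ge 3$ and $\mathcal{H}=\mathcal{H}_0\sqcup\mathcal{H}_1$ with $\mathcal{H}_0,\mathcal{H}_1$ nonempty, $\mathcal{H}_0$ supersolvable of rank $n-1$, and for any distinct $H',H''\in\mathcal{H}_1$ there is $H\in\mathcal{H}_0$ with $H'\cap H''\subseteq H$. For such a decomposition, let $\rho$ map each region of $\mathcal{H}$ to the region of $\mathcal{H}_0$ containing it; for each region $R$ of $\mathcal{H}$, the set $\rho^{ -1}(\rho(R))$ induces a path in $G(\mathcal{H})$. Canonical regions: if the rank is at most $2$, every region is canonical; if the rank is $\ge3$, a region $R_0$ is canonical if $\rho(R_0)$ is canonical for $\mathcal{H}_0$ (with respect to its own decomposition) and $R_0$ is the first or last vertex of the path induced by $\rho^{ -1}(\rho(R_0))$ in $G(\mathcal{H})$.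 The poset of regions $P(\mathcal{H},R_0)$ has the regions as ground set, the rank of a region $R$ being its graph distance from $R_0$ in $G(\mathcal{H})$, covers being the edges of $G(\mathcal{H})$ oriented from lower to higher rank, and the order being the reflexive-transitive closure of the covers. A lattice congruence on a lattice $L$ is an equivalence relation $\equiv$ such that $x\equiv x'$ and $y\equiv y'$ imply $x\wedge y\equiv x'\wedge y'$ and $x\vee y\equiv x'\vee y'$; the quotient lattice $L/\equiv$ is the set of classes, ordered by $X\le Y$ iff there are $x\in X$, $y\in Y$ with $x\le y$. The cover graph of a poset has its elements as vertices and its cover pairs as edges. -}

module Defs where

open import Level using (Level; 0ℓ; _⊔_; Lift) renaming (suc to lsuc)
open import Algebra.Bundles using (CommutativeRing)
open import Algebra.Core using (Op₂)
open import Algebra.Definitions using (Congruent₂)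
open import Data.Fin.Base using (Fin; zero; suc; toℕ; fromℕ; inject₁)
open import Data.Fin.Subset using (Subset; _∈_; _∉_; _∪_; _∩_; Nonempty; Empty)
open import Data.Fin.Subset.Properties using (p⊆p∪q)
open import Data.Nat.Base as ℕ using (ℕ)
open import Data.Product using (Σ; ∃; ∃₂; ∃!; _×_; _,_)
open import Data.Sum.Base using (_⊎_)
open import Data.Unit.Base using (⊤)
open import Data.Vec.Functional using (Vector)
open import Function.Bundles using (_⇔_)
open import Function.Definitions using (Bijective)
open import Relation.Binary.Core using (Rel)
open import Relation.Binary.PropositionalEquality.Core using (_≡_; _≢_; subst)
open import Relation.Binary.Structures using (IsEquivalence; IsStrictTotalOrder)
open import Relation.Nullary.Negation.Core using (¬_)
open import Relation.Unary using (Pred; Satisfiable; _≐_; _≬_)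
import Algebra.Properties.CommutativeMonoid.Sum as Sum
import Relation.Binary.Construct.NonStrictToStrict as ToStrict
import Relation.Binary.Construct.StrictToNonStrict as ToNonStrict
import Relation.Unary as U

private
  variable
    a ℓ ℓ₁ ℓ₂ ℓ₃ : Level
    A : Set a

-- The real numbers, axiomatised classically as a Dedekind-complete totally
-- ordered field (unique up to isomorphism), with a setoid equality.

record CompleteOrderedField : Set₁ where
  infix 4 _<_
  field
    commutativeRing : CommutativeRing 0ℓ 0ℓ

  open CommutativeRing commutativeRing public
    using (Carrier; _≈_; _+_; _*_; 0#; 1#; +-commutativeMonoid)

  field
    _<_                : Rel Carrier 0ℓ
    isStrictTotalOrder : IsStrictTotalOrder _≈_ _<_
    0<1                : 0# < 1#
    inverse            : ∀ x → ¬ (x ≈ 0#) → ∃ λ y → x * y ≈ 1#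
    +-monoˡ-<          : ∀ z {x y} → x < y → x + z < y + z
    *-pos              : ∀ {x y} → 0# < x → 0# < y → 0# < x * y

  open ToNonStrict _≈_ _<_ public using (_≤_)

  UpperBound : Pred Carrier 0ℓ → Pred Carrier 0ℓ
  UpperBound P u = ∀ x → P x → x ≤ u

  field
    complete : ∀ (P : Pred Carrier 0ℓ) → Satisfiable P → Satisfiable (UpperBound P) →
               ∃ λ s → UpperBound P s × (∀ u → UpperBound P u → s ≤ u)

------------------------------------------------------------------------
-- Below, _≈_ is the equality of the vertices of a graph or elements of a poset.

-- The enumeration p shows that F induces, in the graph Adj, a path with
-- vertices p 0, …, p n in this order.
record IsInducedPath {A : Set a} (_≈_ : Rel A ℓ₁) (Adj : Rel A ℓ₂) (F : Pred A ℓ₃)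
                     {n : ℕ} (p : Fin (ℕ.suc n) → A) : Set (a ⊔ ℓ₁ ⊔ ℓ₂ ⊔ ℓ₃) where
  field
    inside    : ∀ i → F (p i)
    covering  : ∀ x → F x → ∃ λ i → p i ≈ x
    injective : ∀ i j → p i ≈ p j → i ≡ j
    induced   : ∀ i j → Adj (p i) (p j) ⇔
                  (toℕ j ≡ ℕ.suc (toℕ i) ⊎ toℕ i ≡ ℕ.suc (toℕ j))

data Walk {A : Set a} (_≈_ : Rel A ℓ₁) (Adj : Rel A ℓ₂) :
          A → A → ℕ → Set (a ⊔ ℓ₁ ⊔ ℓ₂) where
  nil  : ∀ {x y} → x ≈ y → Walk _≈_ Adj x y 0
  cons : ∀ {x y z n} → Adj x y → Walk _≈_ Adj y z n → Walk _≈_ Adj x z (ℕ.suc n)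

IsDistance : {A : Set a} (_≈_ : Rel A ℓ₁) (Adj : Rel A ℓ₂) →
             A → A → ℕ → Set (a ⊔ ℓ₁ ⊔ ℓ₂)
IsDistance _≈_ Adj x y n =
  Walk _≈_ Adj x y n × (∀ k → Walk _≈_ Adj x y k → n ℕ.≤ k)

-- The reflexive-transitive closure, reflexive with respect to _≈_.
data Closure {A : Set a} (_≈_ : Rel A ℓ₁) (_⋖_ : Rel A ℓ₂) :
             A → A → Set (a ⊔ ℓ₁ ⊔ ℓ₂) where
  refl : ∀ {x y} → x ≈ y → Closure _≈_ _⋖_ x y
  step : ∀ {x y z} → x ⋖ y → Closure _≈_ _⋖_ y z → Closure _≈_ _⋖_ x z

CoverPair : {A : Set a} (_≈_ : Rel A ℓ₁) (_≤_ : Rel A ℓ₂) → Rel A (a ⊔ ℓ₁ ⊔ ℓ₂)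
CoverPair _≈_ _≤_ x y = x < y × ¬ (∃ λ z → x < z × z < y)
  where open ToStrict _≈_ _≤_ using (_<_)

CoverGraph : {A : Set a} (_≈_ : Rel A ℓ₁) (_≤_ : Rel A ℓ₂) → Rel A (a ⊔ ℓ₁ ⊔ ℓ₂)
CoverGraph _≈_ _≤_ x y = CoverPair _≈_ _≤_ x y ⊎ CoverPair _≈_ _≤_ y x

HasHamiltonianPath : {A : Set a} (_≈_ : Rel A ℓ₁) (Adj : Rel A ℓ₂) → Set (a ⊔ ℓ₁ ⊔ ℓ₂)
HasHamiltonianPath {A = A} _≈_ Adj =
  ∃ λ n → Σ (Fin (ℕ.suc n) → A) λ p →
    Bijective _≡_ _≈_ p × (∀ (i : Fin n) → Adj (p (inject₁ i)) (p (suc i)))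

-- A congruence is in particular a relation on A up to _≈_, hence `respects`.
record IsLatticeCongruence {A : Set a} (_≈_ : Rel A ℓ₁) (_∨_ _∧_ : Op₂ A)
                           (_∼_ : Rel A ℓ₂) : Set (a ⊔ ℓ₁ ⊔ ℓ₂) where
  field
    isEquivalence : IsEquivalence _∼_
    respects      : ∀ {x y} → x ≈ y → x ∼ y
    ∧-cong        : Congruent₂ _∼_ _∧_
    ∨-cong        : Congruent₂ _∼_ _∨_

-- The order on the classes of _∼_, each class being given by any of its
-- elements; equality of classes is _∼_ itself.
QuotientOrder : {A : Set a} (_≤_ : Rel A ℓ₁) (_∼_ : Rel A ℓ₂) → Rel A (a ⊔ ℓ₁ ⊔ ℓ₂)
QuotientOrder _≤_ _∼_ x y = ∃₂ λ x′ y′ → x′ ∼ x × y′ ∼ y × x′ ≤ y′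

------------------------------------------------------------------------

module HyperplaneArrangements (ℝ : CompleteOrderedField) where

  open CompleteOrderedField ℝ
  open Sum +-commutativeMonoid using (sum)

  Point : ℕ → Set
  Point d = Vector Carrier d

  infix 4 _≋_
  _≋_ : ∀ {d} → Rel (Point d) 0ℓ
  x ≋ y = ∀ i → x i ≈ y i

  ⟨_,_⟩ : ∀ {d} → Point d → Point d → Carrier
  ⟨ x , y ⟩ = sum λ i → x i * y i

  lincomb : ∀ {d n} → (Fin n → Carrier) → (Fin n → Point d) → Point d
  lincomb c v j = sum λ k → c k * v k j

  0ᵥ : ∀ {d} → Point d
  0ᵥ _ = 0#

  LinearlyIndependent : ∀ {d n} → (Fin n → Point d) → Set
  LinearlyIndependent v = ∀ c → lincomb c v ≋ 0ᵥ → ∀ k → c k ≈ 0#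

  Span : ∀ {d n} → (Fin n → Point d) → Pred (Point d) 0ℓ
  Span v x = ∃ λ c → x ≋ lincomb c v

  HasDimension : ∀ {d} → Pred (Point d) 0ℓ → ℕ → Set
  HasDimension {d} V n = Σ (Fin n → Point d) λ b →
    (∀ k → V (b k)) × LinearlyIndependent b × (∀ x → V x → Span b x)

  -- The usual topology of ℝᵈ, given by the maximum norm.
  IsOpen : ∀ {d} → Pred (Point d) 0ℓ → Set
  IsOpen U = ∀ x → U x → ∃ λ ε → 0# < ε ×
    (∀ y → (∀ i → x i < y i + ε × y i < x i + ε) → U y)

  IsConnected : ∀ {d} → Pred (Point d) 0ℓ → Set₁
  IsConnected C = ∀ U V → IsOpen U → IsOpen V → C U.⊆ (U U.∪ V) →
    ¬ (C ≬ (U U.∩ V)) → ¬ (C ≬ U × C ≬ V)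

  -- x and y lie in the same connected component of X.
  SameComponent : ∀ {d} → Pred (Point d) 0ℓ → Rel (Point d) (lsuc 0ℓ)
  SameComponent X x y = ∃ λ C → IsConnected C × C U.⊆ X × C x × C y

  hyperplane : ∀ {d} → Point d → Pred (Point d) 0ℓ
  hyperplane a x = ⟨ a , x ⟩ ≈ 0#

  record Arrangement (d : ℕ) : Set where
    field
      size           : ℕ
      normal         : Fin size → Point d
      normal-nonzero : ∀ i → ¬ (normal i ≋ 0ᵥ)
      distinct       : ∀ i j → i ≢ j → ¬ (hyperplane (normal i) ≐ hyperplane (normal j))

  -- Subarrangements of a fixed arrangement are subsets of its index set.
  module _ {d : ℕ} (𝓗 : Arrangement d) where
    open Arrangement 𝓗

    SpanOfNormals : Subset size → Pred (Point d) 0ℓ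
    SpanOfNormals S x = ∃ λ c → (∀ i → i ∉ S → c i ≈ 0#) × x ≋ lincomb c normal

    HasRank : Subset size → ℕ → Set
    HasRank S n = HasDimension (SpanOfNormals S) n

    Complement : Subset size → Pred (Point d) 0ℓ
    Complement S x = ∀ {i} → i ∈ S → ¬ hyperplane (normal i) x

    -- A region is given by any of its points, and equality of regions is
    -- SameRegion.
    Region : Subset size → Set
    Region S = ∃ (Complement S)

    SameRegion : (S : Subset size) → Rel (Region S) (lsuc 0ℓ)
    SameRegion S (x , _) (y , _) = SameComponent (Complement S) x y

    Separates : Fin size → Rel (Point d) 0ℓ
    Separates i x y =
        (⟨ normal i , x ⟩ < 0# × 0# < ⟨ normal i , y ⟩)
      ⊎ (⟨ normal i , y ⟩ < 0# × 0# < ⟨ normal i , x ⟩)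

    Adjacent : (S : Subset size) → Rel (Region S) 0ℓ
    Adjacent S (x , _) (y , _) = ∃! _≡_ λ i → i ∈ S × Separates i x y

    -- A recursive supersolvable decomposition; a subarrangement is
    -- supersolvable iff it has one.
    data Decomposition (S : Subset size) : Set where
      rank≤2 : ∀ {n} → HasRank S n → n ℕ.≤ 2 → Decomposition S
      rank≥3 : ∀ {n} → HasRank S n → 3 ℕ.≤ n →
               (S₀ S₁ : Subset size) → S₀ ∪ S₁ ≡ S → Empty (S₀ ∩ S₁) →
               Nonempty S₀ → Nonempty S₁ →
               HasRank S₀ (ℕ.pred n) →
               (∀ i j → i ∈ S₁ → j ∈ S₁ → i ≢ j → ∃ λ k → k ∈ S₀ ×
                 (hyperplane (normal i) U.∩ hyperplane (normal j)) U.⊆ hyperplane (normal k)) →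
               Decomposition S₀ →
               Decomposition S

    -- The region of S₀ containing the given region of S₀ ∪ S₁ contains the
    -- same representing point.
    ρ : ∀ {S} (S₀ S₁ : Subset size) → S₀ ∪ S₁ ≡ S → Region S → Region S₀
    ρ S₀ S₁ eq (x , x∉) = x , λ i∈S₀ → x∉ (subst (_ ∈_) eq (p⊆p∪q S₁ i∈S₀))

    IsCanonical : ∀ {S} → Decomposition S → Region S → Set₁
    IsCanonical (rank≤2 _ _) R = Lift (lsuc 0ℓ) ⊤
    IsCanonical {S} (rank≥3 _ _ S₀ S₁ eq _ _ _ _ _ D₀) R =
      IsCanonical D₀ (ρ₀ R) ×
      ∃ λ n → Σ (Fin (ℕ.suc n) → Region S) λ p →
        IsInducedPath (SameRegion S) (Adjacent S)
          (λ R′ → SameRegion S₀ (ρ₀ R′) (ρ₀ R)) p ×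
        (SameRegion S R (p zero) ⊎ SameRegion S R (p (fromℕ n)))
      where
      ρ₀ : Region S → Region S₀
      ρ₀ = ρ S₀ S₁ eq

    module _ {S : Subset size} (R₀ : Region S) where

      RegionRank : Region S → ℕ → Set₁
      RegionRank = IsDistance (SameRegion S) (Adjacent S) R₀

      UpwardEdge : Rel (Region S) (lsuc 0ℓ)
      UpwardEdge R R′ = Adjacent S R R′ ×
        ∃₂ λ k l → RegionRank R k × RegionRank R′ l × k ℕ.< l

      RegionOrder : Rel (Region S) (lsuc 0ℓ)
      RegionOrder = Closure (SameRegion S) UpwardEdge

{-# OPTIONS --safe #-}
module Submission where

-- Let H = H₀ ⊔ H₁ and let v lie on all hyperplanes of H₀ and, for each
-- hyperplane of H₁, on the same side as the base point x₀.  On the line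
-- x + ℝ v the hyperplanes of H₁ are met in an order which, for i and j, depends
-- only on the side of x with respect to the k ∈ H₀ with Hᵢ ∩ Hⱼ ⊆ Hₖ.  A region
-- of H is therefore a region Q of H₀ together with a down-set of the order on
-- H₁ at Q.  The join of x and y lies over the join in H₀, with the least
-- down-set containing both separation sets; meets are dual.  No pair of H₁ can
-- be reversed against this, as k is crossed at most once on the way up.
--
-- Given a congruence ∼ on this lattice L, restrict it to the bottom elements of
-- the fibres, which form a copy of the lattice L₀ of H₀.  Over ∼₀-equivalent
-- regions the fibres meet the same ∼-classes, each fibre modulo ∼ is a chain,
-- and a cover of L₀/∼₀ gives covers both between the bottoms and between the
-- tops.  So a Hamiltonian path of L₀/∼₀ lifts by running through the fibres
-- alternately upwards and downwards.
--
-- Rank at most 2 fits the same scheme with H₀ consisting of one wall of the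
-- base region.

open import Defs hiding (refl; step)
open import Level using (Level; 0ℓ; _⊔_) renaming (suc to lsuc)
open import Axiom.ExcludedMiddle using (ExcludedMiddle)
open import Algebra.Bundles using (CommutativeRing)
open import Algebra.Solver.Ring.AlmostCommutativeRing using (_-Raw-AlmostCommutative⟶_; fromCommutativeRing)
open import Data.Bool.Base using (Bool; true; false; not)
open import Data.Empty using (⊥; ⊥-elim)
open import Data.Fin.Base using (Fin; zero; suc; toℕ; fromℕ; inject₁; punchIn; punchOut)
open import Data.Fin.Patterns using (0F; 1F; 2F)
open import Data.Fin.Subset using (Subset; ⊤; inside; outside; _∈_; _∉_; _∪_; _∩_; _─_; ⁅_⁆; Empty; Nonempty) renaming (⊥ to ∅)
open import Data.Fin.Subset.Properties using (∈⊤; ∉⊥; x∈⁅x⁆; x∈⁅y⁆⇒x≡y; x∈p∪q⁻; x∈p∪q⁺; x∈p∩q⁺; p─q⊆p; x∈p∧x≢y⇒x∈p-y)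
open import Data.Integer.Base as ℤ using (ℤ; +_; -[1+_]; _⊖_)
open import Data.List.Base as List using (List; []; _∷_; _++_)
open import Data.List.Membership.Propositional using (find; lose) renaming (_∈_ to _∈ₗ_)
open import Data.List.Relation.Unary.All as All using (All; []; _∷_)
open import Data.List.Relation.Unary.AllPairs using (AllPairs; []; _∷_)
open import Data.List.Relation.Unary.Any as Any using (Any; here; there)
open import Data.Maybe.Base using (Maybe; just; nothing)
open import Data.Nat using (ℕ)
open import Data.Product using (Σ; ∃; ∃₂; _×_; _,_; proj₁; proj₂)
open import Data.Sum.Base as Sum using (_⊎_; inj₁; inj₂)
open import Data.Unit.Base using (tt) renaming (⊤ to Unit)
open import Data.Vec.Base using (_∷_; here; there)
open import Function.Base using (_∘_; id)
open import Function.Bundles using (Equivalence)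
open import Relation.Binary.Core using (Rel; _⇒_)
open import Relation.Binary.Definitions using (tri<; tri≈; tri>; Symmetric; Total; Transitive)
open import Relation.Binary.Lattice.Structures using (IsLattice)
open import Relation.Binary.PropositionalEquality.Core as ≡ using (_≡_; _≢_)
open import Relation.Binary.Structures using (IsEquivalence; IsStrictTotalOrder)
open import Relation.Nullary using (¬_; Dec; yes; no; contradiction)
open import Relation.Unary using (Pred; _≐_)
import Algebra.Properties.Ring
import Algebra.Properties.Semiring.Mult.TCOptimised
import Algebra.Properties.Semiring.Sum
import Algebra.Solver.Ring
import Data.Fin.Properties as Fin
import Data.Integer.Properties as ℤ
import Data.List.Relation.Unary.All.Properties as All
import Data.List.Relation.Unary.AllPairs.Properties as AllPairs
import Data.List.Relation.Unary.Any.Properties as Any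
import Data.Nat.Base as ℕ
import Data.Nat.Properties as ℕ
import Relation.Binary.Construct.StrictToNonStrict as ToNonStrict
import Relation.Binary.Reasoning.Setoid as SetoidReasoning

-- The direction `v` comes from a dimension count. The normals of `H` span one dimension more than
-- those of `H₀`, so their span contains a nonzero vector orthogonal to all normals of `H₀`, and
-- modularity forbids this vector to lie on any hyperplane of `H₁`. Canonicity puts it, up to sign,
-- on the base side of all of `H₁`: otherwise walks from `x₀` towards the vector and towards its
-- negative would leave the base region through two different hyperplanes of `H₁`, giving it two
-- neighbours in its fibre, whereas it is an end of that path. Regions are given as connected
-- components, and their order as the closure of edges oriented by graph distance. Both have to be
-- expressed by signs: components are classes of equal sign vectors, and the order is inclusion of
-- separation sets. The lattice arguments take place in this model, with the same point `x₀` as base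
-- at every level of the decomposition, since `ρ` keeps the representing point.

private
  variable
    ℓ₀ ℓ ℓ₁ ℓ₂ ℓ₃ : Level

-- Paths with their vertex lists, and Hamiltonian paths

infixr 5 _∷_

data Path {A : Set ℓ₀} (Adj : Rel A ℓ) : A → A → List A → Set (ℓ₀ ⊔ ℓ) where
  [_] : ∀ x → Path Adj x x (x ∷ [])
  _∷_ : ∀ {x y z xs} → Adj x y → Path Adj y z xs → Path Adj x z (x ∷ xs)

module _ {A : Set ℓ₀} {Adj : Rel A ℓ} where

  _⟨_⟩++_ : ∀ {w x y z xs ys} → Path Adj w x xs → Adj x y → Path Adj y z ys →
            Path Adj w z (xs ++ ys)
  [ x ]   ⟨ e ⟩++ q = e ∷ q
  (d ∷ p) ⟨ e ⟩++ q = d ∷ (p ⟨ e ⟩++ q)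

  -- Mutual membership stands in for an equation between the vertex lists; it is what arguments
  -- about coverage consume.
  reverse : ∀ {R : Rel A ℓ₁} {x y xs} → Symmetric Adj → Symmetric R → Path Adj x y xs →
            AllPairs R xs → ∃ λ ys →
            Path Adj y x ys × All (_∈ₗ xs) ys × All (_∈ₗ ys) xs × AllPairs R ys
  reverse sym symR [ x ] pairs = _ , [ x ] , here ≡.refl ∷ [] , here ≡.refl ∷ [] , pairs
  reverse sym symR (_∷_ {x} e p) (r ∷ pairs) =
    let ys , q , ys⊆ , ⊆ys , pairs′ = reverse sym symR p pairs in
    ys ++ x ∷ [] , q ⟨ sym e ⟩++ [ x ] ,
    All.++⁺ (All.map there ys⊆) (here ≡.refl ∷ []) ,
    Any.++⁺ʳ ys (here ≡.refl) ∷ All.map Any.++⁺ˡ ⊆ys ,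
    AllPairs.++⁺ pairs′ ([] ∷ [])
      (All.map (λ y∈ → symR (All.lookup r y∈) ∷ []) ys⊆)

  head∈ : ∀ {x y xs} → Path Adj x y xs → x ∈ₗ xs
  head∈ [ _ ]   = here ≡.refl
  head∈ (_ ∷ _) = here ≡.refl

record HamiltonianList {A : Set ℓ₀} (_≈_ : Rel A ℓ₁) (Adj : Rel A ℓ₂) :
                       Set (ℓ₀ ⊔ ℓ₁ ⊔ ℓ₂) where
  field
    {first last} : A
    {vertices}   : List A
    path         : Path Adj first last vertices
    covering     : ∀ x → Any (x ≈_) vertices
    distinct     : AllPairs (λ x y → ¬ x ≈ y) vertices

module _ {A : Set ℓ₀} {Adj : Rel A ℓ₁} {_≈_ : Rel A ℓ₂} (E : IsEquivalence _≈_) where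
  private module E = IsEquivalence E

  private
    -- The last component ties `p zero` to the head of the path, which is what lets the induction
    -- prepend an edge.
    enumerate : ∀ {x y xs} → Path Adj x y xs → AllPairs (λ u v → ¬ u ≈ v) xs →
                ∃ λ n → Σ (Fin (ℕ.suc n) → A) λ p →
                (∀ {z} → z ∈ₗ xs → ∃ λ i → p i ≡ z) × (∀ i → p i ∈ₗ xs) ×
                (∀ i j → p i ≈ p j → i ≡ j) ×
                (∀ (i : Fin n) → Adj (p (inject₁ i)) (p (suc i))) × (p zero ≡ x)
    enumerate [ x ] _ = 0 , (λ _ → x) , (λ { (here ≡.refl) → zero , ≡.refl }) , (λ _ → here ≡.refl) ,
      (λ { zero zero _ → ≡.refl }) , (λ ()) , ≡.refl
    enumerate (_∷_ {x} e q) (r ∷ rs) =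
      let n , p , index , p∈ , inj , adj , eq = enumerate q rs in
      ℕ.suc n , (λ { zero → x ; (suc i) → p i }) ,
      (λ { (here ≡.refl) → zero , ≡.refl ; (there h) → let i , h′ = index h in suc i , h′ }) ,
      (λ { zero → here ≡.refl ; (suc i) → there (p∈ i) }) ,
      (λ { zero zero _ → ≡.refl
         ; zero (suc j) x≈ → contradiction x≈ (All.lookup r (p∈ j))
         ; (suc i) zero ≈x → contradiction (E.sym ≈x) (All.lookup r (p∈ i))
         ; (suc i) (suc j) e → ≡.cong suc (inj i j e) }) ,
      (λ { zero → ≡.subst (Adj x) (≡.sym eq) e ; (suc i) → adj i }) , ≡.refl

  hasHamiltonianPath : HamiltonianList _≈_ Adj → HasHamiltonianPath _≈_ Adj
  hasHamiltonianPath H =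
    let n , p , index , p∈ , inj , adj , _ = enumerate path distinct in
    n , p , ((λ {i} {j} → inj i j) ,
             λ y → let z , z∈ , y≈z = find (covering y)
                       i , pi≡z = index z∈ in
                   i , λ { ≡.refl → ≡.subst (_≈ y) (≡.sym pi≡z) (E.sym y≈z) }) , adj
    where open HamiltonianList H

mapPath : {A : Set ℓ₀} {R : Rel A ℓ₁} {S : Rel A ℓ₂} → R ⇒ S → ∀ {x y xs} → Path R x y xs → Path S x y xs
mapPath f [ x ]   = [ x ]
mapPath f (e ∷ p) = f e ∷ mapPath f p

-- Lattice congruences and covers in the quotient

module Congruence {A : Set ℓ₀} {_≈_ : Rel A ℓ₁} {_≤_ : Rel A ℓ₂} {_∨_ _∧_ : A → A → A}
                  (L : IsLattice _≈_ _≤_ _∨_ _∧_) {_∼_ : Rel A ℓ₃}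
                  (C : IsLatticeCongruence _≈_ _∨_ _∧_ _∼_) where
  open IsLattice L public
  open IsLatticeCongruence C public using (respects; ∧-cong; ∨-cong)
  module ∼ = IsEquivalence (IsLatticeCongruence.isEquivalence C)

  _≼_ : Rel A _
  _≼_ = QuotientOrder _≤_ _∼_

  Cover : Rel A _
  Cover = CoverGraph _∼_ _≼_

  ∨-absorb : ∀ {x y} → x ≤ y → (x ∨ y) ∼ y
  ∨-absorb x≤y = respects (antisym (∨-least x≤y refl) (y≤x∨y _ _))

  ∧-absorb : ∀ {x y} → x ≤ y → (x ∧ y) ∼ x
  ∧-absorb x≤y = respects (antisym (x∧y≤x _ _) (∧-greatest refl x≤y))

  -- The quotient order only promises that some representatives are comparable; the congruence turns
  -- this into an equation modulo `∼` for the given ones.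
  ≼⇒∨ : ∀ {x y} → x ≼ y → (x ∨ y) ∼ y
  ≼⇒∨ (_ , _ , x′∼x , y′∼y , x′≤y′) =
    ∼.trans (∨-cong (∼.sym x′∼x) (∼.sym y′∼y)) (∼.trans (∨-absorb x′≤y′) y′∼y)

  ≼⇒∧ : ∀ {x y} → x ≼ y → (x ∧ y) ∼ x
  ≼⇒∧ (_ , _ , x′∼x , y′∼y , x′≤y′) =
    ∼.trans (∧-cong (∼.sym x′∼x) (∼.sym y′∼y)) (∼.trans (∧-absorb x′≤y′) x′∼x)

  ≤⇒≼ : ∀ {x y} → x ≤ y → x ≼ y
  ≤⇒≼ x≤y = _ , _ , ∼.refl , ∼.refl , x≤y

  ≼-resp : ∀ {x x′ y y′} → x ∼ x′ → y ∼ y′ → x ≼ y → x′ ≼ y′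
  ≼-resp x∼x′ y∼y′ (u , v , u∼x , v∼y , u≤v) =
    u , v , ∼.trans u∼x x∼x′ , ∼.trans v∼y y∼y′ , u≤v

  CoverPair-resp : ∀ {x x′ y y′} → x ∼ x′ → y ∼ y′ →
                   CoverPair _∼_ _≼_ x y → CoverPair _∼_ _≼_ x′ y′
  CoverPair-resp p q ((x≼y , x≁y) , none) =
    (≼-resp p q x≼y , λ r → x≁y (∼.trans p (∼.trans r (∼.sym q)))) ,
    λ { (z , (x′≼z , x′≁z) , (z≼y′ , z≁y′)) → none (z ,
      (≼-resp (∼.sym p) ∼.refl x′≼z , λ r → x′≁z (∼.trans (∼.sym p) r)) ,
      (≼-resp ∼.refl (∼.sym q) z≼y′ , λ r → z≁y′ (∼.trans r q))) }

  Cover-resp : ∀ {x x′ y y′} → x ∼ x′ → y ∼ y′ → Cover x y → Cover x′ y′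
  Cover-resp p q = Sum.map (CoverPair-resp p q) (CoverPair-resp q p)

  convex : ∀ {x y z} → x ≤ y → y ≤ z → x ∼ z → x ∼ y
  convex x≤y y≤z x∼z = ∼.trans x∼z
    (∼.trans (∼.sym (∨-absorb y≤z))
      (∼.trans (∨-cong ∼.refl (∼.sym x∼z)) (respects (antisym (∨-least refl x≤y) (x≤x∨y _ _)))))

  -- A class `z` between those of `x` and `y` contains `(x ∨ z) ∧ y`, an element of the interval
  -- from `x` to `y`; a cover leaves only the two ends for it.
  CoverPair-descends : ∀ {x y} → CoverPair _≈_ _≤_ x y → ¬ x ∼ y → CoverPair _∼_ _≼_ x y
  CoverPair-descends {x} {y} ((x≤y , _) , none) x≁y = (≤⇒≼ x≤y , x≁y) ,
    λ { (z , (x≼z , x≁z) , (z≼y , z≁y)) →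
      let z′∼z : ((x ∨ z) ∧ y) ∼ z
          z′∼z = ∼.trans (∧-cong (≼⇒∨ x≼z) ∼.refl) (≼⇒∧ z≼y) in
      none ((x ∨ z) ∧ y ,
        (∧-greatest (x≤x∨y _ _) x≤y , λ x≈z′ → x≁z (∼.trans (respects x≈z′) z′∼z)) ,
        (x∧y≤y _ _ , λ z′≈y → z≁y (∼.trans (∼.sym z′∼z) (respects z′≈y)))) }

-- bot-down and top-up make the image of bot a down-set and that of top an
-- up-set; fibre lists each fibre as a saturated chain from bot to top.
record Fibration {A : Set ℓ₀} {A₀ : Set ℓ₀} {_≈_ : Rel A ℓ₁} {_≤_ : Rel A ℓ₁} {_∨_ _∧_ : A → A → A}
                 (L : IsLattice _≈_ _≤_ _∨_ _∧_)
                 {_≈₀_ : Rel A₀ ℓ₁} {_≤₀_ : Rel A₀ ℓ₁} {_∨₀_ _∧₀_ : A₀ → A₀ → A₀}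
                 (L₀ : IsLattice _≈₀_ _≤₀_ _∨₀_ _∧₀_) : Set (ℓ₀ ⊔ ℓ₁) where
  field
    ρ         : A → A₀
    bot top   : A₀ → A
    ρ-mono    : ∀ {x y} → x ≤ y → ρ x ≤₀ ρ y
    ρ-bot     : ∀ q → ρ (bot q) ≈₀ q
    ρ-top     : ∀ q → ρ (top q) ≈₀ q
    bot-least : ∀ {q x} → q ≤₀ ρ x → bot q ≤ x
    top-great : ∀ {x q} → ρ x ≤₀ q → x ≤ top q
    bot-down  : ∀ {x q} → x ≤ bot q → x ≤ bot (ρ x)
    top-up    : ∀ {q x} → top q ≤ x → top (ρ x) ≤ x
    fibre     : ∀ q → ∃ λ x → ∃ λ y → ∃ λ xs →
                Path (CoverPair _≈_ _≤_) x y xs × x ≈ bot q × y ≈ top q ×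
                All (λ z → ρ z ≈₀ q) xs × (∀ z → ρ z ≈₀ q → Any (z ≈_) xs)

-- Lifting Hamiltonian paths along a fibration of lattices

module Zigzag {A : Set ℓ₀} {A₀ : Set ℓ₀} {_≈_ : Rel A ℓ₁} {_≤_ : Rel A ℓ₁} {_∨_ _∧_ : A → A → A}
                 {L : IsLattice _≈_ _≤_ _∨_ _∧_}
                 {_≈₀_ : Rel A₀ ℓ₁} {_≤₀_ : Rel A₀ ℓ₁} {_∨₀_ _∧₀_ : A₀ → A₀ → A₀}
                 {L₀ : IsLattice _≈₀_ _≤₀_ _∨₀_ _∧₀_} (F : Fibration L L₀)
                 (em : ∀ {ℓ} → ExcludedMiddle ℓ)
                 {_∼_ : Rel A ℓ₃} (C : IsLatticeCongruence _≈_ _∨_ _∧_ _∼_) where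
  open Congruence L C
  open Fibration F
  private module L₀ = IsLattice L₀

  bot-mono : ∀ {p q} → p ≤₀ q → bot p ≤ bot q
  bot-mono p≤q = bot-least (L₀.trans p≤q (L₀.reflexive (L₀.Eq.sym (ρ-bot _))))

  top-mono : ∀ {p q} → p ≤₀ q → top p ≤ top q
  top-mono p≤q = top-great (L₀.trans (L₀.reflexive (ρ-top _)) p≤q)

  bot-cong : ∀ {p q} → p ≈₀ q → bot p ≈ bot q
  bot-cong e = antisym (bot-mono (L₀.reflexive e)) (bot-mono (L₀.reflexive (L₀.Eq.sym e)))

  top-cong : ∀ {p q} → p ≈₀ q → top p ≈ top q
  top-cong e = antisym (top-mono (L₀.reflexive e)) (top-mono (L₀.reflexive (L₀.Eq.sym e)))

  below-bot : ∀ {x q} → x ≤ bot q → x ≈ bot (ρ x)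
  below-bot x≤ = antisym (bot-down x≤) (bot-least L₀.refl)

  above-top : ∀ {x q} → top q ≤ x → x ≈ top (ρ x)
  above-top ≤x = antisym (top-great L₀.refl) (top-up ≤x)

  bot-∨ : ∀ p q → bot (p ∨₀ q) ≈ (bot p ∨ bot q)
  bot-∨ p q = antisym
    (bot-least (L₀.∨-least (L₀.trans (L₀.reflexive (L₀.Eq.sym (ρ-bot p))) (ρ-mono (x≤x∨y _ _)))
                           (L₀.trans (L₀.reflexive (L₀.Eq.sym (ρ-bot q))) (ρ-mono (y≤x∨y _ _)))))
    (∨-least (bot-mono (L₀.x≤x∨y p q)) (bot-mono (L₀.y≤x∨y p q)))

  ∧-bot : ∀ {x q} → ρ x ≤₀ q → (x ∧ bot q) ≈ bot (ρ x)
  ∧-bot ρx≤q = antisym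
    (trans (bot-down (x∧y≤y _ _)) (bot-mono (ρ-mono (x∧y≤x _ _))))
    (∧-greatest (bot-least L₀.refl) (bot-mono ρx≤q))

  top-∨-bot : ∀ {p q} → p ≤₀ q → (top p ∨ bot q) ≈ top q
  top-∨-bot p≤q = antisym
    (∨-least (top-mono p≤q) (bot-least (L₀.reflexive (L₀.Eq.sym (ρ-top _)))))
    (trans (top-mono (L₀.trans (L₀.reflexive (L₀.Eq.sym (ρ-bot _))) (ρ-mono (y≤x∨y _ _))))
           (top-up (x≤x∨y _ _)))

  _∼₀_ : Rel A₀ ℓ₃
  p ∼₀ q = bot p ∼ bot q

  -- `bot` preserves joins because it is left adjoint to `ρ`, and meets because its image is a
  -- down-set, so `∼` can be pulled back along it.
  isCongruence₀ : IsLatticeCongruence _≈₀_ _∨₀_ _∧₀_ _∼₀_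
  isCongruence₀ = record
    { isEquivalence = record { refl = ∼.refl ; sym = ∼.sym ; trans = ∼.trans }
    ; respects = λ e → respects (bot-cong e)
    ; ∧-cong = λ {p} {p′} {q} {q′} e f →
        ∼.trans (∼.sym (bot-∧ p q)) (∼.trans (∧-cong e f) (bot-∧ p′ q′))
    ; ∨-cong = λ {p} {p′} {q} {q′} e f →
        ∼.trans (respects (bot-∨ p q)) (∼.trans (∨-cong e f) (∼.sym (respects (bot-∨ p′ q′))))
    }
    where
    bot-∧ : ∀ p q → (bot p ∧ bot q) ∼ bot (p ∧₀ q)
    bot-∧ p q = respects (antisym
      (trans (bot-down (x∧y≤x _ _)) (bot-mono (L₀.∧-greatest
        (L₀.trans (ρ-mono (x∧y≤x _ _)) (L₀.reflexive (ρ-bot p)))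
        (L₀.trans (ρ-mono (x∧y≤y _ _)) (L₀.reflexive (ρ-bot q))))))
      (∧-greatest (bot-mono (L₀.x∧y≤x p q)) (bot-mono (L₀.x∧y≤y p q))))

  private module C₀ = Congruence L₀ isCongruence₀

  -- Meeting with `bot q`, for any `q` above `ρ x`, cuts `x` down to `bot (ρ x)`. The choice
  -- `q = ρ x ∨₀ ρ y` serves both elements, so `∧-cong` applies.
  ρ-cong : ∀ {x y} → x ∼ y → ρ x ∼₀ ρ y
  ρ-cong x∼y = ∼.trans (∼.sym (respects (∧-bot (L₀.x≤x∨y _ _))))
    (∼.trans (∧-cong x∼y ∼.refl) (respects (∧-bot (L₀.y≤x∨y _ _))))

  ρ-≼ : ∀ {x y} → x ≼ y → ρ x C₀.≼ ρ y
  ρ-≼ (x′ , y′ , x′∼x , y′∼y , x′≤y′) = ρ x′ , ρ y′ , ρ-cong x′∼x , ρ-cong y′∼y , ρ-mono x′≤y′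

  bot-≼ : ∀ {p q} → p C₀.≼ q → bot p ≼ bot q
  bot-≼ (p′ , q′ , e , f , p′≤q′) = bot p′ , bot q′ , e , f , bot-mono p′≤q′

  -- `∼₀` is defined by bottoms, so its effect on tops must be derived. Joining
  -- `bot p ∼ bot (p ∨₀ q)` with `top p` gives `top p ∼ top (p ∨₀ q)`, because every element above a
  -- top is a top; the other half is symmetric.
  top∼ : ∀ {p q} → p ∼₀ q → top p ∼ top q
  top∼ e = ∼.trans (up e) (∼.trans (respects (top-cong (∨₀-comm _ _))) (∼.sym (up (∼.sym e))))
    where
    ∨₀-comm : ∀ p q → (p ∨₀ q) ≈₀ (q ∨₀ p)
    ∨₀-comm p q = L₀.antisym (L₀.∨-least (L₀.y≤x∨y _ _) (L₀.x≤x∨y _ _))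
                             (L₀.∨-least (L₀.y≤x∨y _ _) (L₀.x≤x∨y _ _))
    up : ∀ {p q} → p ∼₀ q → top p ∼ top (p ∨₀ q)
    up {p} {q} e = ∼.trans (respects (antisym (x≤x∨y _ _) (∨-least refl bot≤top)))
      (∼.trans (∨-cong ∼.refl (∼.trans (∼.sym (C₀.∨-absorb L₀.refl)) (C₀.∨-cong (∼.refl {bot p}) e)))
        (respects (top-∨-bot (L₀.x≤x∨y p q))))
      where
      bot≤top : bot p ≤ top p
      bot≤top = bot-least (L₀.reflexive (L₀.Eq.sym (ρ-top p)))

  top-≼ : ∀ {p q} → p C₀.≼ q → top p ≼ top q
  top-≼ (p′ , q′ , e , f , p′≤q′) = top p′ , top q′ , top∼ e , top∼ f , top-mono p′≤q′

  top-≁ : ∀ {p q} → ¬ p ∼₀ q → ¬ top p ∼ top q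
  top-≁ p≁q e = p≁q (∼.trans (∼.sym (respects (bot-cong (ρ-top _))))
    (∼.trans (ρ-cong e) (respects (bot-cong (ρ-top _)))))

  -- A class between those of `bot p` and `bot q` contains `z ∧ bot q`, which is itself a bottom
  -- because bottoms form a down-set. Its image under `ρ` would lie strictly between `p` and `q`
  -- modulo `∼₀`.
  bot-CoverPair : ∀ {p q} → CoverPair _∼₀_ C₀._≼_ p q → CoverPair _∼_ _≼_ (bot p) (bot q)
  bot-CoverPair {p} {q} ((p≼q , p≁q) , none) = (bot-≼ p≼q , p≁q) ,
    λ { (z , (p≼z , p≁z) , (z≼q , z≁q)) →
      let r = ρ (z ∧ bot q)
          z∼r : z ∼ bot r
          z∼r = ∼.trans (∼.sym (≼⇒∧ z≼q)) (respects (below-bot (x∧y≤y _ _)))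
          ρz∼r : ρ z ∼₀ r
          ρz∼r = ∼.trans (ρ-cong z∼r) (respects (bot-cong (ρ-bot _))) in
      none (r ,
        (C₀.≼-resp (respects (bot-cong (ρ-bot _))) ρz∼r (ρ-≼ p≼z) ,
          λ e → p≁z (∼.trans e (∼.sym z∼r))) ,
        (C₀.≼-resp ρz∼r (respects (bot-cong (ρ-bot _))) (ρ-≼ z≼q) ,
          λ e → z≁q (∼.trans z∼r e))) }

  top-CoverPair : ∀ {p q} → CoverPair _∼₀_ C₀._≼_ p q → CoverPair _∼_ _≼_ (top p) (top q)
  top-CoverPair {p} {q} ((p≼q , p≁q) , none) = (top-≼ p≼q , top-≁ p≁q) ,
    λ { (z , (p≼z , p≁z) , (z≼q , z≁q)) →
      let r = ρ (top p ∨ z)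
          z∼r : z ∼ top r
          z∼r = ∼.trans (∼.sym (≼⇒∨ p≼z)) (respects (above-top (x≤x∨y _ _)))
          ρz∼r : ρ z ∼₀ r
          ρz∼r = ∼.trans (ρ-cong z∼r) (respects (bot-cong (ρ-top _))) in
      none (r ,
        (C₀.≼-resp (respects (bot-cong (ρ-top _))) ρz∼r (ρ-≼ p≼z) ,
          λ e → p≁z (∼.trans (top∼ e) (∼.sym z∼r))) ,
        (C₀.≼-resp ρz∼r (respects (bot-cong (ρ-top _))) (ρ-≼ z≼q) ,
          λ e → z≁q (∼.trans z∼r (top∼ e)))) }

  bot-Cover : ∀ {p q} → C₀.Cover p q → Cover (bot p) (bot q)
  bot-Cover = Sum.map bot-CoverPair bot-CoverPair

  top-Cover : ∀ {p q} → C₀.Cover p q → Cover (top p) (top q)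
  top-Cover = Sum.map top-CoverPair top-CoverPair

  -- Congruent elements of a chain are consecutive by convexity; `above` is carried along to make
  -- this available. From a run of congruent elements the last one survives, so `x′` is only
  -- congruent to `x`.
  record Dedup (x y : A) (xs : List A) : Set (ℓ₀ ⊔ ℓ₁ ⊔ ℓ₃) where
    field
      {x′ y′}   : A
      {ys}      : List A
      path      : Path Cover x′ y′ ys
      x′∼x      : x′ ∼ x
      y′∼y      : y′ ∼ y
      above     : All (x ≤_) ys
      subset    : All (_∈ₗ xs) ys
      covering  : ∀ {z} → Any (z ∼_) xs → Any (z ∼_) ys
      distinct  : AllPairs (λ u v → ¬ u ∼ v) ys

  dedup : ∀ {x y xs} → Path (CoverPair _≈_ _≤_) x y xs → Dedup x y xs
  dedup [ x ] = record
    { path = [ x ] ; x′∼x = ∼.refl ; y′∼y = ∼.refl ; above = refl ∷ []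
    ; subset = here ≡.refl ∷ [] ; covering = id ; distinct = [] ∷ [] }
  dedup (_∷_ {x} {y} x⋖y p) with dedup p | em {P = x ∼ y}
  ... | D | yes x∼y = record
    { path = path ; x′∼x = ∼.trans x′∼x (∼.sym x∼y) ; y′∼y = y′∼y
    ; above = All.map (trans (proj₁ (proj₁ x⋖y))) above
    ; subset = All.map there subset
    ; covering = λ { (here z∼x) → covering (Any.map (λ { ≡.refl → ∼.trans z∼x x∼y }) (head∈ p))
                   ; (there z∈) → covering z∈ }
    ; distinct = distinct }
    where open Dedup D
  ... | D | no x≁y = record
    { path = Cover-resp ∼.refl (∼.sym x′∼x) (inj₁ (CoverPair-descends x⋖y x≁y)) ∷ path
    ; x′∼x = ∼.refl ; y′∼y = y′∼y
    ; above = refl ∷ All.map (trans x≤y) above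
    ; subset = here ≡.refl ∷ All.map there subset
    ; covering = λ { (here z∼x) → here z∼x ; (there z∈) → there (covering z∈) }
    ; distinct = All.map (λ y≤v x∼v → x≁y (convex x≤y y≤v x∼v)) above ∷ distinct }
    where
    open Dedup D
    x≤y : x ≤ y
    x≤y = proj₁ (proj₁ x⋖y)

  corner : Bool → A₀ → A
  corner false = bot
  corner true  = top

  -- `over` records which base classes have been used. As `ρ` respects the congruences, it keeps the
  -- blocks of different fibres apart.
  record Traversal (b : Bool) (b′ : Bool) (p q : A₀) (qs : List A₀) : Set (ℓ₀ ⊔ ℓ₁ ⊔ ℓ₃) where
    field
      {x y}    : A
      {xs}     : List A
      path     : Path Cover x y xs
      start    : x ∼ corner b p
      end      : y ∼ corner b′ q
      over     : All (λ z → Any (λ r → ρ z ∼₀ r) qs) xs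
      covering : ∀ z → Any (λ r → ρ z ∼₀ r) qs → Any (z ∼_) xs
      distinct : AllPairs (λ u v → ¬ u ∼ v) xs

  Cover-sym : ∀ {x y} → Cover x y → Cover y x
  Cover-sym (inj₁ e) = inj₂ e
  Cover-sym (inj₂ e) = inj₁ e

  -- Hence a single fibre for each ∼₀-class already meets every ∼-class.
  retract : ∀ {z q} → ρ z ∼₀ q → ∃ λ z′ → z ∼ z′ × ρ z′ ≈₀ q
  retract {z} {q} e = z′ , ∼.trans z∼u (∼.trans (∼.sym (∧-absorb u≤top)) (∧-cong ∼.refl top-eq)) ,
    L₀.antisym (L₀.trans (ρ-mono (x∧y≤y _ _)) (L₀.reflexive (ρ-top q)))
      (L₀.trans (L₀.reflexive (L₀.Eq.sym (ρ-bot q))) (ρ-mono (∧-greatest (y≤x∨y _ _)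
        (bot-least (L₀.reflexive (L₀.Eq.sym (ρ-top q)))))))
    where
    u z′ : A
    u = z ∨ bot q
    z′ = u ∧ top q
    z∼u : z ∼ u
    z∼u = ∼.trans (∼.sym (respects (antisym (∨-least refl (bot-least L₀.refl)) (x≤x∨y _ _)))) (∨-cong ∼.refl e)
    u≤top : u ≤ top (ρ z ∨₀ q)
    u≤top = ∨-least (top-great (L₀.x≤x∨y _ _))
      (bot-least (L₀.trans (L₀.y≤x∨y _ _) (L₀.reflexive (L₀.Eq.sym (ρ-top _)))))
    top-eq : top (ρ z ∨₀ q) ∼ top q
    top-eq = top∼ (∼.trans (C₀.∨-cong e (∼.refl {bot q})) (C₀.∨-absorb L₀.refl))

  upwards : ∀ q → Traversal false true q q (q ∷ [])
  upwards q with fibre q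
  ... | x , y , xs , p , x≈ , y≈ , over , cover = record
    { path = path ; start = ∼.trans x′∼x (respects x≈) ; end = ∼.trans y′∼y (respects y≈)
    ; over = All.map (λ z∈ → here (respects (bot-cong (All.lookup over z∈)))) subset
    ; covering = λ { z (here e) → let z′ , z∼z′ , e′ = retract e in
        covering (Any.map (λ f → ∼.trans z∼z′ (respects f)) (cover z′ e′)) }
    ; distinct = distinct }
    where open Dedup (dedup p)

  block : ∀ b q → Traversal b (not b) q q (q ∷ [])
  block false q = upwards q
  block true  q =
    let ys , p , ys⊆ , ⊆ys , distinct′ = reverse Cover-sym (λ ne e → ne (∼.sym e)) path distinct in record
    { path = p ; start = end ; end = start ; over = All.map (All.lookup over) ys⊆
    ; covering = λ z h → let w , w∈ , e = find (covering z h) in lose (All.lookup ⊆ys w∈) e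
    ; distinct = distinct′ }
    where open Traversal (upwards q)

  corner-Cover : ∀ b {p q} → C₀.Cover p q → Cover (corner b p) (corner b q)
  corner-Cover false = bot-Cover
  corner-Cover true  = top-Cover

  zigzag : ∀ {p q qs} → Path C₀.Cover p q qs → AllPairs (λ u v → ¬ u ∼₀ v) qs → ∀ b →
           ∃ λ b′ → Traversal b b′ p q qs
  zigzag [ q ] _ b = not b , block b q
  zigzag (_∷_ {p} {q} {r} {qs} e π) (p≁ ∷ ne) b with zigzag π ne (not b)
  ... | b′ , T′ = b′ , record
    -- The block over `p` ends at the corner `not b`, and the next block starts at the same kind of
    -- corner, so the base cover is lifted between two tops or two bottoms.
    { path = T.path ⟨ Cover-resp (∼.sym T.end) (∼.sym T′.start) (corner-Cover (not b) e) ⟩++ T′.path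
    ; start = T.start ; end = T′.end
    ; over = All.++⁺ (All.map (λ { (here h) → here h }) T.over) (All.map there T′.over)
    ; covering = λ { z (here h) → Any.++⁺ˡ (T.covering z (here h))
                   ; z (there h) → Any.++⁺ʳ T.xs (T′.covering z h) }
    ; distinct = AllPairs.++⁺ T.distinct T′.distinct
        (All.map (λ { (here h) → All.map (λ k u∼v → All.lookupWith
          (λ p≁r w → p≁r (∼.trans (∼.sym h) (∼.trans (ρ-cong u∼v) w))) p≁ k) T′.over }) T.over) }
    where
    module T  = Traversal (block b p)
    module T′ = Traversal T′

  lift-path : HamiltonianList _∼₀_ C₀.Cover → HamiltonianList _∼_ Cover
  lift-path H = record
    { path = path ; covering = λ z → covering z (H.covering (ρ z)) ; distinct = distinct }
    where
    module H = HamiltonianList H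
    open Traversal (proj₂ (zigzag H.path H.distinct false))

-- The integers as coefficients of the ring solver, so that it sees cancellations.
module IntegerCoefficients {r₁ r₂} (R : CommutativeRing r₁ r₂) where
  open CommutativeRing R
  open Algebra.Properties.Ring ring using (-‿distribˡ-*; -‿distribʳ-*; -‿involutive; -0#≈0#; -‿+-comm)
  open Algebra.Properties.Semiring.Mult.TCOptimised semiring using (1+×; ×-homo-+; ×1-homo-*) renaming (_×_ to _⋆_)
  open SetoidReasoning setoid

  ⟦_⟧ : ℤ → Carrier
  ⟦ + n ⟧      = n ⋆ 1#
  ⟦ -[1+ n ] ⟧ = - (ℕ.suc n ⋆ 1#)

  -homo : ∀ i → ⟦ ℤ.- i ⟧ ≈ - ⟦ i ⟧
  -homo (+ ℕ.zero)  = sym -0#≈0#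
  -homo (+ ℕ.suc n) = refl
  -homo -[1+ n ]    = sym (-‿involutive _)

  ⊖-homo : ∀ m n → ⟦ m ⊖ n ⟧ ≈ m ⋆ 1# + - (n ⋆ 1#)
  ⊖-homo ℕ.zero ℕ.zero = sym (-‿inverseʳ _)
  ⊖-homo (ℕ.suc m) ℕ.zero = sym (trans (+-congˡ -0#≈0#) (+-identityʳ _))
  ⊖-homo ℕ.zero (ℕ.suc n) = sym (+-identityˡ _)
  ⊖-homo (ℕ.suc m) (ℕ.suc n) = begin
    ⟦ ℕ.suc m ⊖ ℕ.suc n ⟧  ≡⟨ ≡.cong ⟦_⟧ (ℤ.[1+m]⊖[1+n]≡m⊖n m n) ⟩
    ⟦ m ⊖ n ⟧             ≈⟨ ⊖-homo m n ⟩
    a + - b                       ≈⟨ +-congˡ (+-identityˡ _) ⟨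
    a + (0# + - b)                ≈⟨ +-congˡ (+-congʳ (-‿inverseʳ 1#)) ⟨
    a + (1# + - 1# + - b)         ≈⟨ +-congˡ (trans (+-assoc _ _ _) (+-congˡ (-‿+-comm _ _))) ⟩
    a + (1# + - (1# + b))         ≈⟨ +-assoc _ _ _ ⟨
    (a + 1#) + - (1# + b)         ≈⟨ +-cong (trans (+-comm _ _) (sym (1+× m 1#))) (-‿cong (sym (1+× n 1#))) ⟩
    ℕ.suc m ⋆ 1# + - (ℕ.suc n ⋆ 1#) ∎
    where
    a = m ⋆ 1#
    b = n ⋆ 1#

  +homo : ∀ i j → ⟦ i ℤ.+ j ⟧ ≈ ⟦ i ⟧ + ⟦ j ⟧
  +homo (+ m) (+ n)           = ×-homo-+ 1# m n
  +homo (+ m) -[1+ n ]        = ⊖-homo m (ℕ.suc n)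
  +homo -[1+ m ] (+ n)        = trans (⊖-homo n (ℕ.suc m)) (+-comm _ _)
  +homo -[1+ m ] -[1+ n ]     = begin
    - (ℕ.suc (ℕ.suc (m ℕ.+ n)) ⋆ 1#)  ≈⟨ -‿cong (1+× (ℕ.suc m ℕ.+ n) 1#) ⟩
    - (1# + (ℕ.suc m ℕ.+ n) ⋆ 1#)     ≈⟨ -‿cong (+-congˡ (×-homo-+ 1# (ℕ.suc m) n)) ⟩
    - (1# + (a + n ⋆ 1#))             ≈⟨ -‿cong (+-assoc _ _ _) ⟨
    - (1# + a + n ⋆ 1#)               ≈⟨ -‿cong (+-congʳ (+-comm _ _)) ⟩
    - (a + 1# + n ⋆ 1#)               ≈⟨ -‿cong (+-assoc _ _ _) ⟩
    - (a + (1# + n ⋆ 1#))             ≈⟨ -‿cong (+-congˡ (1+× n 1#)) ⟨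
    - (a + ℕ.suc n ⋆ 1#)              ≈⟨ -‿+-comm _ _ ⟨
    - a + - (ℕ.suc n ⋆ 1#)            ∎
    where a = ℕ.suc m ⋆ 1#

  *homo : ∀ i j → ⟦ i ℤ.* j ⟧ ≈ ⟦ i ⟧ * ⟦ j ⟧
  *homo (+ m) (+ n) = trans (reflexive (≡.cong ⟦_⟧ (ℤ.+◃n≡+n (m ℕ.* n)))) (×1-homo-* m n)
  *homo (+ m) -[1+ n ] = begin
    ⟦ + m ℤ.* -[1+ n ] ⟧          ≡⟨ ≡.cong ⟦_⟧ (ℤ.-◃n≡-n (m ℕ.* ℕ.suc n)) ⟩
    ⟦ ℤ.- (+ (m ℕ.* ℕ.suc n)) ⟧   ≈⟨ -homo (+ (m ℕ.* ℕ.suc n)) ⟩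
    - ((m ℕ.* ℕ.suc n) ⋆ 1#)       ≈⟨ -‿cong (×1-homo-* m (ℕ.suc n)) ⟩
    - (m ⋆ 1# * ℕ.suc n ⋆ 1#)     ≈⟨ -‿distribʳ-* _ _ ⟩
    m ⋆ 1# * - (ℕ.suc n ⋆ 1#)     ∎
  *homo -[1+ m ] (+ n) = begin
    ⟦ -[1+ m ] ℤ.* + n ⟧          ≡⟨ ≡.cong ⟦_⟧ (ℤ.-◃n≡-n (ℕ.suc m ℕ.* n)) ⟩
    ⟦ ℤ.- (+ (ℕ.suc m ℕ.* n)) ⟧   ≈⟨ -homo (+ (ℕ.suc m ℕ.* n)) ⟩
    - ((ℕ.suc m ℕ.* n) ⋆ 1#)       ≈⟨ -‿cong (×1-homo-* (ℕ.suc m) n) ⟩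
    - (ℕ.suc m ⋆ 1# * n ⋆ 1#)     ≈⟨ -‿distribˡ-* _ _ ⟩
    - (ℕ.suc m ⋆ 1#) * n ⋆ 1#     ∎
  *homo -[1+ m ] -[1+ n ] = begin
    ⟦ + (ℕ.suc m ℕ.* ℕ.suc n) ⟧           ≈⟨ ×1-homo-* (ℕ.suc m) (ℕ.suc n) ⟩
    ℕ.suc m ⋆ 1# * ℕ.suc n ⋆ 1#           ≈⟨ -‿involutive _ ⟨
    - - (ℕ.suc m ⋆ 1# * ℕ.suc n ⋆ 1#)     ≈⟨ -‿cong (-‿distribˡ-* _ _) ⟩
    - (- (ℕ.suc m ⋆ 1#) * ℕ.suc n ⋆ 1#)   ≈⟨ -‿distribʳ-* _ _ ⟩
    - (ℕ.suc m ⋆ 1#) * - (ℕ.suc n ⋆ 1#)   ∎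

  morphism : ℤ.+-*-rawRing -Raw-AlmostCommutative⟶ fromCommutativeRing R
  morphism = record { ⟦_⟧ = ⟦_⟧ ; +-homo = +homo ; *-homo = *homo ; -‿homo = -homo ; 0-homo = refl ; 1-homo =
    refl }

  _coeff≟_ : ∀ i j → Maybe (⟦ i ⟧ ≈ ⟦ j ⟧)
  i coeff≟ j with i ℤ.≟ j
  ... | yes ≡.refl = just refl
  ... | no _       = nothing

  open Algebra.Solver.Ring ℤ.+-*-rawRing (fromCommutativeRing R) morphism _coeff≟_ public
    using (solve; con; _:=_; _:+_; _:-_; _:*_; :-_)

-- Arithmetic in an ordered field

module OrderedField (ℝ : CompleteOrderedField) where

  open CompleteOrderedField ℝ public
  open CommutativeRing commutativeRing public
    using (-_; _-_; refl; sym; trans; reflexive; setoid; semiring; +-cong; +-congˡ; +-congʳ; *-cong; *-congˡ;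
      *-congʳ;
           -‿cong; +-identityˡ; +-identityʳ; *-identityˡ; *-identityʳ; zeroˡ; zeroʳ; +-comm; *-comm)
  open IsStrictTotalOrder isStrictTotalOrder public
    using (compare; asym; irrefl; <-respʳ-≈; <-respˡ-≈) renaming (trans to <-trans; _≟_ to _≈?_)
  open IntegerCoefficients commutativeRing public
    using (solve; con; _:=_; _:+_; _:-_; _:*_; :-_)
  module ≤ = ToNonStrict _≈_ _<_

  ≤-total : ∀ x y → x ≤ y ⊎ y ≤ x
  ≤-total = ≤.total compare

  ≤-trans : ∀ {x y z} → x ≤ y → y ≤ z → x ≤ z
  ≤-trans = ≤.trans (IsStrictTotalOrder.isEquivalence isStrictTotalOrder)
                    (IsStrictTotalOrder.<-resp-≈ isStrictTotalOrder) <-trans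

  <-≤-trans : ∀ {x y z} → x < y → y ≤ z → x < z
  <-≤-trans = ≤.<-≤-trans <-trans <-respʳ-≈

  ≤-<-trans : ∀ {x y z} → x ≤ y → y < z → x < z
  ≤-<-trans = ≤.≤-<-trans sym <-trans <-respˡ-≈

  ≤-or-> : ∀ x y → x ≤ y ⊎ y < x
  ≤-or-> x y with compare x y
  ... | tri< p _ _ = inj₁ (inj₁ p)
  ... | tri≈ _ p _ = inj₁ (inj₂ p)
  ... | tri> _ _ p = inj₂ p

  <⇒≱ : ∀ {x y} → x < y → ¬ y ≤ x
  <⇒≱ x<y y≤x = irrefl refl (<-≤-trans x<y y≤x)

  sub-pos : ∀ {x y} → x < y → 0# < y - x
  sub-pos {x} {y} x<y = <-respˡ-≈ (solve 1 (λ x → x :- x := con (+ 0)) refl x) (+-monoˡ-< (- x) x<y)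

  pos-sub : ∀ {x y} → 0# < y - x → x < y
  pos-sub {x} {y} p = <-respˡ-≈ (+-identityˡ x)
    (<-respʳ-≈ (solve 2 (λ x y → y :- x :+ x := y) refl x y) (+-monoˡ-< x p))

  -- Strict inequalities are proved by exhibiting y - x as a positive expression.
  <-by : ∀ {x y e} → 0# < e → e ≈ y - x → x < y
  <-by p eq = pos-sub (<-respʳ-≈ eq p)

  +-pos : ∀ {x y} → 0# < x → 0# < y → 0# < x + y
  +-pos {x} {y} p q = <-trans q (<-by p (solve 2 (λ x y → x := (x :+ y) :- y) refl x y))

  neg-pos : ∀ {x} → x < 0# → 0# < - x
  neg-pos {x} p = <-by (sub-pos p) (solve 1 (λ x → con (+ 0) :- x := :- x :- con (+ 0)) refl x)

  pos-neg : ∀ {x} → 0# < - x → x < 0#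
  pos-neg {x} p = <-by p (solve 1 (λ x → :- x := con (+ 0) :- x) refl x)

  neg-neg : ∀ {x} → 0# < x → - x < 0#
  neg-neg {x} p = <-by p (solve 1 (λ x → x := con (+ 0) :- :- x) refl x)

  neg*neg : ∀ {x y} → x < 0# → y < 0# → 0# < x * y
  neg*neg {x} {y} p q = <-respʳ-≈ (solve 2 (λ x y → :- x :* :- y := x :* y) refl x y)
    (*-pos (neg-pos p) (neg-pos q))

  pos*neg : ∀ {x y} → 0# < x → y < 0# → x * y < 0#
  pos*neg {x} {y} p q = pos-neg (<-respʳ-≈ (solve 2 (λ x y → x :* :- y := :- (x :* y)) refl x y)
    (*-pos p (neg-pos q)))

  neg*pos : ∀ {x y} → x < 0# → 0# < y → x * y < 0#
  neg*pos p q = <-respˡ-≈ (*-comm _ _) (pos*neg q p)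

  ≈-stable : ∀ {x y} → ¬ ¬ x ≈ y → x ≈ y
  ≈-stable {x} {y} nn with x ≈? y
  ... | yes e = e
  ... | no ne = contradiction ne nn

  sign : ∀ {x} → ¬ x ≈ 0# → x < 0# ⊎ 0# < x
  sign {x} x≉0 with compare x 0#
  ... | tri< p _ _ = inj₁ p
  ... | tri≈ _ p _ = contradiction p x≉0
  ... | tri> _ _ p = inj₂ p

  pos⇒≉ : ∀ {x} → 0# < x → ¬ x ≈ 0#
  pos⇒≉ p e = irrefl (sym e) p

  neg⇒≉ : ∀ {x} → x < 0# → ¬ x ≈ 0#
  neg⇒≉ p e = irrefl e p

  sq-pos : ∀ {x} → ¬ x ≈ 0# → 0# < x * x
  sq-pos x≉0 with sign x≉0
  ... | inj₁ p = neg*neg p p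
  ... | inj₂ p = *-pos p p

  sq-nonneg : ∀ x → 0# ≤ x * x
  sq-nonneg x with x ≈? 0#
  ... | yes e = inj₂ (sym (trans (*-congʳ e) (zeroˡ x)))
  ... | no ne = inj₁ (sq-pos ne)

  cancel-pos : ∀ {x y} → 0# < x → 0# < x * y → 0# < y
  cancel-pos {x} {y} p q with compare y 0#
  ... | tri< r _ _ = contradiction (pos*neg p r) (asym q)
  ... | tri≈ _ e _ = contradiction (trans (*-congˡ e) (zeroʳ x)) (pos⇒≉ q)
  ... | tri> _ _ r = r

  *-≉0 : ∀ {x y} → ¬ x ≈ 0# → ¬ y ≈ 0# → ¬ x * y ≈ 0#
  *-≉0 p q with sign p | sign q
  ... | inj₁ a | inj₁ b = pos⇒≉ (neg*neg a b)
  ... | inj₁ a | inj₂ b = neg⇒≉ (neg*pos a b)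
  ... | inj₂ a | inj₁ b = neg⇒≉ (pos*neg a b)
  ... | inj₂ a | inj₂ b = pos⇒≉ (*-pos a b)

  *-cancel-0 : ∀ {x y} → ¬ x ≈ 0# → x * y ≈ 0# → y ≈ 0#
  *-cancel-0 p e = ≈-stable λ q → *-≉0 p q e

  ¬≈0 : ∀ {x y} → x ≈ y → ¬ x ≈ 0# → ¬ y ≈ 0#
  ¬≈0 e ne e′ = ne (trans e e′)

  -- Junk value: recip x = 0 when x = 0.
  recip : Carrier → Carrier
  recip x with x ≈? 0#
  ... | yes _ = 0#
  ... | no ne = proj₁ (inverse x ne)

  *-recip : ∀ {x} → ¬ x ≈ 0# → x * recip x ≈ 1#
  *-recip {x} ne with x ≈? 0#
  ... | yes e  = contradiction e ne
  ... | no ne′ = proj₂ (inverse x ne′)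

  recip-pos : ∀ {x} → 0# < x → 0# < recip x
  recip-pos p = cancel-pos p (<-respʳ-≈ (sym (*-recip (pos⇒≉ p))) 0<1)

  2# : Carrier
  2# = 1# + 1#

  2-pos : 0# < 2#
  2-pos = +-pos 0<1 0<1

  dense : ∀ {x y} → x < y → ∃ λ z → x < z × z < y
  dense {x} {y} x<y = z , <-by pos left , <-by pos right
    where
    h = recip 2#
    z = x + (y - x) * h
    pos : 0# < (y - x) * h
    pos = *-pos (sub-pos x<y) (recip-pos 2-pos)
    left : (y - x) * h ≈ z - x
    left = solve 2 (λ x e → e := (x :+ e) :- x) refl x ((y - x) * h)
    right : (y - x) * h ≈ y - z
    -- The term `(y - x) * (1 - 2h)` vanishes because `h` is the reciprocal of 2; splitting it off
    -- leaves an identity valid for a free `h`.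
    right = trans (solve 3 (λ x y h →
      (y :- x) :* h := y :- (x :+ (y :- x) :* h) :- (y :- x) :* (con (+ 1) :- (con (+ 1) :+ con (+ 1)) :* h))
      refl x y h)
      (trans (+-congˡ (-‿cong (trans
        (*-congˡ (trans (+-congˡ (-‿cong (*-recip (pos⇒≉ 2-pos))))
        (solve 0 (con (+ 1) :- con (+ 1) := con (+ 0)) refl))) (zeroʳ _))))
        (solve 1 (λ a → a :- con (+ 0) := a) refl _))

  above : ∀ x → ∃ λ y → x < y
  above x = x + 1# , <-by 0<1 (solve 1 (λ x → con (+ 1) := (x :+ con (+ 1)) :- x) refl x)

  below : ∀ x → ∃ λ y → y < x
  below x = x - 1# , <-by 0<1 (solve 1 (λ x → con (+ 1) := x :- (x :- con (+ 1))) refl x)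

  min-pos : ∀ {x y} → 0# < x → 0# < y → ∃ λ z → 0# < z × z ≤ x × z ≤ y
  min-pos {x} {y} p q with ≤-total x y
  ... | inj₁ x≤y = x , p , inj₂ refl , x≤y
  ... | inj₂ y≤x = y , q , y≤x , inj₂ refl

-- Linear forms, their signs, and generic points

module Forms (em : ∀ {ℓ} → ExcludedMiddle ℓ) (ℝ : CompleteOrderedField) where
  open OrderedField ℝ public
  open HyperplaneArrangements ℝ using (Point)

  extremum : ∀ {n} {R : Rel (Fin n) ℓ} → Total R → Transitive R → (P : Pred (Fin n) ℓ₁) →
             (∀ i → ¬ P i) ⊎ (∃ λ i → P i × ∀ j → P j → R i j)
  extremum {n = ℕ.zero} _ _ P = inj₁ λ ()
  extremum {n = ℕ.suc n} {R} total trans P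
    with em {P = P zero} | extremum {R = λ i j → R (suc i) (suc j)} (λ i j → total (suc i) (suc j)) trans
      (P ∘ suc)
  ... | no ¬p | inj₁ none = inj₁ λ { zero p → ¬p p ; (suc i) p → none i p }
  ... | no ¬p | inj₂ (i , p , least) =
    inj₂ (suc i , p , λ { zero q → contradiction q ¬p ; (suc j) q → least j q })
  ... | yes p | inj₁ none =
    inj₂ (zero , p , λ { zero _ → Sum.[ id , id ]′ (total zero zero) ; (suc j) q → contradiction q (none j) })
  ... | yes p | inj₂ (i , q , least) with total zero (suc i)
  ...   | inj₁ r = inj₂ (zero , p ,
    λ { zero _ → Sum.[ id , id ]′ (total zero zero) ; (suc j) q′ → trans r (least j q′) })
  ...   | inj₂ r = inj₂ (suc i , q , λ { zero _ → r ; (suc j) q′ → least j q′ })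

  -- Density applies between the largest value on `L` and the smallest on `U`, and an empty side
  -- imposes no bound. This is how a down-set of crossings becomes a point on a line.
  between : ∀ {n} (t : Fin n → Carrier) {L U : Pred (Fin n) ℓ} →
            (∀ i j → L i → U j → t i < t j) →
            ∃ λ s → (∀ i → L i → t i < s) × (∀ j → U j → s < t j)
  between t {L} {U} sep
    with extremum {R = λ i j → t j ≤ t i} (λ i j → ≤-total (t j) (t i)) (λ p q → ≤-trans q p) L
       | extremum {R = λ i j → t i ≤ t j} (λ i j → ≤-total (t i) (t j)) ≤-trans U
  ... | inj₁ noL | inj₁ noU = 0# , (λ i l → contradiction l (noL i)) , λ j u → contradiction u (noU j)
  ... | inj₁ noL | inj₂ (j , u , least) = let s , s< = below (t j) in
    s , (λ i l → contradiction l (noL i)) , λ k v → <-≤-trans s< (least k v)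
  ... | inj₂ (i , l , greatest) | inj₁ noU = let s , <s = above (t i) in
    s , (λ k v → ≤-<-trans (greatest k v) <s) , λ j u → contradiction u (noU j)
  ... | inj₂ (i , l , greatest) | inj₂ (j , u , least) = let s , <s , s< = dense (sep i j l u) in
    s , (λ k v → ≤-<-trans (greatest k v) <s) , λ k v → <-≤-trans s< (least k v)

  -- Comparing signs through the product excludes zero on both sides and reduces transitivity to
  -- `(a b) (b c) = b² (a c)`.
  Same Opposite : Rel Carrier 0ℓ
  Same a b     = 0# < a * b
  Opposite a b = a * b < 0#

  same-refl : ∀ {a} → ¬ a ≈ 0# → Same a a
  same-refl = sq-pos

  same-sym : ∀ {a b} → Same a b → Same b a
  same-sym = <-respʳ-≈ (*-comm _ _)

  opp-sym : ∀ {a b} → Opposite a b → Opposite b a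
  opp-sym = <-respˡ-≈ (*-comm _ _)

  same⇒≉ˡ : ∀ {a b} → Same a b → ¬ a ≈ 0#
  same⇒≉ˡ p e = pos⇒≉ p (trans (*-congʳ e) (zeroˡ _))

  same⇒≉ʳ : ∀ {a b} → Same a b → ¬ b ≈ 0#
  same⇒≉ʳ p = same⇒≉ˡ (same-sym p)

  same-trans : ∀ {a b c} → Same a b → Same b c → Same a c
  same-trans {a} {b} {c} p q = cancel-pos (sq-pos (same⇒≉ʳ p))
    (<-respʳ-≈ (solve 3 (λ a b c → (a :* b) :* (b :* c) := (b :* b) :* (a :* c)) refl a b c) (*-pos p q))

  opp-trans : ∀ {a b c} → Opposite a b → Opposite b c → Same a c
  opp-trans {a} {b} {c} p q = cancel-pos (sq-pos (λ e → neg⇒≉ q (trans (*-congʳ e) (zeroˡ _))))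
    (<-respʳ-≈ (solve 3 (λ a b c → (a :* b) :* (b :* c) := (b :* b) :* (a :* c)) refl a b c) (neg*neg p q))

  same-opp : ∀ {a b c} → Same a b → Opposite b c → Opposite a c
  same-opp {a} {b} {c} p q = pos-neg (<-respʳ-≈ (solve 2 (λ a c → a :* :- c := :- (a :* c)) refl a c)
    (same-trans p (<-respʳ-≈ (solve 2 (λ b c → :- (b :* c) := b :* :- c) refl b c) (neg-pos q))))

  same-or-opp : ∀ {a b} → ¬ a ≈ 0# → ¬ b ≈ 0# → Opposite a b ⊎ Same a b
  same-or-opp p q = sign (*-≉0 p q)

  same-cong : ∀ {a a′ b b′} → a ≈ a′ → b ≈ b′ → Same a b → Same a′ b′
  same-cong p q = <-respʳ-≈ (*-cong p q)

  comb : ∀ {d} → Carrier → Point d → Carrier → Point d → Point d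
  comb α x β y i = α * x i + β * y i

  record Form (d : ℕ) : Set where
    field
      fn     : Point d → Carrier
      linear : ∀ α x β y → fn (comb α x β y) ≈ α * fn x + β * fn y

    step : ∀ x s v → fn (comb 1# x s v) ≈ fn x + s * fn v
    step x s v = trans (linear 1# x s v) (+-congʳ (*-identityˡ _))

  open Form public using () renaming (fn to infixr 9 _$_)
  open Form public using (linear; step)

  infixl 6 _*ᶠ_-_*ᶠ_

  _*ᶠ_-_*ᶠ_ : ∀ {d} → Carrier → Form d → Carrier → Form d → Form d
  b *ᶠ f - a *ᶠ g = record
    { fn     = λ x → b * (f $ x) - a * (g $ x)
    ; linear = λ α x β y → trans
        (+-cong (*-congˡ (linear f α x β y)) (-‿cong (*-congˡ (linear g α x β y))))
        (solve 8 (λ a b α β p q r s → b :* (α :* p :+ β :* q) :- a :* (α :* r :+ β :* s) :=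
          α :* (b :* p :- a :* r) :+ β :* (b :* q :- a :* s)) refl a b α β (f $ x) (f $ y) (g $ x) (g $ y)) }

  Vanishes : ∀ {d} → Form d → Set
  Vanishes f = ∀ x → f $ x ≈ 0#

  kernel : ∀ {d} → Form d → Pred (Point d) 0ℓ
  kernel f x = f $ x ≈ 0#

  Keeps : ∀ {d} → Point d → Point d → Pred (Form d) 0ℓ
  Keeps x x′ θ = ¬ θ $ x ≈ 0# → Same (θ $ x) (θ $ x′)

  -- With `A = θ $ x` and `B = θ $ u`, the product of the old and the new value is
  -- `A * A + ε * (A * B)`. Only `A * B < 0` limits `ε`, by `A² / C` with `C = - (A * B)`; the
  -- smallest limit serves the whole list.
  nudge : ∀ {d} (Θ : List (Form d)) (x u : Point d) → ∃ λ δ → 0# < δ ×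
          (∀ ε → 0# < ε → ε < δ → All (Keeps x (comb 1# x ε u)) Θ)
  nudge [] x u = 1# , 0<1 , λ _ _ _ → []
  nudge (θ ∷ Θ) x u =
    let δ₁ , p , keep = first
        δ₂ , q , keeps = nudge Θ x u
        δ , r , δ≤δ₁ , δ≤δ₂ = min-pos p q in
    δ , r , λ ε 0<ε ε<δ → keep ε 0<ε (<-≤-trans ε<δ δ≤δ₁) ∷ keeps ε 0<ε (<-≤-trans ε<δ δ≤δ₂)
    where
    A = θ $ x
    B = θ $ u
    expand : ∀ ε → A * A + ε * (A * B) ≈ A * (θ $ comb 1# x ε u)
    expand ε = trans (solve 3 (λ a b e → a :* a :+ e :* (a :* b) := a :* (a :+ e :* b)) refl A B ε)
      (*-congˡ (sym (step θ x ε u)))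
    first : ∃ λ δ → 0# < δ × (∀ ε → 0# < ε → ε < δ → Keeps x (comb 1# x ε u) θ)
    first with A ≈? 0# | compare (A * B) 0#
    ... | yes e | _ = 1# , 0<1 , λ _ _ _ ne → contradiction e ne
    ... | no ne | tri≈ _ e _ = 1# , 0<1 , λ ε _ _ _ → <-respʳ-≈ (trans
      (sym (trans (+-congˡ (trans (*-congˡ e) (zeroʳ ε))) (+-identityʳ _))) (expand ε)) (sq-pos ne)
    ... | no ne | tri> _ _ p = 1# , 0<1 , λ ε 0<ε _ _ →
      <-respʳ-≈ (expand ε) (+-pos (sq-pos ne) (*-pos 0<ε p))
    ... | no ne | tri< p _ _ = A * A * recip C , *-pos (sq-pos ne) (recip-pos 0<C) , λ ε 0<ε ε<δ _ →
      <-respʳ-≈ (trans (eq ε) (expand ε)) (*-pos (sub-pos ε<δ) 0<C)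
      where
      C = - (A * B)
      0<C : 0# < C
      0<C = neg-pos p
      eq : ∀ ε → (A * A * recip C - ε) * C ≈ A * A + ε * (A * B)
      eq ε = trans (solve 4 (λ a b e r → (a :* a :* r :- e) :* (:- (a :* b)) :=
          a :* a :* ((:- (a :* b)) :* r) :+ e :* (a :* b)) refl A B ε (recip C))
        (+-congʳ (trans (*-congˡ (*-recip (pos⇒≉ 0<C))) (*-identityʳ _)))

  -- A form of `Ψ` that still vanishes at the point built so far is made nonzero by a small move
  -- towards some `u` where it does not vanish; `nudge` protects `Θ` and the forms of `Ψ` already
  -- treated.
  perturb : ∀ {d} (Θ Ψ : List (Form d)) (x : Point d) → ∃ λ x′ →
            All (Keeps x x′) Θ × All (λ ψ → ¬ Vanishes ψ → ¬ ψ $ x′ ≈ 0#) Ψ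
  perturb Θ [] x = x , All.universal (λ θ → same-refl) Θ , []
  perturb Θ (ψ ∷ Ψ) x with perturb Θ Ψ x
  ... | x′ , keeps , generic with (ψ $ x′) ≈? 0# | em {P = ∃ λ u → ¬ ψ $ u ≈ 0#}
  ...   | no ne | _ = x′ , keeps , (λ _ → ne) ∷ generic
  ...   | yes _ | no none = x′ , keeps ,
    (λ nz _ → nz λ u → ≈-stable λ ne → none (u , ne)) ∷ generic
  ...   | yes e | yes (u , ne) =
    let δ , 0<δ , keep = nudge (Θ ++ Ψ) x′ u
        ε , 0<ε , ε<δ = dense 0<δ
        keepΘ , keepΨ = All.++⁻ Θ (keep ε 0<ε ε<δ) in
    comb 1# x′ ε u ,
    All.zipWith (λ (k , k′) ne → same-trans (k ne) (k′ (same⇒≉ʳ (k ne)))) (keeps , keepΘ) ,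
    (λ _ → ¬≈0 (sym (trans (step ψ x′ ε u) (trans (+-congʳ e) (+-identityˡ _)))) (*-≉0 (pos⇒≉ 0<ε) ne)) ∷
    All.zipWith (λ (g , k) nz → same⇒≉ʳ (k (g nz))) (generic , keepΨ)

  -- Walking from a generic perturbation of x in direction y, the first form
  -- to change its sign does so alone.
  facet : ∀ {d n} (φ : Fin n → Form d) {S : Subset n} →
          (∀ i j → i ∈ S → j ∈ S → i ≢ j → ¬ kernel (φ i) ≐ kernel (φ j)) →
          ∀ x y → (∀ {i} → i ∈ S → ¬ φ i $ x ≈ 0#) → (∀ {i} → i ∈ S → ¬ φ i $ y ≈ 0#) →
          (∃ λ i → i ∈ S × Opposite (φ i $ x) (φ i $ y)) →
          ∃₂ λ x′ h → h ∈ S × Opposite (φ h $ x) (φ h $ y) × Opposite (φ h $ x) (φ h $ x′) ×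
            (∀ i → i ∈ S → i ≢ h → Same (φ i $ x) (φ i $ x′))
  facet {d} {n} φ {S} distinct x y x∉ y∉ (i₀ , i₀∈S , opp₀) = result
    where
    -- For `i` and `j` in `S`, `ψ i j` vanishes at a point exactly when the line through it in
    -- direction `y` meets both hyperplanes at the same parameter. Keeping these forms nonzero at
    -- `x̃` makes the parameters `t i` distinct.
    ψ : Fin n → Fin n → Form d
    ψ i j = (φ j $ y) *ᶠ φ i - (φ i $ y) *ᶠ φ j

    Sep : Pred (Fin n) 0ℓ
    Sep i = i ∈ S × Opposite (φ i $ x) (φ i $ y)

    perturbed = perturb (List.tabulate φ) (List.concat (List.tabulate λ i → List.tabulate (ψ i))) x
    x̃ = proj₁ perturbed
    X Y t : Fin n → Carrier
    X i = φ i $ x̃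
    Y i = φ i $ y
    t i = - (X i * recip (Y i))

    keeps : ∀ {i} → i ∈ S → Same (φ i $ x) (X i)
    keeps {i} i∈S = All.tabulate⁻ (proj₁ (proj₂ perturbed)) i (x∉ i∈S)

    generic : ∀ i j → ¬ Vanishes (ψ i j) → ¬ ψ i j $ x̃ ≈ 0#
    generic i = All.tabulate⁻ (All.tabulate⁻
      (All.concat⁻ {xss = List.tabulate λ i → List.tabulate (ψ i)} (proj₂ (proj₂ perturbed))) i)

    tY : ∀ {i} → i ∈ S → t i * Y i ≈ - X i
    tY {i} i∈S = trans (solve 3 (λ x y r → :- (x :* r) :* y := :- (x :* (y :* r))) refl (X i) (Y i)
      (recip (Y i)))
      (-‿cong (trans (*-congˡ (*-recip (y∉ i∈S))) (*-identityʳ _)))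

    nonzero : ∀ {i j} → i ∈ S → j ∈ S → i ≢ j → ¬ Vanishes (ψ i j)
    nonzero {i} {j} i∈S j∈S i≢j van = distinct i j i∈S j∈S i≢j
      ( (λ {z} e → *-cancel-0 (y∉ i∈S)
        (trans (solve 2 (λ p q → q := p :- (p :- q)) refl (Y j * (φ i $ z)) (Y i * (φ j $ z)))
          (trans (+-cong (trans (*-congˡ e) (zeroʳ _)) (-‿cong (van z)))
            (solve 0 (con (+ 0) :- con (+ 0) := con (+ 0)) refl))))
      , (λ {z} e → *-cancel-0 (y∉ j∈S)
        (trans (solve 2 (λ p q → p := q :+ (p :- q)) refl (Y j * (φ i $ z)) (Y i * (φ j $ z)))
          (trans (+-cong (trans (*-congˡ e) (zeroʳ _)) (van z)) (+-identityˡ _)))) )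

    t-distinct : ∀ {i j} → i ∈ S → j ∈ S → i ≢ j → ¬ t i ≈ t j
    t-distinct {i} {j} i∈S j∈S i≢j e = generic i j (nonzero i∈S j∈S i≢j)
      (trans (+-cong (*-congˡ (neg (tY i∈S))) (-‿cong (*-congˡ (neg (tY j∈S)))))
        (trans (+-congʳ (*-congˡ (-‿cong (*-congʳ e))))
          (solve 3 (λ t yi yj → yj :* :- (t :* yi) :- yi :* :- (t :* yj) := con (+ 0)) refl (t j) (Y i) (Y j))))
      where
      neg : ∀ {a b} → a ≈ - b → b ≈ - a
      neg {a} {b} e = trans (solve 1 (λ b → b := :- :- b) refl b) (-‿cong (sym e))

    opp : ∀ {i} → Sep i → Opposite (X i) (Y i)
    opp (i∈S , o) = same-opp (same-sym (keeps i∈S)) o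

    result : _
    result with extremum {R = λ i j → t i ≤ t j} (λ i j → ≤-total (t i) (t j)) ≤-trans Sep
    ... | inj₁ none = contradiction (i₀∈S , opp₀) (none i₀)
    ... | inj₂ (h , sep@(h∈S , oppₕ) , least) =
      x′ , h , h∈S , oppₕ , same-opp (keeps h∈S) crossed , λ i i∈S i≢h → same-trans (keeps i∈S) (kept i∈S i≢h)
      where
      L U : Pred (Fin n) 0ℓ
      L i = i ≡ h
      U i = Sep i × i ≢ h

      -- `u` lies beyond the first crossing and before all others in `Sep`; hyperplanes of `S`
      -- outside `Sep` are not met at positive parameters.
      cut : ∃ λ u → (∀ i → L i → t i < u) × (∀ i → U i → u < t i)
      cut = between t λ { i j ≡.refl (sj , j≢h) → Sum.[ id ,
        (λ e → contradiction (sym e) (t-distinct (proj₁ sj) h∈S j≢h)) ]′ (least j sj) }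
      u = proj₁ cut
      x′ = comb 1# x̃ u y

      0<u : 0# < u
      0<u = <-trans (cancel-pos (sq-pos (y∉ h∈S))
        (<-respʳ-≈ (trans (solve 2 (λ x y → :- (x :* y) := y :* :- x) refl (X h) (Y h))
        (trans (*-congˡ (sym (tY h∈S))) (solve 2 (λ t y → y :* (t :* y) := y :* y :* t) refl (t h) (Y h))))
          (neg-pos (opp sep))))
        (proj₁ (proj₂ cut) h ≡.refl)

      value : ∀ i → X i * X i + u * (X i * Y i) ≈ X i * (φ i $ x′)
      value i = trans (solve 3 (λ x y u → x :* x :+ u :* (x :* y) := x :* (x :+ u :* y)) refl (X i) (Y i) u)
        (*-congˡ (sym (step (φ i) x̃ u y)))

      factor : ∀ {i} → i ∈ S → (u - t i) * (X i * Y i) ≈ X i * (φ i $ x′)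
      factor {i} i∈S = trans (solve 4 (λ x y u t → (u :- t) :* (x :* y) := u :* (x :* y) :- x :* (t :* y)) refl
        (X i) (Y i) u (t i))
        (trans (+-congˡ (-‿cong (*-congˡ (tY i∈S))))
          (trans (solve 3 (λ x y u → u :* (x :* y) :- x :* :- x := x :* x :+ u :* (x :* y)) refl (X i) (Y i) u)
            (value i)))

      crossed : Opposite (X h) (φ h $ x′)
      crossed = <-respˡ-≈ (factor h∈S) (pos*neg (sub-pos (proj₁ (proj₂ cut) h ≡.refl)) (opp sep))

      kept : ∀ {i} → i ∈ S → i ≢ h → Same (X i) (φ i $ x′)
      kept {i} i∈S i≢h with same-or-opp (x∉ i∈S) (y∉ i∈S)
      ... | inj₁ o = <-respʳ-≈ (factor i∈S) (neg*neg
        (pos-neg (<-respʳ-≈ (solve 2 (λ u t → t :- u := :- (u :- t)) refl u (t i))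
          (sub-pos (proj₂ (proj₂ cut) i ((i∈S , o) , i≢h)))))
        (opp (i∈S , o)))
      ... | inj₂ s = <-respʳ-≈ (value i) (+-pos (sq-pos (same⇒≉ʳ (keeps i∈S)))
        (*-pos 0<u (same-trans (same-sym (keeps i∈S)) s)))

-- Counting predicates on finite sets

module Counting (em : ∀ {ℓ} → ExcludedMiddle ℓ) where

  card : ∀ {n} → Pred (Fin n) ℓ → ℕ
  card {n = ℕ.zero}  P = 0
  card {n = ℕ.suc n} P with em {P = P zero}
  ... | yes _ = ℕ.suc (card (P ∘ suc))
  ... | no  _ = card (P ∘ suc)

  card-cong : ∀ {n} {P : Pred (Fin n) ℓ} {Q : Pred (Fin n) ℓ₁} → P ≐ Q → card P ≡ card Q
  card-cong {n = ℕ.zero} _ = ≡.refl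
  card-cong {n = ℕ.suc n} {P = P} {Q} (f , g) with em {P = P zero} | em {P = Q zero}
  ... | yes _ | yes _ = ≡.cong ℕ.suc (card-cong ((λ {i} → f {suc i}) , λ {i} → g {suc i}))
  ... | no _  | no _  = card-cong ((λ {i} → f {suc i}) , λ {i} → g {suc i})
  ... | yes p | no ¬q = contradiction (f p) ¬q
  ... | no ¬p | yes q = contradiction (g q) ¬p

  card-empty : ∀ {n} {P : Pred (Fin n) ℓ} → (∀ i → ¬ P i) → card P ≡ 0
  card-empty {n = ℕ.zero} _ = ≡.refl
  card-empty {n = ℕ.suc n} {P = P} none with em {P = P zero}
  ... | yes p = contradiction p (none zero)
  ... | no _  = card-empty (none ∘ suc)

  card-insert : ∀ {n} {P : Pred (Fin n) ℓ} {Q : Pred (Fin n) ℓ₁} j → ¬ P j → Q j →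
                (∀ i → i ≢ j → P i → Q i) → (∀ i → i ≢ j → Q i → P i) → card Q ≡ ℕ.suc (card P)
  card-insert {n = ℕ.suc n} {P = P} {Q} zero ¬p q f g with em {P = P zero} | em {P = Q zero}
  ... | yes p | _     = contradiction p ¬p
  ... | no _  | no ¬q = contradiction q ¬q
  ... | no _  | yes _ = ≡.cong ℕ.suc (card-cong ((λ {i} → g (suc i) λ ()) , λ {i} → f (suc i) λ ()))
  card-insert {n = ℕ.suc n} {P = P} {Q} (suc j) ¬p q f g with em {P = P zero} | em {P = Q zero}
  ... | yes p | no ¬q = contradiction (f zero (λ ()) p) ¬q
  ... | no ¬p₀ | yes q₀ = contradiction (g zero (λ ()) q₀) ¬p₀
  ... | yes _ | yes _ = ≡.cong ℕ.suc
    (card-insert j ¬p q (λ i ne → f (suc i) (ne ∘ Fin.suc-injective))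
    (λ i ne → g (suc i) (ne ∘ Fin.suc-injective)))
  ... | no _  | no _  = card-insert j ¬p q (λ i ne → f (suc i) (ne ∘ Fin.suc-injective))
    (λ i ne → g (suc i) (ne ∘ Fin.suc-injective))

-- The lattice of chambers of a tower

module Towers (em : ∀ {ℓ} → ExcludedMiddle ℓ) (ℝ : CompleteOrderedField) where
  open Forms em ℝ
  open Counting em
  open HyperplaneArrangements ℝ using (Point)

  -- Otherwise h has a zero between x and y, where g has none.
  sign-determined : ∀ {d} (h g : Form d) → (∀ x → h $ x ≈ 0# → g $ x ≈ 0#) →
                    ∀ {x y} → Same (g $ x) (g $ y) → 0# < h $ x → 0# < h $ y
  sign-determined h g ker {x} {y} same 0<hx with compare (h $ y) 0#
  ... | tri> _ _ p = p
  ... | tri≈ _ e _ = contradiction (ker y e) (same⇒≉ʳ same)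
  ... | tri< p _ _ = contradiction gz≈0 (same⇒≉ʳ {g $ x} (<-respʳ-≈ eq
      (+-pos (*-pos (neg-pos p) (sq-pos (same⇒≉ˡ same))) (*-pos 0<hx same))))
    where
    z : Point _
    z = comb (- (h $ y)) x (h $ x) y
    gz≈0 : g $ z ≈ 0#
    gz≈0 = ker z (trans (linear h _ _ _ _)
      (solve 2 (λ a b → :- b :* a :+ a :* b := con (+ 0)) refl (h $ x) (h $ y)))
    eq : - (h $ y) * ((g $ x) * (g $ x)) + (h $ x) * ((g $ x) * (g $ y)) ≈ (g $ x) * (g $ z)
    eq = trans (solve 4 (λ a b p q → :- b :* (p :* p) :+ a :* (p :* q) := p :* (:- b :* p :+ a :* q)) refl
      (h $ x) (h $ y) (g $ x) (g $ y))
      (*-congˡ (sym (linear g _ _ _ _)))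

  module Chambers {d n : ℕ} (ν : Fin n → Form d) (x₀ : Point d) (x₀∉ : ∀ i → ¬ ν i $ x₀ ≈ 0#) where

    Chamber : Subset n → Set
    Chamber S = ∃ λ x → ∀ {i} → i ∈ S → ¬ ν i $ x ≈ 0#

    -- Inv x is the separation set of x₀ and x; the order of regions turns out
    -- to be inclusion of separation sets.
    opaque
      Inv : Point d → Pred (Fin n) 0ℓ
      Inv x i = Opposite (ν i $ x₀) (ν i $ x)

      inv⇒opp : ∀ {x i} → Inv x i → Opposite (ν i $ x₀) (ν i $ x)
      inv⇒opp o = o

      opp⇒inv : ∀ {x i} → Opposite (ν i $ x₀) (ν i $ x) → Inv x i
      opp⇒inv o = o

    Below : (S : Subset n) → Rel (Chamber S) 0ℓ
    Below S (x , _) (y , _) = ∀ {i} → i ∈ S → Inv x i → Inv y i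

    Alike : (S : Subset n) → Rel (Chamber S) 0ℓ
    Alike S x y = Below S x y × Below S y x

    same? : ∀ {S} ((x , _) : Chamber S) {i} → i ∈ S → Inv x i ⊎ Same (ν i $ x₀) (ν i $ x)
    same? (x , x∉) {i} i∈S = Sum.map₁ opp⇒inv (same-or-opp (x₀∉ i) (x∉ i∈S))

    same⇒¬inv : ∀ {x i} → Same (ν i $ x₀) (ν i $ x) → ¬ Inv x i
    same⇒¬inv s o = asym s (inv⇒opp o)

    ¬inv⇒same : ∀ {S} (x : Chamber S) {i} → i ∈ S → ¬ Inv (proj₁ x) i → Same (ν i $ x₀) (ν i $ proj₁ x)
    ¬inv⇒same x i∈S ¬inv with same? x i∈S
    ... | inj₁ o = contradiction o ¬inv
    ... | inj₂ s = s

    inv-same : ∀ {x y i} → Same (ν i $ x) (ν i $ y) → Inv x i → Inv y i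
    inv-same s o = opp⇒inv (opp-sym (same-opp (same-sym s) (opp-sym (inv⇒opp o))))

    agree⇒same : ∀ {S} (x y : Chamber S) {i} → i ∈ S → (Inv (proj₁ x) i → Inv (proj₁ y) i) →
                 (Inv (proj₁ y) i → Inv (proj₁ x) i) → Same (ν i $ proj₁ x) (ν i $ proj₁ y)
    agree⇒same x y i∈S f g with same? x i∈S | same? y i∈S
    ... | inj₁ o | inj₁ o′ = opp-trans (opp-sym (inv⇒opp o)) (inv⇒opp o′)
    ... | inj₂ s | inj₂ s′ = same-trans (same-sym s) s′
    ... | inj₁ o | inj₂ s′ = contradiction (f o) (same⇒¬inv s′)
    ... | inj₂ s | inj₁ o′ = contradiction (g o′) (same⇒¬inv s)

    alike⇒same : ∀ {S} (x y : Chamber S) → Alike S x y → ∀ {i} → i ∈ S → Same (ν i $ proj₁ x) (ν i $ proj₁ y)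
    alike⇒same x y (f , g) i∈S = agree⇒same x y i∈S (f i∈S) (g i∈S)

    same⇒alike : ∀ {S} (x y : Chamber S) → (∀ {i} → i ∈ S → Same (ν i $ proj₁ x) (ν i $ proj₁ y)) → Alike S x y
    same⇒alike x y same = (λ i∈S → inv-same (same i∈S)) , λ i∈S → inv-same (same-sym (same i∈S))

    -- What the lattice construction takes from a decomposition step: ranks are replaced by the
    -- direction `v`. By `crossing`, the ray from `x₀` in direction `v` meets no hyperplane of `S₁`,
    -- so `x₀` is at an end of its fibre.
    record Fibred (S S₀ S₁ : Subset n) (v : Point d) : Set where
      field
        split    : ∀ {i} → i ∈ S → i ∈ S₀ ⊎ i ∈ S₁
        S₀⊆S     : ∀ {i} → i ∈ S₀ → i ∈ S
        S₁⊆S     : ∀ {i} → i ∈ S₁ → i ∈ S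
        parallel : ∀ {k} → k ∈ S₀ → ν k $ v ≈ 0#
        crossing : ∀ {j} → j ∈ S₁ → Same (ν j $ x₀) (ν j $ v)
        modular  : ∀ {i j} → i ∈ S₁ → j ∈ S₁ → i ≢ j → ∃ λ k → k ∈ S₀ ×
                   (∀ x → ν i $ x ≈ 0# → ν j $ x ≈ 0# → ν k $ x ≈ 0#)

    data Tower : Subset n → Set where
      ground : ∀ {S} → (∀ {i} → i ∉ S) → Tower S
      storey : ∀ {S S₀ S₁ v} → Fibred S S₀ S₁ v → Tower S₀ → Tower S

    isLatticeOf : ∀ {S} {_∨_ _∧_ : Chamber S → Chamber S → Chamber S} →
      (∀ x y → Below S x (x ∨ y)) → (∀ x y → Below S y (x ∨ y)) →
      (∀ x y z → Below S x z → Below S y z → Below S (x ∨ y) z) →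
      (∀ x y → Below S (x ∧ y) x) → (∀ x y → Below S (x ∧ y) y) →
      (∀ x y z → Below S z x → Below S z y → Below S z (x ∧ y)) →
      IsLattice (Alike S) (Below S) _∨_ _∧_
    isLatticeOf u₁ u₂ u₃ l₁ l₂ l₃ = record
      { isPartialOrder = record
          { isPreorder = record
              { isEquivalence = record
                  { refl = (λ _ o → o) , λ _ o → o
                  ; sym = λ (f , g) → g , f
                  ; trans = λ (f , g) (f′ , g′) → (λ i∈S o → f′ i∈S (f i∈S o)) , λ i∈S o → g i∈S (g′ i∈S o) }
              ; reflexive = proj₁
              ; trans = λ f g i∈S o → g i∈S (f i∈S o) }
          ; antisym = λ f g → f , g }
      ; supremum = λ x y → u₁ x y , u₂ x y , u₃ x y
      ; infimum = λ x y → l₁ x y , l₂ x y , l₃ x y }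

    module Storey {S S₀ S₁ : Subset n} {v : Point d} (F : Fibred S S₀ S₁ v) where
      open Fibred F

      crossing≉0 : ∀ {j} → j ∈ S₁ → ¬ ν j $ v ≈ 0#
      crossing≉0 j∈S₁ = same⇒≉ʳ (crossing j∈S₁)

      -- The line x + ℝ v meets the hyperplane j at x - t j x • v.
      t : Fin n → Point d → Carrier
      t j x = recip (ν j $ v) * (ν j $ x)

      t*v : ∀ {j} → j ∈ S₁ → ∀ x → t j x * (ν j $ v) ≈ ν j $ x
      t*v {j} j∈S₁ x = trans (solve 3 (λ r x v → r :* x :* v := (v :* r) :* x) refl (recip (ν j $ v)) (ν j $ x)
        (ν j $ v))
        (trans (*-congʳ (*-recip (crossing≉0 j∈S₁))) (*-identityˡ _))

      t-step : ∀ {j} → j ∈ S₁ → ∀ x s → t j (comb 1# x s v) ≈ t j x + s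
      t-step {j} j∈S₁ x s = trans (*-congˡ (step (ν j) x s v))
        (trans (solve 4 (λ r x s v → r :* (x :+ s :* v) := r :* x :+ (v :* r) :* s) refl (recip (ν j $ v))
          (ν j $ x) s (ν j $ v))
          (+-congˡ (trans (*-congʳ (*-recip (crossing≉0 j∈S₁))) (*-identityˡ _))))

      same-recip : ∀ {j} → j ∈ S₁ → Same (ν j $ x₀) (recip (ν j $ v))
      same-recip j∈S₁ = same-trans (crossing j∈S₁) (<-respʳ-≈ (sym (*-recip (crossing≉0 j∈S₁))) 0<1)

      -- Since `v` is on the side of `x₀`, the quotient `t j x` is positive on that side and
      -- negative beyond the hyperplane.
      inv⇒t : ∀ {j x} → j ∈ S₁ → Inv x j → t j x < 0#
      inv⇒t j∈S₁ o = same-opp (same-sym (same-recip j∈S₁)) (inv⇒opp o)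

      t⇒inv : ∀ {j x} → j ∈ S₁ → t j x < 0# → Inv x j
      t⇒inv j∈S₁ t<0 = opp⇒inv (same-opp (same-recip j∈S₁) t<0)

      ρ : Chamber S → Chamber S₀
      ρ (x , x∉) = x , λ k∈S₀ → x∉ (S₀⊆S k∈S₀)

      difference : Fin n → Fin n → Form d
      difference i j = recip (ν j $ v) *ᶠ ν j - recip (ν i $ v) *ᶠ ν i

      -- If `t i x = t j x`, the line `x + ℝ v` meets both hyperplanes in the same point, which
      -- therefore lies on `Hₖ`; as `v` is parallel to `Hₖ`, so does `x`.
      difference-kernel : ∀ {i j} (i∈S₁ : i ∈ S₁) (j∈S₁ : j ∈ S₁) (i≢j : i ≢ j) → ∀ x →
                          difference i j $ x ≈ 0# → ν (proj₁ (modular i∈S₁ j∈S₁ i≢j)) $ x ≈ 0#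
      difference-kernel {i} {j} i∈S₁ j∈S₁ i≢j x e = trans
        (sym (trans (step (ν k) x s v)
          (trans (+-congˡ (trans (*-congˡ (parallel k∈S₀)) (zeroʳ s))) (+-identityʳ _))))
        (ker y (trans (step (ν i) x s v) (trans (+-congʳ (sym (t*v i∈S₁ x)))
                 (solve 2 (λ t v → t :* v :+ :- t :* v := con (+ 0)) refl (t i x) (ν i $ v))))
               (trans (step (ν j) x s v) (trans (+-congʳ (sym (t*v j∈S₁ x)))
                 (trans (solve 3 (λ t t′ v → t :* v :+ :- t′ :* v := (t :- t′) :* v) refl (t j x) (t i x)
                   (ν j $ v))
                   (trans (*-congʳ e) (zeroˡ _))))))
        where
        k = proj₁ (modular i∈S₁ j∈S₁ i≢j)
        k∈S₀ = proj₁ (proj₂ (modular i∈S₁ j∈S₁ i≢j))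
        ker = proj₂ (proj₂ (modular i∈S₁ j∈S₁ i≢j))
        s = - t i x
        y = comb 1# x s v

      t-distinct : ∀ {i j} → i ∈ S₁ → j ∈ S₁ → i ≢ j → ((q , _) : Chamber S₀) → ¬ t i q ≈ t j q
      t-distinct {i} {j} i∈S₁ j∈S₁ i≢j (q , q∉) e = q∉ (proj₁ (proj₂ (modular i∈S₁ j∈S₁ i≢j)))
        (difference-kernel i∈S₁ j∈S₁ i≢j q
          (trans (+-congˡ (-‿cong e)) (solve 1 (λ a → a :- a := con (+ 0)) refl (t j q))))

      t-strict : ∀ {i j} → i ∈ S₁ → j ∈ S₁ → i ≢ j → ((q , _) : Chamber S₀) → t i q ≤ t j q → t i q < t j q
      t-strict i∈S₁ j∈S₁ i≢j q = Sum.[ id , (λ e → contradiction e (t-distinct i∈S₁ j∈S₁ i≢j q)) ]′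

      -- By `sign-determined`, `t j - t i` keeps its sign as long as the form `k` of the pair does.
      -- The second alternative hands `k` out so that the sides of further regions can be compared
      -- with that of `q`.
      exchange : ∀ {i j} → i ∈ S₁ → j ∈ S₁ → i ≢ j → ((q , _) (q′ , _) : Chamber S₀) → t i q < t j q →
                 t i q′ < t j q′ ⊎
                 (∃ λ k → k ∈ S₀ × Opposite (ν k $ q) (ν k $ q′) ×
                   (∀ q″ → Same (ν k $ q) (ν k $ q″) → t i q″ < t j q″))
      exchange {i} {j} i∈S₁ j∈S₁ i≢j (q , q∉) (q′ , q′∉) p = go
        where
        k = proj₁ (modular i∈S₁ j∈S₁ i≢j)
        k∈S₀ = proj₁ (proj₂ (modular i∈S₁ j∈S₁ i≢j))
        order : ∀ q″ → Same (ν k $ q) (ν k $ q″) → t i q″ < t j q″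
        order q″ same = pos-sub (sign-determined (difference i j) (ν k) (difference-kernel i∈S₁ j∈S₁ i≢j) {q}
          {q″} same (sub-pos p))
        go : _
        go with same-or-opp (q∉ k∈S₀) (q′∉ k∈S₀)
        ... | inj₁ o = inj₂ (k , k∈S₀ , o , order)
        ... | inj₂ s = inj₁ (order q′ s)

      inv-down : ∀ {i j x} → i ∈ S₁ → j ∈ S₁ → t j x ≤ t i x → Inv x i → Inv x j
      inv-down i∈S₁ j∈S₁ le o = t⇒inv j∈S₁ (≤-<-trans le (inv⇒t i∈S₁ o))

      record Realisation (q : Chamber S₀) (D : Pred (Fin n) 0ℓ) : Set where
        field
          chamber : Chamber S
          over    : ∀ {k} → k ∈ S₀ → ν k $ proj₁ chamber ≈ ν k $ proj₁ q
          inv     : ∀ {j} → j ∈ S₁ → D j → Inv (proj₁ chamber) j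
          inv⁻    : ∀ {j} → j ∈ S₁ → Inv (proj₁ chamber) j → D j

        over-same : ∀ {k} → k ∈ S₀ → Same (ν k $ proj₁ q) (ν k $ proj₁ chamber)
        over-same k∈S₀ = same-cong refl (sym (over k∈S₀)) (same-refl (proj₂ q k∈S₀))

        down : Below S₀ (ρ chamber) q
        down k∈S₀ = inv-same (same-sym (over-same k∈S₀))

        up : Below S₀ q (ρ chamber)
        up k∈S₀ = inv-same (over-same k∈S₀)

      -- Passing from `q` to `q - s v` lowers every `t j` by `s` and fixes the forms of `S₀`. With
      -- `s` between the values on `D` and those off `D`, exactly the members of `D` become
      -- negative.
      realise : (q : Chamber S₀) (D : Pred (Fin n) 0ℓ) →
                (∀ {i j} → i ∈ S₁ → j ∈ S₁ → D i → ¬ D j → t i (proj₁ q) < t j (proj₁ q)) → Realisation q D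
      realise (q , q∉) D downset = record
        { chamber = x , λ i∈S → Sum.[ (λ k∈S₀ → ¬≈0 (sym (over k∈S₀)) (q∉ k∈S₀)) , x∉₁ ]′ (split i∈S)
        ; over = over ; inv = inv ; inv⁻ = inv⁻ }
        where
        cut = between (λ j → t j q) {λ i → i ∈ S₁ × D i} {λ j → j ∈ S₁ × ¬ D j}
                (λ { i j (i∈S₁ , Di) (j∈S₁ , ¬Dj) → downset i∈S₁ j∈S₁ Di ¬Dj })
        s = proj₁ cut
        x = comb 1# q (- s) v
        over : ∀ {k} → k ∈ S₀ → ν k $ x ≈ ν k $ q
        over {k} k∈S₀ = trans (step (ν k) q (- s) v)
          (trans (+-congˡ (trans (*-congˡ (parallel k∈S₀)) (zeroʳ _))) (+-identityʳ _))
        inv : ∀ {j} → j ∈ S₁ → D j → Inv x j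
        inv {j} j∈S₁ Dj = t⇒inv j∈S₁ (<-respˡ-≈ (sym (t-step j∈S₁ q (- s)))
          (<-by (sub-pos (proj₁ (proj₂ cut) j (j∈S₁ , Dj)))
            (solve 2 (λ s t → s :- t := con (+ 0) :- (t :+ :- s)) refl s (t j q))))
        notD : ∀ {j} → j ∈ S₁ → ¬ D j → 0# < t j x
        notD {j} j∈S₁ ¬Dj = <-respʳ-≈ (sym (t-step j∈S₁ q (- s))) (sub-pos (proj₂ (proj₂ cut) j (j∈S₁ , ¬Dj)))
        inv⁻ : ∀ {j} → j ∈ S₁ → Inv x j → D j
        inv⁻ {j} j∈S₁ o with em {P = D j}
        ... | yes Dj = Dj
        ... | no ¬Dj = contradiction (inv⇒t j∈S₁ o) (asym (notD j∈S₁ ¬Dj))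
        x∉₁ : ∀ {j} → j ∈ S₁ → ¬ ν j $ x ≈ 0#
        x∉₁ {j} j∈S₁ e with em {P = D j}
        ... | yes Dj = neg⇒≉ (inv⇒opp (inv j∈S₁ Dj)) (trans (*-congˡ e) (zeroʳ _))
        ... | no ¬Dj = pos⇒≉ (notD j∈S₁ ¬Dj) (trans (*-congˡ e) (zeroʳ _))

      -- If k reverses the order of i and j between q and w, then q and x lie
      -- on the same side of k, so the order at q is also the order at x.
      inv-transfer : (x w : Chamber S) (q : Chamber S₀) → Below S₀ (ρ x) q → Below S₀ q (ρ w) → Below S x w →
                     ∀ {i j} → i ∈ S₁ → j ∈ S₁ → Inv (proj₁ x) i → t j (proj₁ q) ≤ t i (proj₁ q) →
                       Inv (proj₁ w) j
      inv-transfer x w q x⊑q q⊑w x⊑w {i} {j} i∈S₁ j∈S₁ o le = go (j Fin.≟ i)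
        where
        go : Dec (j ≡ i) → Inv (proj₁ w) j
        go (yes ≡.refl) = x⊑w (S₁⊆S i∈S₁) o
        go (no j≢i) = Sum.[ (λ lt → inv-down i∈S₁ j∈S₁ (inj₁ lt) (x⊑w (S₁⊆S i∈S₁) o))
          , (λ (k , k∈S₀ , opp , order) → x⊑w (S₁⊆S j∈S₁) (inv-down i∈S₁ j∈S₁ (inj₁ (order (proj₁ x)
              (agree⇒same q (ρ x) k∈S₀
                (λ qk → contradiction opp (asym (opp-trans (opp-sym (inv⇒opp qk)) (inv⇒opp (q⊑w k∈S₀ qk)))))
                (x⊑q k∈S₀)))) o)) ]′
          (exchange j∈S₁ i∈S₁ j≢i q (ρ w) (t-strict j∈S₁ i∈S₁ j≢i q le))

      -- The mirror image: a `k` with `q` and `w` on different sides separates `q`, but not `w`,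
      -- from `x₀`. Since `q` is below `x`, it separates `x` from `x₀` too, so the order at `q` is
      -- still the order at `x`.
      ¬inv-transfer : (x w : Chamber S) (q : Chamber S₀) → Below S₀ q (ρ x) → Below S₀ (ρ w) q → Below S w x →
                      ∀ {i j} → i ∈ S₁ → j ∈ S₁ → ¬ Inv (proj₁ x) i → t i (proj₁ q) ≤ t j (proj₁ q) →
                        ¬ Inv (proj₁ w) j
      ¬inv-transfer x w q q⊑x w⊑q w⊑x {i} {j} i∈S₁ j∈S₁ ¬o le wj = go (i Fin.≟ j)
        where
        go : Dec (i ≡ j) → ⊥
        go (yes ≡.refl) = ¬o (w⊑x (S₁⊆S i∈S₁) wj)
        go (no i≢j) = Sum.[ (λ lt → ¬o (w⊑x (S₁⊆S i∈S₁) (inv-down j∈S₁ i∈S₁ (inj₁ lt) wj)))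
          , (λ (k , k∈S₀ , opp , order) → ¬o (inv-down j∈S₁ i∈S₁ (inj₁ (order (proj₁ x)
              (agree⇒same q (ρ x) k∈S₀ (q⊑x k∈S₀) (λ _ → Sum.[ id , (λ s → contradiction opp (asym
                (same-trans (same-sym s) (¬inv⇒same (ρ w) k∈S₀ (λ wk → same⇒¬inv s (w⊑q k∈S₀ wk)))))) ]′
                  (same? q k∈S₀)))))
              (w⊑x (S₁⊆S j∈S₁) wj))) ]′
          (exchange i∈S₁ j∈S₁ i≢j q (ρ w) (t-strict i∈S₁ j∈S₁ i≢j q le))

      below-by : (x y : Chamber S) → Below S₀ (ρ x) (ρ y) →
        (∀ {j} → j ∈ S₁ → Inv (proj₁ x) j → Inv (proj₁ y) j) → Below S x y
      below-by x y f g i∈S = Sum.[ f , g ]′ (split i∈S)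

      restrict : (x y : Chamber S) → Below S x y → Below S₀ (ρ x) (ρ y)
      restrict x y f k∈S₀ = f (S₀⊆S k∈S₀)

      module Operations {_∨₀_ _∧₀_ : Chamber S₀ → Chamber S₀ → Chamber S₀}
                        (L₀ : IsLattice (Alike S₀) (Below S₀) _∨₀_ _∧₀_) where
        private module L₀ = IsLattice L₀

        join : (x y : Chamber S) → Realisation (ρ x ∨₀ ρ y)
               (λ j → ∃ λ i → i ∈ S₁ × (Inv (proj₁ x) i ⊎ Inv (proj₁ y) i) ×
                 t j (proj₁ (ρ x ∨₀ ρ y)) ≤ t i (proj₁ (ρ x ∨₀ ρ y)))
        join x y = realise _ _ λ { {i} {j} i∈S₁ j∈S₁ (k , k∈S₁ , o , le) ¬Dj →
          Sum.[ (λ le′ → contradiction (k , k∈S₁ , o , ≤-trans le′ le) ¬Dj) , id ]′ (≤-or-> (t j _) (t i _)) }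

        -- The complement of the up-set generated by what `x` or `y` has not crossed, in the order
        -- at `ρ x ∧₀ ρ y`, is the largest down-set contained in both separation sets.
        meet : (x y : Chamber S) → Realisation (ρ x ∧₀ ρ y)
               (λ j → ¬ ∃ λ i → i ∈ S₁ × (¬ Inv (proj₁ x) i ⊎ ¬ Inv (proj₁ y) i) ×
                 t i (proj₁ (ρ x ∧₀ ρ y)) ≤ t j (proj₁ (ρ x ∧₀ ρ y)))
        meet x y = realise _ _ λ { {i} {j} i∈S₁ j∈S₁ Di ¬Dj →
          Sum.[ (λ le′ → contradiction (λ { (k , k∈S₁ , o , le) → Di (k , k∈S₁ , o , ≤-trans le le′) }) ¬Dj) ,
            id ]′
            (≤-or-> (t j _) (t i _)) }

        infixr 6 _∨_
        infixr 7 _∧_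
        _∨_ _∧_ : Chamber S → Chamber S → Chamber S
        x ∨ y = Realisation.chamber (join x y)
        x ∧ y = Realisation.chamber (meet x y)

        isLattice : IsLattice (Alike S) (Below S) _∨_ _∧_
        isLattice = isLatticeOf
          (λ x y → let open Realisation (join x y) in below-by x (x ∨ y)
            (L₀.trans {ρ x} {ρ x ∨₀ ρ y} {ρ (x ∨ y)} (L₀.x≤x∨y (ρ x) (ρ y)) up)
            λ j∈S₁ o → inv j∈S₁ (_ , j∈S₁ , inj₁ o , inj₂ refl))
          (λ x y → let open Realisation (join x y) in below-by y (x ∨ y)
            (L₀.trans {ρ y} {ρ x ∨₀ ρ y} {ρ (x ∨ y)} (L₀.y≤x∨y (ρ x) (ρ y)) up)
            λ j∈S₁ o → inv j∈S₁ (_ , j∈S₁ , inj₂ o , inj₂ refl))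
          (λ x y z x⊑z y⊑z → let open Realisation (join x y)
                                 q⊑z = L₀.∨-least {ρ x} {ρ y} {ρ z} (restrict x z x⊑z) (restrict y z y⊑z) in
            below-by (x ∨ y) z (L₀.trans {ρ (x ∨ y)} {ρ x ∨₀ ρ y} {ρ z} down q⊑z)
            λ j∈S₁ o → case-join x y z x⊑z y⊑z (λ {k} → q⊑z {k}) j∈S₁ (inv⁻ j∈S₁ o))
          (λ x y → let open Realisation (meet x y) in below-by (x ∧ y) x
            (L₀.trans {ρ (x ∧ y)} {ρ x ∧₀ ρ y} {ρ x} down (L₀.x∧y≤x (ρ x) (ρ y)))
            λ j∈S₁ o → Sum.[ id , (λ s → contradiction (_ , j∈S₁ , inj₁ (same⇒¬inv s) , inj₂ refl)
              (inv⁻ j∈S₁ o)) ]′ (same? x (S₁⊆S j∈S₁)))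
          (λ x y → let open Realisation (meet x y) in below-by (x ∧ y) y
            (L₀.trans {ρ (x ∧ y)} {ρ x ∧₀ ρ y} {ρ y} down (L₀.x∧y≤y (ρ x) (ρ y)))
            λ j∈S₁ o → Sum.[ id , (λ s → contradiction (_ , j∈S₁ , inj₂ (same⇒¬inv s) , inj₂ refl)
              (inv⁻ j∈S₁ o)) ]′ (same? y (S₁⊆S j∈S₁)))
          (λ x y z z⊑x z⊑y → let open Realisation (meet x y)
                                 z⊑q = L₀.∧-greatest {ρ z} {ρ x} {ρ y} (restrict z x z⊑x) (restrict z y z⊑y) in
            below-by z (x ∧ y) (L₀.trans {ρ z} {ρ x ∧₀ ρ y} {ρ (x ∧ y)} z⊑q up)
            λ j∈S₁ o → inv j∈S₁ λ
              { (i , i∈S₁ , inj₁ ¬o , le) → ¬inv-transfer x z (ρ x ∧₀ ρ y) (L₀.x∧y≤x (ρ x) (ρ y)) z⊑q z⊑x i∈S₁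
                j∈S₁ ¬o le o
              ; (i , i∈S₁ , inj₂ ¬o , le) → ¬inv-transfer y z (ρ x ∧₀ ρ y) (L₀.x∧y≤y (ρ x) (ρ y)) z⊑q z⊑y i∈S₁
                j∈S₁ ¬o le o })
          where
          case-join : ∀ x y z → Below S x z → Below S y z → Below S₀ (ρ x ∨₀ ρ y) (ρ z) → ∀ {j} → j ∈ S₁ →
            (∃ λ i → i ∈ S₁ × (Inv (proj₁ x) i ⊎ Inv (proj₁ y) i) ×
                 t j (proj₁ (ρ x ∨₀ ρ y)) ≤ t i (proj₁ (ρ x ∨₀ ρ y))) → Inv (proj₁ z) j
          case-join x y z x⊑z y⊑z q⊑z j∈S₁ (i , i∈S₁ , inj₁ o , le) =
            inv-transfer x z (ρ x ∨₀ ρ y) (L₀.x≤x∨y (ρ x) (ρ y)) q⊑z x⊑z i∈S₁ j∈S₁ o le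
          case-join x y z x⊑z y⊑z q⊑z j∈S₁ (i , i∈S₁ , inj₂ o , le) =
            inv-transfer y z (ρ x ∨₀ ρ y) (L₀.y≤x∨y (ρ x) (ρ y)) q⊑z y⊑z i∈S₁ j∈S₁ o le

      bottom topmost : (q : Chamber S₀) → ∃ λ D → Realisation q D
      bottom q = (λ _ → ⊥) , realise q _ λ _ _ ()
      topmost q = (λ _ → Unit) , realise q _ λ _ _ _ ¬⊤ → contradiction tt ¬⊤

      bot top : Chamber S₀ → Chamber S
      bot q = Realisation.chamber (proj₂ (bottom q))
      top q = Realisation.chamber (proj₂ (topmost q))

-- Fibres as saturated chains, and the induction over towers

module TowerPaths (em : ∀ {ℓ} → ExcludedMiddle ℓ) (ℝ : CompleteOrderedField) where
  open Forms em ℝ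
  open Counting em
  open Towers em ℝ
  open HyperplaneArrangements ℝ using (Point)

  module ChamberPaths {d n : ℕ} (ν : Fin n → Form d) (x₀ : Point d) (x₀∉ : ∀ i → ¬ ν i $ x₀ ≈ 0#) where
    open Chambers ν x₀ x₀∉

    alike-refl : ∀ {S} (x : Chamber S) → Alike S x x
    alike-refl x = (λ _ o → o) , λ _ o → o

    alike-trans : ∀ {S} (x y z : Chamber S) → Alike S x y → Alike S y z → Alike S x z
    alike-trans x y z (f , f′) (g , g′) = (λ i∈S o → g i∈S (f i∈S o)) , λ i∈S o → f′ i∈S (g′ i∈S o)

    inv-stable : ∀ {S} (x : Chamber S) {i} → i ∈ S → ¬ ¬ Inv (proj₁ x) i → Inv (proj₁ x) i
    inv-stable x i∈S nn = Sum.[ id , (λ s → contradiction (same⇒¬inv s) nn) ]′ (same? x i∈S)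

    not-below : ∀ {S} (x y : Chamber S) → ¬ Below S x y → ∃ λ i → i ∈ S × Inv (proj₁ x) i × ¬ Inv (proj₁ y) i
    not-below {S} x y nb with em {P = ∃ λ i → i ∈ S × Inv (proj₁ x) i × ¬ Inv (proj₁ y) i}
    ... | yes p = p
    ... | no np = contradiction (λ {i} i∈S o → inv-stable y i∈S λ ¬o → np (i , i∈S , o , ¬o)) nb

    module StoreyPaths {S S₀ S₁ : Subset n} {v : Point d} (F : Fibred S S₀ S₁ v) where
      open Fibred F
      open Storey F

      _⋖_ : Rel (Chamber S) 0ℓ
      _⋖_ = CoverPair (Alike S) (Below S)

      record Ascent (x : Chamber S) : Set where
        field
          {y}      : Chamber S
          {xs}     : List (Chamber S)
          path     : Path _⋖_ x y xs
          complete : ∀ {j} → j ∈ S₁ → Inv (proj₁ y) j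
          over     : All (λ z → Alike S₀ (ρ z) (ρ x)) xs
          covering : ∀ z → Alike S₀ (ρ z) (ρ x) → Below S x z → Any (Alike S z) xs

      Uncrossed : Chamber S → Pred (Fin n) 0ℓ
      Uncrossed x j = j ∈ S₁ × ¬ Inv (proj₁ x) j

      -- `j` is the first hyperplane still to be crossed when `x` moves along `- v`; its minimality
      -- makes the separation set extended by `j` a down-set, hence realisable.
      module Climb (x : Chamber S) (j : Fin n) (j∈S₁ : j ∈ S₁) (¬xj : ¬ Inv (proj₁ x) j)
                   (least : ∀ i → Uncrossed x i → t j (proj₁ x) ≤ t i (proj₁ x)) where

        D : Pred (Fin n) 0ℓ
        D i = Inv (proj₁ x) i ⊎ i ≡ j

        downset : ∀ {i k} → i ∈ S₁ → k ∈ S₁ → D i → ¬ D k → t i (proj₁ x) < t k (proj₁ x)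
        downset {i} {k} i∈S₁ k∈S₁ (inj₁ o) ¬Dk =
          Sum.[ (λ le → contradiction (inj₁ (inv-down i∈S₁ k∈S₁ le o)) ¬Dk) , id ]′
          (≤-or-> (t k (proj₁ x)) (t i (proj₁ x)))
        downset {i} {k} i∈S₁ k∈S₁ (inj₂ ≡.refl) ¬Dk =
          t-strict i∈S₁ k∈S₁ (λ i≡k → ¬Dk (inj₂ (≡.sym i≡k))) (ρ x) (least k (k∈S₁ , λ o → ¬Dk (inj₁ o)))

        R : Realisation (ρ x) D
        R = realise (ρ x) D downset
        open Realisation R public using (inv; inv⁻; up; down) renaming (chamber to x′)

        xj′ : Inv (proj₁ x′) j
        xj′ = inv j∈S₁ (inj₂ ≡.refl)

        x⊑x′ : Below S x x′
        x⊑x′ = below-by x x′ up λ i∈S₁ o → inv i∈S₁ (inj₁ o)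

        inv⁻′ : ∀ {i} → i ∈ S → Inv (proj₁ x′) i → i ≢ j → Inv (proj₁ x) i
        inv⁻′ i∈S o i≢j = Sum.[ (λ i∈S₀ → down i∈S₀ o)
                             , (λ i∈S₁ → Sum.[ id , (λ e → contradiction e i≢j) ]′ (inv⁻ i∈S₁ o)) ]′ (split i∈S)

        -- The separation sets differ only in `j`, and an intermediate region has either crossed `j`
        -- or not.
        cover : x ⋖ x′
        cover = (x⊑x′ , λ (_ , x′⊑x) → ¬xj (x′⊑x (S₁⊆S j∈S₁) xj′)) ,
          λ (z , (x⊑z , x≄z) , (z⊑x′ , z≄x′)) → case z x⊑z x≄z z⊑x′ z≄x′ (em {P = Inv (proj₁ z) j})
          where
          case : ∀ z → Below S x z → ¬ Alike S x z → Below S z x′ → ¬ Alike S z x′ → Dec (Inv (proj₁ z) j) → ⊥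
          case z x⊑z x≄z z⊑x′ z≄x′ (yes zj) = z≄x′ (z⊑x′ , λ {i} i∈S o → case₂ i∈S o (i Fin.≟ j))
            where
            case₂ : ∀ {i} → i ∈ S → Inv (proj₁ x′) i → Dec (i ≡ j) → Inv (proj₁ z) i
            case₂ i∈S o (yes ≡.refl) = zj
            case₂ i∈S o (no i≢j)     = x⊑z i∈S (inv⁻′ i∈S o i≢j)
          case z x⊑z x≄z z⊑x′ z≄x′ (no ¬zj) =
            x≄z (x⊑z , λ { {i} i∈S o → inv⁻′ i∈S (z⊑x′ i∈S o) λ { ≡.refl → ¬zj o } })

        -- Such a `z` has crossed some `i` of `S₁` that `x` has not. In one fibre the order on `S₁`
        -- is constant, and there `j` equals or precedes `i`, so `z` has crossed `j` as well.
        x′⊑ : ∀ z → Alike S₀ (ρ z) (ρ x) → Below S x z → ¬ Below S z x → Below S x′ z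
        x′⊑ z (zx , xz) x⊑z z⋢x = go (not-below z x z⋢x)
          where
          go : (∃ λ i → i ∈ S × Inv (proj₁ z) i × ¬ Inv (proj₁ x) i) → Below S x′ z
          go (i , i∈S , zi , ¬xi) = below-by x′ z (λ k∈S₀ o → xz k∈S₀ (down k∈S₀ o))
              λ k∈S₁ o → Sum.[ x⊑z (S₁⊆S k∈S₁) , (λ { ≡.refl → zj (j Fin.≟ i) }) ]′ (inv⁻ k∈S₁ o)
            where
            i∈S₁ : i ∈ S₁
            i∈S₁ = Sum.[ (λ i∈S₀ → contradiction (zx i∈S₀ zi) ¬xi) , id ]′ (split i∈S)
            zj : Dec (j ≡ i) → Inv (proj₁ z) j
            zj (yes ≡.refl) = zi
            zj (no j≢i) = Sum.[ (λ lt → inv-down i∈S₁ j∈S₁ (inj₁ lt) zi)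
              , (λ (k , k∈S₀ , opp , _) → contradiction opp (asym (alike⇒same (ρ x) (ρ z) (xz , zx) k∈S₀))) ]′
              (exchange j∈S₁ i∈S₁ j≢i (ρ x) (ρ z) (t-strict j∈S₁ i∈S₁ j≢i (ρ x) (least i (i∈S₁ , ¬xi))))

        fewer : card (Uncrossed x) ≡ ℕ.suc (card (Uncrossed x′))
        fewer = card-insert {P = Uncrossed x′} {Q = Uncrossed x} j (λ (_ , ¬o) → ¬o xj′) (j∈S₁ , ¬xj)
            (λ i _ (i∈S₁ , ¬o) → i∈S₁ , λ o → ¬o (x⊑x′ (S₁⊆S i∈S₁) o))
            (λ i i≢j (i∈S₁ , ¬o) → i∈S₁ , λ o → ¬o (inv⁻′ (S₁⊆S i∈S₁) o i≢j))

        next : Ascent x′ → Ascent x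
        next A′ = record
          { path = cover ∷ A′.path
          ; complete = A′.complete
          ; over = alike-refl (ρ x) ∷ All.map (λ {z} zx′ → alike-trans (ρ z) (ρ x′) (ρ x) zx′ (down , up))
            A′.over
          ; covering = λ z (zx , xz) x⊑z → cov z zx xz x⊑z em }
          where
          module A′ = Ascent A′
          cov : ∀ z → Below S₀ (ρ z) (ρ x) → Below S₀ (ρ x) (ρ z) → Below S x z → Dec (Below S z x) →
            Any (Alike S z) (x ∷ A′.xs)
          cov z zx xz x⊑z (yes z⊑x) = here (z⊑x , x⊑z)
          cov z zx xz x⊑z (no z⋢x) = there
            (A′.covering z ((λ k∈S₀ o → up k∈S₀ (zx k∈S₀ o)) , λ k∈S₀ o → xz k∈S₀ (down k∈S₀ o))
                                 (x′⊑ z (zx , xz) x⊑z z⋢x))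

      lowest : ∀ x → (∀ i → ¬ Uncrossed x i) ⊎
               (∃ λ j → Uncrossed x j × ∀ i → Uncrossed x i → t j (proj₁ x) ≤ t i (proj₁ x))
      lowest x = extremum {R = λ i j → t i (proj₁ x) ≤ t j (proj₁ x)}
        (λ i j → ≤-total (t i (proj₁ x)) (t j (proj₁ x))) ≤-trans (Uncrossed x)

      arrived : ∀ x → (∀ i → ¬ Uncrossed x i) → Ascent x
      arrived x none = record
        { path = [ x ]
        ; complete = full
        ; over = alike-refl (ρ x) ∷ []
        ; covering = λ z (zx , _) x⊑z → here (below-by z x zx (λ j∈S₁ _ → full j∈S₁) , x⊑z) }
        where
        full : ∀ {j} → j ∈ S₁ → Inv (proj₁ x) j
        full {j} j∈S₁ = inv-stable x (S₁⊆S j∈S₁) λ ¬o → none j (j∈S₁ , ¬o)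

      ascend : ∀ m x → card (Uncrossed x) ≡ m → Ascent x
      ascend ℕ.zero x m≡ = Sum.[ arrived x
        , (λ (j , (j∈S₁ , ¬xj) , least) →
          contradiction (≡.trans (≡.sym m≡) (Climb.fewer x j j∈S₁ ¬xj least)) λ ()) ]′ (lowest x)
      ascend (ℕ.suc m) x m≡ = Sum.[ arrived x
        , (λ (j , (j∈S₁ , ¬xj) , least) → let open Climb x j j∈S₁ ¬xj least in
            next (ascend m x′ (ℕ.suc-injective (≡.trans (≡.sym fewer) m≡)))) ]′ (lowest x)

      module _ {_∨₀_ _∧₀_ : Chamber S₀ → Chamber S₀ → Chamber S₀}
               (L₀ : IsLattice (Alike S₀) (Below S₀) _∨₀_ _∧₀_) where
        open Operations L₀

        fibration : Fibration isLattice L₀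
        fibration = record
          { ρ = ρ ; bot = bot ; top = top
          ; ρ-mono = λ {x} {y} → restrict x y
          ; ρ-bot = λ q → Realisation.down (proj₂ (bottom q)) , Realisation.up (proj₂ (bottom q))
          ; ρ-top = λ q → Realisation.down (proj₂ (topmost q)) , Realisation.up (proj₂ (topmost q))
          ; bot-least = λ {q} {x} q⊑x → below-by (bot q) x
              (λ k∈S₀ o → q⊑x k∈S₀ (Realisation.down (proj₂ (bottom q)) k∈S₀ o))
              (λ j∈S₁ o → ⊥-elim (Realisation.inv⁻ (proj₂ (bottom q)) j∈S₁ o))
          ; top-great = λ {x} {q} x⊑q → below-by x (top q)
              (λ k∈S₀ o → Realisation.up (proj₂ (topmost q)) k∈S₀ (x⊑q k∈S₀ o))
              (λ j∈S₁ _ → Realisation.inv (proj₂ (topmost q)) j∈S₁ tt)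
          ; bot-down = λ {x} {q} x⊑ → below-by x (bot (ρ x))
              (Realisation.up (proj₂ (bottom (ρ x))))
              (λ j∈S₁ o → ⊥-elim (Realisation.inv⁻ (proj₂ (bottom q)) j∈S₁ (x⊑ (S₁⊆S j∈S₁) o)))
          ; top-up = λ {q} {x} ⊑x → below-by (top (ρ x)) x
              (Realisation.down (proj₂ (topmost (ρ x))))
              (λ j∈S₁ _ → ⊑x (S₁⊆S j∈S₁) (Realisation.inv (proj₂ (topmost q)) j∈S₁ tt))
          ; fibre = fibre }
          where
          fibre : ∀ q → ∃ λ x → ∃ λ y → ∃ λ xs →
                  Path _⋖_ x y xs × Alike S x (bot q) × Alike S y (top q) ×
                  All (λ z → Alike S₀ (ρ z) q) xs × (∀ z → Alike S₀ (ρ z) q → Any (Alike S z) xs)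
          fibre q = bot q , Asc.y , Asc.xs , Asc.path , alike-refl (bot q) ,
            ( below-by Asc.y (top q) (λ k∈S₀ o → Top.up k∈S₀ (Bot.down k∈S₀ (yx k∈S₀ o)))
              (λ j∈S₁ _ → Top.inv j∈S₁ tt)
            , below-by (top q) Asc.y (λ k∈S₀ o → xy k∈S₀ (Bot.up k∈S₀ (Top.down k∈S₀ o)))
              (λ j∈S₁ _ → Asc.complete j∈S₁)) ,
            All.map (λ {z} zb → alike-trans (ρ z) (ρ (bot q)) q zb (Bot.down , Bot.up)) Asc.over ,
            λ z (zq , qz) → Asc.covering z
              ((λ k∈S₀ o → Bot.up k∈S₀ (zq k∈S₀ o)) , λ k∈S₀ o → qz k∈S₀ (Bot.down k∈S₀ o))
              (below-by (bot q) z (λ k∈S₀ o → qz k∈S₀ (Bot.down k∈S₀ o)) (λ j∈S₁ o → ⊥-elim (Bot.inv⁻ j∈S₁ o)))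
            where
            module Bot = Realisation (proj₂ (bottom q))
            module Top = Realisation (proj₂ (topmost q))
            module Asc = Ascent (ascend _ (bot q) ≡.refl)
            last-over : ∀ {x y : Chamber S} {xs} {P : Pred (Chamber S) 0ℓ} → Path _⋖_ x y xs → All P xs → P y
            last-over [ _ ] (p ∷ _) = p
            last-over (_ ∷ π) (_ ∷ ps) = last-over π ps
            yx = proj₁ (last-over Asc.path Asc.over)
            xy = proj₂ (last-over Asc.path Asc.over)

    HasHamiltonianQuotients : ∀ c {S} (_∨_ _∧_ : Chamber S → Chamber S → Chamber S) → Set (lsuc c)
    HasHamiltonianQuotients c {S} _∨_ _∧_ = (_∼_ : Rel (Chamber S) c) →
      IsLatticeCongruence (Alike S) _∨_ _∧_ _∼_ →
      HamiltonianList _∼_ (CoverGraph _∼_ (QuotientOrder (Below S) _∼_))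

    -- Lattice and quotients share one induction, because the Hamiltonian list above calls for one
    -- for the restricted congruence `∼₀` below. The level `c` can stay fixed: `∼₀` is defined
    -- through `bot` and lives in the universe of `∼`.
    tower-lattice : ∀ c {S} → Tower S → ∃₂ λ _∨_ _∧_ →
                    IsLattice (Alike S) (Below S) _∨_ _∧_ × HasHamiltonianQuotients c _∨_ _∧_
    tower-lattice c (ground {S} S-empty) = (λ x _ → x) , (λ x _ → x) ,
      isLatticeOf (λ _ _ i∈S → contradiction i∈S S-empty) (λ _ _ i∈S → contradiction i∈S S-empty)
        (λ _ _ _ _ _ i∈S → contradiction i∈S S-empty) (λ _ _ i∈S → contradiction i∈S S-empty)
        (λ _ _ i∈S → contradiction i∈S S-empty) (λ _ _ _ _ _ i∈S → contradiction i∈S S-empty) ,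
      λ _∼_ C → record
        { path = [ x₀ , (λ {i} _ → x₀∉ i) ]
        ; covering = λ x → here (IsLatticeCongruence.respects C
            ((λ i∈S → contradiction i∈S S-empty) , λ i∈S → contradiction i∈S S-empty))
        ; distinct = [] ∷ [] }
    tower-lattice c (storey F T₀) =
      let _∨₀_ , _∧₀_ , L₀ , H₀ = tower-lattice c T₀
          open Storey F
          open Operations L₀
          open StoreyPaths F in
      _∨_ , _∧_ , isLattice , λ _∼_ C →
        let open Zigzag (fibration L₀) em C in
        lift-path (H₀ _∼₀_ isCongruence₀)

-- Sums, inner products and linear dependence

module LinearAlgebra (em : ∀ {ℓ} → ExcludedMiddle ℓ) (ℝ : CompleteOrderedField) where
  open Forms em ℝ
  open HyperplaneArrangements ℝ
  open Algebra.Properties.Semiring.Sum semiring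
    using (sum; ∑-distrib-+; ∑-comm; sum-cong-≋; *-distribˡ-sum; *-distribʳ-sum)

  sum-zero : ∀ {n} (f : Fin n → Carrier) → (∀ i → f i ≈ 0#) → sum f ≈ 0#
  sum-zero {ℕ.zero}  f z = refl
  sum-zero {ℕ.suc n} f z = trans (+-cong (z zero) (sum-zero (f ∘ suc) (z ∘ suc))) (+-identityˡ _)

  sum-linear : ∀ {n} α β (f g : Fin n → Carrier) →
               sum (λ i → α * f i + β * g i) ≈ α * sum f + β * sum g
  sum-linear α β f g = trans (∑-distrib-+ (λ i → α * f i) (λ i → β * g i))
    (+-cong (sym (*-distribˡ-sum α f)) (sym (*-distribˡ-sum β g)))

  δ : ∀ {n} → Fin n → Fin n → Carrier
  δ zero    zero    = 1#
  δ zero    (suc j) = 0#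
  δ (suc i) zero    = 0#
  δ (suc i) (suc j) = δ i j

  δ-≢ : ∀ {n} (i j : Fin n) → i ≢ j → δ i j ≈ 0#
  δ-≢ zero    zero    ne = contradiction ≡.refl ne
  δ-≢ zero    (suc j) ne = refl
  δ-≢ (suc i) zero    ne = refl
  δ-≢ (suc i) (suc j) ne = δ-≢ i j (ne ∘ ≡.cong suc)

  sum-δ : ∀ {n} (i : Fin n) (f : Fin n → Carrier) → sum (λ j → δ i j * f j) ≈ f i
  sum-δ zero    f = trans (+-cong (*-identityˡ _) (sum-zero (λ j → 0# * f (suc j)) λ j → zeroˡ (f (suc j))))
    (+-identityʳ _)
  sum-δ (suc i) f = trans (+-cong (zeroˡ _) (sum-δ i (f ∘ suc))) (+-identityˡ _)

  sum-nonneg : ∀ {n} (f : Fin n → Carrier) → (∀ i → 0# ≤ f i) → 0# ≤ sum f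
  sum-nonneg {ℕ.zero}  f p = inj₂ refl
  sum-nonneg {ℕ.suc n} f p with p zero | sum-nonneg (f ∘ suc) (p ∘ suc)
  ... | inj₁ a | inj₁ b = inj₁ (+-pos a b)
  ... | inj₁ a | inj₂ b = inj₁ (<-respʳ-≈ (trans (sym (+-identityʳ _)) (+-congˡ b)) a)
  ... | inj₂ a | inj₁ b = inj₁ (<-respʳ-≈ (trans (sym (+-identityˡ _)) (+-congʳ a)) b)
  ... | inj₂ a | inj₂ b = inj₂ (trans (sym (+-identityˡ _)) (+-cong a b))

  sum-pos : ∀ {n} (f : Fin n → Carrier) → (∀ i → 0# ≤ f i) → ∀ i → 0# < f i → 0# < sum f
  sum-pos {ℕ.suc n} f p zero q with sum-nonneg (f ∘ suc) (p ∘ suc)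
  ... | inj₁ a = +-pos q a
  ... | inj₂ a = <-respʳ-≈ (trans (sym (+-identityʳ _)) (+-congˡ a)) q
  sum-pos {ℕ.suc n} f p (suc i) q with p zero | sum-pos (f ∘ suc) (p ∘ suc) i q
  ... | inj₁ a | b = +-pos a b
  ... | inj₂ a | b = <-respʳ-≈ (trans (sym (+-identityˡ _)) (+-congʳ a)) b

  ip-comm : ∀ {d} (x y : Point d) → ⟨ x , y ⟩ ≈ ⟨ y , x ⟩
  ip-comm x y = sum-cong-≋ λ i → *-comm (x i) (y i)

  ip-congˡ : ∀ {d} {x x′ : Point d} (y : Point d) → x ≋ x′ → ⟨ x , y ⟩ ≈ ⟨ x′ , y ⟩
  ip-congˡ y e = sum-cong-≋ λ i → *-congʳ (e i)

  ip-definite : ∀ {d} (x : Point d) → ⟨ x , x ⟩ ≈ 0# → x ≋ 0ᵥ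
  ip-definite x e i = ≈-stable λ ne →
    pos⇒≉ (sum-pos (λ i → x i * x i) (λ i → sq-nonneg (x i)) i (sq-pos ne)) e

  normalForm : ∀ {d} → Point d → Form d
  normalForm a = record
    { fn     = λ x → ⟨ a , x ⟩
    ; linear = λ α x β y → trans
        (sum-cong-≋ λ i → solve 5 (λ a α x β y → a :* (α :* x :+ β :* y) := α :* (a :* x) :+ β :* (a :* y))
          refl (a i) α (x i) β (y i))
        (sum-linear α β (λ i → a i * x i) (λ i → a i * y i)) }

  ip-lincomb : ∀ {d n} (c : Fin n → Carrier) (b : Fin n → Point d) (x : Point d) →
               ⟨ lincomb c b , x ⟩ ≈ sum (λ k → c k * ⟨ b k , x ⟩)
  ip-lincomb c b x = trans (sum-cong-≋ λ i → *-distribʳ-sum (x i) (λ k → c k * b k i))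
    (trans (∑-comm (λ i k → c k * b k i * x i))
      (sum-cong-≋ λ k → trans
        (sum-cong-≋ λ i → solve 3 (λ c b x → c :* b :* x := c :* (b :* x)) refl (c k) (b k i) (x i))
        (sym (*-distribˡ-sum (c k) (λ i → b k i * x i)))))

  -- Gaussian elimination of the first unknown. If its column is zero, it is set to 1 and the others
  -- to 0; otherwise multiples of a pivot row `k` are subtracted from the other rows, and row `k`
  -- then determines the first unknown.
  underdetermined : ∀ {r m} → r ℕ.< m → (M : Fin r → Fin m → Carrier) →
                    ∃ λ (c : Fin m → Carrier) → (∃ λ l → ¬ c l ≈ 0#) × (∀ k → sum (λ l → c l * M k l) ≈ 0#)
  underdetermined {ℕ.zero} {ℕ.suc m} _ M = (λ _ → 1#) , (zero , pos⇒≉ 0<1) , λ ()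
  underdetermined {ℕ.suc r} {ℕ.suc m} (ℕ.s≤s r<m) M with em {P = ∃ λ k → ¬ M k zero ≈ 0#}
  ... | no none = (λ { zero → 1# ; (suc _) → 0# }) , (zero , pos⇒≉ 0<1) , λ k →
    trans (+-cong (trans (*-identityˡ _) (column k))
      (sum-zero (λ l → 0# * M k (suc l)) λ l → zeroˡ (M k (suc l)))) (+-identityˡ _)
    where
    column : ∀ k → M k zero ≈ 0#
    column k = ≈-stable λ ne → none (k , ne)
  ... | yes (k , pivot≉0) =
    let c , (l , cl≉0) , eqs = underdetermined r<m M′ in
    (λ { zero → - (T c * recip (M k zero)) ; (suc l) → c l }) , (suc l , cl≉0) ,
    λ i → row c eqs i (k Fin.≟ i)
    where
    q : Fin r → Carrier
    q i = M (punchIn k i) zero * recip (M k zero)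
    M′ : Fin r → Fin m → Carrier
    -- The factor `1#` gives the entry the shape that `sum-linear` expects.
    M′ i l = 1# * M (punchIn k i) (suc l) + - q i * M k (suc l)
    T : (Fin m → Carrier) → Carrier
    T c = sum (λ l → c l * M k (suc l))
    U : (Fin m → Carrier) → Fin (ℕ.suc r) → Carrier
    U c i = sum (λ l → c l * M i (suc l))
    row : ∀ c → (∀ i → sum (λ l → c l * M′ i l) ≈ 0#) → ∀ i → Dec (k ≡ i) →
          - (T c * recip (M k zero)) * M i zero + U c i ≈ 0#
    row c eqs i (yes ≡.refl) = trans
      (+-congʳ (trans (solve 3 (λ t r p → :- (t :* r) :* p := :- (t :* (p :* r))) refl (T c) (recip (M k zero))
        (M k zero))
        (-‿cong (trans (*-congˡ (*-recip pivot≉0)) (*-identityʳ _)))))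
      (solve 1 (λ t → :- t :+ t := con (+ 0)) refl (T c))
    row c eqs i (no k≢i) = ≡.subst (λ i → - (T c * recip (M k zero)) * M i zero + U c i ≈ 0#)
      (Fin.punchIn-punchOut k≢i)
      (trans (solve 4 (λ t r p u → :- (t :* r) :* p :+ u := con (+ 1) :* u :+ :- (p :* r) :* t) refl (T c)
        (recip (M k zero)) (M i′ zero) (U c i′))
        (trans (sym (trans
          (sum-cong-≋ λ l → solve 4 (λ c a q b →
            c :* (con (+ 1) :* a :+ :- q :* b) := con (+ 1) :* (c :* a) :+ :- q :* (c :* b)) refl (c l)
            (M i′ (suc l)) (q (punchOut k≢i)) (M k (suc l)))
          (sum-linear 1# (- q (punchOut k≢i)) (λ l → c l * M i′ (suc l)) (λ l → c l * M k (suc l)))))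
          (eqs (punchOut k≢i))))
      where
      i′ = punchIn k (punchOut k≢i)

  -- Coordinates in `b` give a system with fewer equations than unknowns. The relation is stated
  -- through values at every `x` because hyperplanes are only seen through their forms.
  dependent : ∀ {d r m} → r ℕ.< m → (b : Fin r → Point d) (u : Fin m → Point d) → (∀ l → Span b (u l)) →
              ∃ λ (c : Fin m → Carrier) → (∃ λ l → ¬ c l ≈ 0#) × (∀ x → sum (λ l → c l * ⟨ u l , x ⟩) ≈ 0#)
  dependent r<m b u span =
    let c , c≉0 , eqs = underdetermined r<m (λ k l → proj₁ (span l) k) in
    c , c≉0 , λ x → trans
      (sum-cong-≋ λ l → trans (*-congˡ (trans (ip-congˡ x (proj₂ (span l))) (ip-lincomb (proj₁ (span l)) b x)))
        (*-distribˡ-sum (c l) (λ k → proj₁ (span l) k * ⟨ b k , x ⟩)))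
      (trans (∑-comm (λ l k → c l * (proj₁ (span l) k * ⟨ b k , x ⟩)))
        (sum-zero _ λ k → trans
          (sum-cong-≋ λ l → solve 3 (λ c m y → c :* (m :* y) := c :* m :* y) refl (c l) (proj₁ (span l) k) ⟨ b
            k , x ⟩)
          (trans (sym (*-distribʳ-sum ⟨ b k , x ⟩ (λ l → c l * proj₁ (span l) k)))
            (trans (*-congʳ (eqs k)) (zeroˡ _)))))

-- Connected components as classes of equal sign vectors

module Topology (em : ∀ {ℓ} → ExcludedMiddle ℓ) (ℝ : CompleteOrderedField) where
  open Forms em ℝ
  open LinearAlgebra em ℝ
  open HyperplaneArrangements ℝ

  Near : ∀ {d} → Carrier → Point d → Point d → Set
  Near ε x y = ∀ i → x i < y i + ε × y i < x i + ε

  -- This is `|a| < M`, written as two positivity conditions so that products can be bounded without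
  -- case distinctions.
  Bounds : Carrier → Carrier → Set
  Bounds M a = 0# < M - a × 0# < M + a

  bound : ∀ a → ∃ λ M → 0# < M × Bounds M a
  bound a with compare a 0#
  ... | tri< p _ _ = 1# - a , +-pos 0<1 (neg-pos p) ,
    <-respʳ-≈ (solve 1 (λ a → con (+ 1) :+ (:- a :+ :- a) := con (+ 1) :- a :- a) refl a)
      (+-pos 0<1 (+-pos (neg-pos p) (neg-pos p))) ,
    <-respʳ-≈ (solve 1 (λ a → con (+ 1) := con (+ 1) :- a :+ a) refl a) 0<1
  ... | tri≈ _ e _ = 1# , 0<1 ,
    <-respʳ-≈ (sym (trans (+-congˡ (-‿cong e)) (solve 0 (con (+ 1) :- con (+ 0) := con (+ 1)) refl))) 0<1 ,
    <-respʳ-≈ (sym (trans (+-congˡ e) (+-identityʳ 1#))) 0<1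
  ... | tri> _ _ p = 1# + a , +-pos 0<1 p ,
    <-respʳ-≈ (solve 1 (λ a → con (+ 1) := con (+ 1) :+ a :- a) refl a) 0<1 ,
    <-respʳ-≈ (solve 1 (λ a → con (+ 1) :+ (a :+ a) := con (+ 1) :+ a :+ a) refl a) (+-pos 0<1 (+-pos p p))

  bound-all : ∀ {d} (w : Point d) → ∃ λ M → 0# < M × (∀ i → Bounds M (w i))
  bound-all {ℕ.zero}  w = 1# , 0<1 , λ ()
  bound-all {ℕ.suc d} w =
    let M , 0<M , p , q = bound (w zero)
        M′ , 0<M′ , ps = bound-all (w ∘ suc) in
    M + M′ , +-pos 0<M 0<M′ , λ
      { zero → <-respʳ-≈ (solve 3 (λ m n w → m :- w :+ n := m :+ n :- w) refl M M′ (w zero)) (+-pos p 0<M′)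
             , <-respʳ-≈ (solve 3 (λ m n w → m :+ w :+ n := m :+ n :+ w) refl M M′ (w zero)) (+-pos q 0<M′)
      ; (suc i) → <-respʳ-≈ (solve 3 (λ m n w → n :- w :+ m := m :+ n :- w) refl M M′ (w (suc i)))
        (+-pos (proj₁ (ps i)) 0<M)
                , <-respʳ-≈ (solve 3 (λ m n w → n :+ w :+ m := m :+ n :+ w) refl M M′ (w (suc i)))
                  (+-pos (proj₂ (ps i)) 0<M) }

  -- Twice `M ε - a w` and twice `M ε + a w` are sums of products of the four given positive
  -- quantities.
  Bounds-* : ∀ {M a ε w} → Bounds M a → Bounds ε w → Bounds (M * ε) (a * w)
  Bounds-* {M} {a} {ε} {w} (p , q) (r , s) =
    cancel-pos 2-pos (<-respʳ-≈ (solve 4 (λ m a e w → (m :- a) :* (e :+ w) :+ (m :+ a) :* (e :- w) :=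
      (con (+ 1) :+ con (+ 1)) :* (m :* e :- a :* w)) refl M a ε w) (+-pos (*-pos p s) (*-pos q r))) ,
    cancel-pos 2-pos (<-respʳ-≈ (solve 4 (λ m a e w → (m :- a) :* (e :- w) :+ (m :+ a) :* (e :+ w) :=
      (con (+ 1) :+ con (+ 1)) :* (m :* e :+ a :* w)) refl M a ε w) (+-pos (*-pos p r) (*-pos q s)))

  Bounds-weaken : ∀ {ε ε′ w} → ε ≤ ε′ → Bounds ε w → Bounds ε′ w
  Bounds-weaken {ε} {ε′} {w} le (p , q) = sub-pos (<-≤-trans (pos-sub p) le) ,
    <-respʳ-≈ (solve 2 (λ e w → e :- :- w := e :+ w) refl ε′ w)
      (sub-pos (<-≤-trans (pos-sub (<-respʳ-≈ (solve 2 (λ e w → e :+ w := e :- :- w) refl ε w) q)) le))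

  Bounds-cong : ∀ {ε ε′ w w′} → ε ≈ ε′ → w ≈ w′ → Bounds ε w → Bounds ε′ w′
  Bounds-cong e f (p , q) = <-respʳ-≈ (+-cong e (-‿cong f)) p , <-respʳ-≈ (+-cong e f) q

  near⇒bounds : ∀ {ε x y} → x < y + ε × y < x + ε → Bounds ε (y - x)
  near⇒bounds {ε} {x} {y} (p , q) =
    <-respʳ-≈ (solve 3 (λ e x y → x :+ e :- y := e :- (y :- x)) refl ε x y) (sub-pos q) ,
    <-respʳ-≈ (solve 3 (λ e x y → y :+ e :- x := e :+ (y :- x)) refl ε x y) (sub-pos p)

  bounds⇒near : ∀ {ε x y} → Bounds ε (y - x) → x < y + ε × y < x + ε
  bounds⇒near {ε} {x} {y} (p , q) =
    <-by q (solve 3 (λ e x y → e :+ (y :- x) := y :+ e :- x) refl ε x y) ,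
    <-by p (solve 3 (λ e x y → e :- (y :- x) := x :+ e :- y) refl ε x y)

  *-recip-cancel : ∀ {M} η → 0# < M → M * (η * recip M) ≈ η
  *-recip-cancel {M} η 0<M = trans (solve 3 (λ m e r → m :* (e :* r) := e :* (m :* r)) refl M η (recip M))
    (trans (*-congˡ (*-recip (pos⇒≉ 0<M))) (*-identityʳ η))

  -- A part `η₁` of the tolerance goes to the first coordinate, which may vary by `η₁ / M` with `M`
  -- above the absolute value of `a zero`; the rest goes to the remaining coordinates.
  continuous : ∀ {d} (a x : Point d) {η} → 0# < η → ∃ λ ε → 0# < ε ×
               (∀ y → Near ε x y → Bounds η (⟨ a , y ⟩ - ⟨ a , x ⟩))
  continuous {ℕ.zero} a x {η} 0<η = 1# , 0<1 , λ _ _ →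
    <-respʳ-≈ (solve 1 (λ e → e := e :- (con (+ 0) :- con (+ 0))) refl η) 0<η ,
    <-respʳ-≈ (solve 1 (λ e → e := e :+ (con (+ 0) :- con (+ 0))) refl η) 0<η
  continuous {ℕ.suc d} a x {η} 0<η =
    let η₁ , 0<η₁ , η₁<η = dense 0<η
        M , 0<M , boundsM = bound (a zero)
        ε₁ = η₁ * recip M
        ε₂ , 0<ε₂ , near = continuous (a ∘ suc) (x ∘ suc) (sub-pos η₁<η)
        ε , 0<ε , ε≤ε₁ , ε≤ε₂ = min-pos (*-pos 0<η₁ (recip-pos 0<M)) 0<ε₂ in
    ε , 0<ε , λ y n →
      let w = Bounds-cong (*-recip-cancel η₁ 0<M) refl (Bounds-* boundsM (Bounds-weaken ε≤ε₁ (near⇒bounds (n zero))))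
          rest = near (y ∘ suc) (λ i → bounds⇒near (Bounds-weaken ε≤ε₂ (near⇒bounds (n (suc i)))))
          tx = ⟨ a ∘ suc , x ∘ suc ⟩
          ty = ⟨ a ∘ suc , y ∘ suc ⟩ in
      <-respʳ-≈ (solve 7 (λ e e₁ a x y tx ty → (e₁ :- a :* (y :- x)) :+ (e :- e₁ :- (ty :- tx)) :=
          e :- ((a :* y :+ ty) :- (a :* x :+ tx))) refl η η₁ (a zero) (x zero) (y zero) tx ty)
            (+-pos (proj₁ w) (proj₁ rest)) ,
      <-respʳ-≈ (solve 7 (λ e e₁ a x y tx ty → (e₁ :+ a :* (y :- x)) :+ (e :- e₁ :+ (ty :- tx)) :=
          e :+ ((a :* y :+ ty) :- (a :* x :+ tx))) refl η η₁ (a zero) (x zero) (y zero) tx ty)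
            (+-pos (proj₂ w) (proj₂ rest))

  open-pos : ∀ {d} (a : Point d) → IsOpen (λ x → 0# < ⟨ a , x ⟩)
  open-pos a x p = let ε , 0<ε , near = continuous a x p in
    ε , 0<ε , λ y n → <-respʳ-≈ (solve 2 (λ x y → x :+ (y :- x) := y) refl ⟨ a , x ⟩ ⟨ a , y ⟩)
      (proj₂ (near y n))

  open-neg : ∀ {d} (a : Point d) → IsOpen (λ x → ⟨ a , x ⟩ < 0#)
  open-neg a x p = let ε , 0<ε , near = continuous a x (neg-pos p) in
    ε , 0<ε , λ y n → pos-neg (<-respʳ-≈ (solve 2 (λ x y → :- x :- (y :- x) := :- y) refl ⟨ a , x ⟩ ⟨ a , y ⟩)
      (proj₁ (near y n)))

  open-resp : ∀ {d} {U : Pred (Point d) 0ℓ} → IsOpen U → ∀ {x y} → x ≋ y → U x → U y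
  open-resp op {x} {y} e Ux = let ε , 0<ε , near = op x Ux in
    near y λ i → bounds⇒near (Bounds-cong refl
      (trans (solve 1 (λ x → con (+ 0) := x :- x) refl (x i)) (+-congʳ (e i)))
      ( <-respʳ-≈ (solve 1 (λ e → e := e :- con (+ 0)) refl ε) 0<ε , <-respʳ-≈ (sym (+-identityʳ ε)) 0<ε))

  segment : ∀ {d} → Point d → Point d → Carrier → Point d
  segment p q s = comb (1# - s) p s q

  segment-continuous : ∀ {d} (p q : Point d) s {η} → 0# < η → ∃ λ δ → 0# < δ ×
                       (∀ r → Bounds δ (r - s) → Near η (segment p q s) (segment p q r))
  segment-continuous p q s {η} 0<η =
    let M , 0<M , bounds = bound-all (λ i → q i - p i) in
    η * recip M , *-pos 0<η (recip-pos 0<M) , λ r b i → bounds⇒near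
      (Bounds-cong (*-recip-cancel η 0<M)
        (solve 4 (λ p q r s → (q :- p) :* (r :- s) := ((con (+ 1) :- r) :* p :+ r :* q) :-
          ((con (+ 1) :- s) :* p :+ s :* q)) refl (p i) (q i) r s)
        (Bounds-* (bounds i) b))

  -- On the segment from a point of `U` to a point of `V`, let `σ` be the supremum of the parameters
  -- in `U`. If `γ σ` is in `U`, either slightly larger parameters are too, or `σ = 1` and the
  -- endpoint is in both sets. If it is in `V`, so is a whole neighbourhood, and `σ - δ` would be a
  -- smaller upper bound.
  convex⇒connected : ∀ {d} (C : Pred (Point d) 0ℓ) →
    (∀ {p q s} → C p → C q → 0# ≤ s → s ≤ 1# → C (segment p q s)) → IsConnected C
  convex⇒connected C convex U V openU openV cover disjoint ((p , Cp , Up) , (q , Cq , Vq)) =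
    Sum.[ inU , inV ]′ (cover (convex Cp Cq 0≤σ σ≤1))
    where
    γ = segment p q
    P : Pred Carrier 0ℓ
    P s = (0# ≤ s × s ≤ 1#) × U (γ s)
    P0 : P 0#
    P0 = (inj₂ refl , inj₁ 0<1) , open-resp openU
      (λ i → solve 2 (λ p q → p := (con (+ 1) :- con (+ 0)) :* p :+ con (+ 0) :* q) refl (p i) (q i)) Up
    supremum = complete P (0# , P0) (1# , λ s ((_ , s≤1) , _) → s≤1)
    σ = proj₁ supremum
    upper = proj₁ (proj₂ supremum)
    least = proj₂ (proj₂ supremum)
    0≤σ : 0# ≤ σ
    0≤σ = upper 0# P0
    σ≤1 : σ ≤ 1#
    σ≤1 = least 1# (λ s ((_ , s≤1) , _) → s≤1)

    inU : U (γ σ) → ⊥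
    inU Uσ = Sum.[ σ<1⇒⊥ , σ≈1⇒⊥ ]′ σ≤1
      where
      σ≈1⇒⊥ : σ ≈ 1# → ⊥
      σ≈1⇒⊥ e = disjoint (q , Cq , open-resp openU (λ i → trans
        (+-cong (*-congʳ (+-congˡ (-‿cong e))) (*-congʳ e))
        (solve 2 (λ p q → (con (+ 1) :- con (+ 1)) :* p :+ con (+ 1) :* q := q) refl (p i) (q i))) Uσ , Vq)
      σ<1⇒⊥ : σ < 1# → ⊥
      σ<1⇒⊥ σ<1 =
        let η , 0<η , within = openU (γ σ) Uσ
            δ , 0<δ , near = segment-continuous p q σ 0<η
            r , 0<r , r≤δ , r≤1-σ = min-pos 0<δ (sub-pos σ<1)
            ε , 0<ε , ε<r = dense 0<r
            σ<s : σ < σ + ε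
            σ<s = <-by 0<ε (solve 2 (λ s e → e := s :+ e :- s) refl σ ε)
            s<1 : σ + ε < 1#
            s<1 = <-by (sub-pos (<-≤-trans ε<r r≤1-σ))
              (solve 2 (λ s e → con (+ 1) :- s :- e := con (+ 1) :- (s :+ e)) refl σ ε)
            b : Bounds δ (σ + ε - σ)
            b = <-respʳ-≈ (solve 3 (λ d s e → d :- e := d :- (s :+ e :- s)) refl δ σ ε)
              (sub-pos (<-≤-trans ε<r r≤δ)) ,
                <-respʳ-≈ (solve 3 (λ d s e → d :+ e := d :+ (s :+ e :- s)) refl δ σ ε) (+-pos 0<δ 0<ε) in
        <⇒≱ σ<s (upper (σ + ε) ((≤-trans 0≤σ (inj₁ σ<s) , inj₁ s<1) , within (γ (σ + ε)) (near (σ + ε) b)))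

    inV : V (γ σ) → ⊥
    inV Vσ =
      let η , 0<η , within = openV (γ σ) Vσ
          δ , 0<δ , near = segment-continuous p q σ 0<η
          smaller : ∀ s → P s → s ≤ σ - δ
          smaller s ((0≤s , s≤1) , Us) = Sum.[ id , (λ lt → contradiction
            (γ s , convex Cp Cq 0≤s s≤1 , Us , within (γ s) (near s
              ( <-≤-trans-pos (upper s ((0≤s , s≤1) , Us)) 0<δ
              , <-respʳ-≈ (solve 3 (λ d s t → s :- (t :- d) := d :+ (s :- t)) refl δ s σ) (sub-pos lt))))
            disjoint) ]′ (≤-or-> s (σ - δ)) in
      <⇒≱ (<-by 0<δ (solve 2 (λ s d → d := s :- (s :- d)) refl σ δ)) (least (σ - δ) smaller)
      where
      <-≤-trans-pos : ∀ {s δ} → s ≤ σ → 0# < δ → 0# < δ - (s - σ)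
      <-≤-trans-pos {s} {δ} s≤σ 0<δ = <-respʳ-≈ (solve 3 (λ d s t → t :+ d :- s := d :- (s :- t)) refl δ s σ)
        (sub-pos (≤-<-trans s≤σ (<-by 0<δ (solve 2 (λ t d → d := t :+ d :- t) refl σ δ))))

  module _ {d : ℕ} (𝓗 : Arrangement d) where
    open Arrangement 𝓗

    ν : Fin size → Form d
    ν i = normalForm (normal i)

    -- The open half-spaces of hyperplane `i` are disjoint and cover the connecting set, so it
    -- cannot meet both.
    sameRegion⇒same : ∀ {S} {x y : Region 𝓗 S} → SameRegion 𝓗 S x y →
                      ∀ {i} → i ∈ S → Same (ν i $ proj₁ x) (ν i $ proj₁ y)
    sameRegion⇒same {S} {x , x∉} {y , y∉} (C , connected , C⊆ , Cx , Cy) {i} i∈S =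
      go (sign (x∉ i∈S)) (sign (y∉ i∈S))
      where
      split : _
      split = connected (λ z → ⟨ normal i , z ⟩ < 0#) (λ z → 0# < ⟨ normal i , z ⟩)
        (open-neg (normal i)) (open-pos (normal i)) (λ Cz → sign (C⊆ Cz i∈S))
        (λ (_ , _ , n , p) → asym n p)
      go : _ → _ → Same (ν i $ x) (ν i $ y)
      go (inj₁ p) (inj₁ q) = neg*neg p q
      go (inj₂ p) (inj₂ q) = *-pos p q
      go (inj₁ p) (inj₂ q) = contradiction ((x , Cx , p) , (y , Cy , q)) split
      go (inj₂ p) (inj₁ q) = contradiction ((y , Cy , q) , (x , Cx , p)) split

    -- The points with the signs of `x` form a convex, hence connected, set, and `y` belongs to it.
    same⇒sameRegion : ∀ {S} {x y : Region 𝓗 S} →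
                      (∀ {i} → i ∈ S → Same (ν i $ proj₁ x) (ν i $ proj₁ y)) → SameRegion 𝓗 S x y
    same⇒sameRegion {S} {x , x∉} {y , y∉} same =
      C , convex⇒connected C convex , (λ Cz i∈S → same⇒≉ʳ (Cz i∈S)) , (λ i∈S → same-refl (x∉ i∈S)) , same
      where
      C : Pred (Point d) 0ℓ
      C z = ∀ {i} → i ∈ S → Same (ν i $ x) (ν i $ z)
      convex : ∀ {p q s} → C p → C q → 0# ≤ s → s ≤ 1# → C (segment p q s)
      convex {p} {q} {s} Cp Cq 0≤s s≤1 {i} i∈S = <-respʳ-≈
        (trans (solve 4 (λ x s p q → (con (+ 1) :- s) :* (x :* p) :+ s :* (x :* q) := x :*
          ((con (+ 1) :- s) :* p :+ s :* q)) refl (ν i $ x) s (ν i $ p) (ν i $ q))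
          (*-congˡ (sym (linear (ν i) (1# - s) p s q))))
        (positive 0≤s s≤1)
        where
        A = (ν i $ x) * (ν i $ p)
        B = (ν i $ x) * (ν i $ q)
        positive : 0# ≤ s → s ≤ 1# → 0# < (1# - s) * A + s * B
        positive (inj₁ 0<s) (inj₁ s<1) = +-pos (*-pos (sub-pos s<1) (Cp i∈S)) (*-pos 0<s (Cq i∈S))
        positive (inj₂ 0≈s) _ = <-respʳ-≈
          (trans (solve 2 (λ a b → a := (con (+ 1) :- con (+ 0)) :* a :+ con (+ 0) :* b) refl A B)
            (+-cong (*-congʳ (+-congˡ (-‿cong 0≈s))) (*-congʳ 0≈s))) (Cp i∈S)
        positive (inj₁ _) (inj₂ s≈1) = <-respʳ-≈
          (trans (solve 2 (λ a b → b := (con (+ 1) :- con (+ 1)) :* a :+ con (+ 1) :* b) refl A B)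
            (+-cong (*-congʳ (+-congˡ (-‿cong (sym s≈1)))) (*-congʳ (sym s≈1)))) (Cq i∈S)

-- The order of regions as inclusion of separation sets

module RegionOrders (em : ∀ {ℓ} → ExcludedMiddle ℓ) (ℝ : CompleteOrderedField) where
  open Forms em ℝ
  open Counting em
  open Towers em ℝ
  open TowerPaths em ℝ
  open Topology em ℝ
  open HyperplaneArrangements ℝ

  module _ {d : ℕ} (𝓗 : Arrangement d) where
    open Arrangement 𝓗

    opposite⇒separates : ∀ {x y i} → Opposite (ν 𝓗 i $ x) (ν 𝓗 i $ y) → Separates 𝓗 i x y
    opposite⇒separates {x} {y} {i} o =
      go (sign (λ e → neg⇒≉ o (trans (*-congʳ e) (zeroˡ _))))
        (sign (λ e → neg⇒≉ o (trans (*-congˡ e) (zeroʳ _))))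
      where
      go : _ → _ → Separates 𝓗 i x y
      go (inj₁ p) (inj₁ q) = contradiction o (asym (neg*neg p q))
      go (inj₁ p) (inj₂ q) = inj₁ (p , q)
      go (inj₂ p) (inj₁ q) = inj₂ (q , p)
      go (inj₂ p) (inj₂ q) = contradiction o (asym (*-pos p q))

    separates⇒opposite : ∀ {x y i} → Separates 𝓗 i x y → Opposite (ν 𝓗 i $ x) (ν 𝓗 i $ y)
    separates⇒opposite (inj₁ (p , q)) = neg*pos p q
    separates⇒opposite (inj₂ (p , q)) = pos*neg q p

    Crosses : ∀ {S} → Region 𝓗 S → Region 𝓗 S → Fin size → Set
    Crosses {S} (x , _) (y , _) h = h ∈ S × Opposite (ν 𝓗 h $ x) (ν 𝓗 h $ y) ×
      (∀ {i} → i ∈ S → i ≢ h → Same (ν 𝓗 i $ x) (ν 𝓗 i $ y))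

    crosses⇒adjacent : ∀ {S} (x y : Region 𝓗 S) {h} → Crosses x y h → Adjacent 𝓗 S x y
    crosses⇒adjacent x y {h} (h∈S , o , same) = h , (h∈S , opposite⇒separates {proj₁ x} {proj₁ y} o) ,
      λ { {i} (i∈S , sep) → go i i∈S sep (i Fin.≟ h) }
      where
      go : ∀ i → i ∈ _ → Separates 𝓗 i (proj₁ x) (proj₁ y) → Dec (i ≡ h) → h ≡ i
      go i i∈S sep (yes e) = ≡.sym e
      go i i∈S sep (no ne) = contradiction (separates⇒opposite {proj₁ x} {proj₁ y} sep) (asym (same i∈S ne))

    adjacent⇒crosses : ∀ {S} (x y : Region 𝓗 S) → Adjacent 𝓗 S x y → ∃ (Crosses x y)
    adjacent⇒crosses {S} (x , x∉) (y , y∉) (h , (h∈S , sep) , unique) = h , h∈S ,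
      separates⇒opposite {x} {y} sep ,
      λ {i} i∈S i≢h → Sum.[ (λ o → contradiction (≡.sym (unique (i∈S , opposite⇒separates {x} {y} o))) i≢h) ,
        id ]′
        (same-or-opp (x∉ i∈S) (y∉ i∈S))

    module BasedAt (R₀ : Region 𝓗 ⊤) where
      x₀ : Point d
      x₀ = proj₁ R₀

      x₀∉ : ∀ i → ¬ ν 𝓗 i $ x₀ ≈ 0#
      x₀∉ i = proj₂ R₀ (∈⊤ {x = i})

      open Chambers (ν 𝓗) x₀ x₀∉ public
      open ChamberPaths (ν 𝓗) x₀ x₀∉ public

      sameRegion⇒alike : ∀ {S} (x y : Region 𝓗 S) → SameRegion 𝓗 S x y → Alike S x y
      sameRegion⇒alike x y r = same⇒alike x y (sameRegion⇒same 𝓗 {x = x} {y} r)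

      alike⇒sameRegion : ∀ {S} (x y : Region 𝓗 S) → Alike S x y → SameRegion 𝓗 S x y
      alike⇒sameRegion x y a = same⇒sameRegion 𝓗 {x = x} {y} (alike⇒same x y a)

      inv-x₀ : ∀ {i} → ¬ Inv x₀ i
      inv-x₀ {i} o = asym (same-refl (x₀∉ i)) (inv⇒opp o)

      R₀-least : ∀ x → Below ⊤ R₀ x
      R₀-least x _ o = contradiction o inv-x₀

      private
        _⊑_ : Region 𝓗 ⊤ → Region 𝓗 ⊤ → Set
        _⊑_ = Below ⊤

      height : Region 𝓗 ⊤ → ℕ
      height x = card (Inv (proj₁ x))

      Ascends : Region 𝓗 ⊤ → Region 𝓗 ⊤ → Fin size → Set
      Ascends x y h = Crosses x y h × ¬ Inv (proj₁ x) h

      crossed : ∀ x y {h} → Ascends x y h → Inv (proj₁ y) h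
      crossed x y ((h∈ , o , _) , ¬xh) = opp⇒inv (same-opp (¬inv⇒same x h∈ ¬xh) o)

      ascends-height : ∀ x y {h} → Ascends x y h → height y ≡ ℕ.suc (height x)
      ascends-height x y {h} asc@((_ , _ , same) , ¬xh) = card-insert h ¬xh (crossed x y asc)
        (λ i i≢h → inv-same (same ∈⊤ i≢h)) (λ i i≢h → inv-same (same-sym (same ∈⊤ i≢h)))

      ascends⇒below : ∀ x y {h} → Ascends x y h → x ⊑ y
      ascends⇒below x y {h} asc@((_ , _ , same) , ¬xh) {i} i∈ o = go (i Fin.≟ h)
        where
        go : Dec (i ≡ h) → Inv (proj₁ y) i
        go (yes ≡.refl) = contradiction o ¬xh
        go (no i≢h)     = inv-same (same i∈ i≢h) o

      crosses-sym : ∀ {S} (x y : Region 𝓗 S) {h} → Crosses x y h → Crosses y x h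
      crosses-sym x y (h∈S , o , same) = h∈S , opp-sym o , λ i∈S i≢h → same-sym (same i∈S i≢h)

      crosses-cases : ∀ x y {h} → Crosses x y h → Ascends x y h ⊎ Ascends y x h
      crosses-cases x y {h} c@(h∈ , o , same) = Sum.[
        (λ xh → inj₂ (crosses-sym x y c , λ yh → asym (opp-trans (opp-sym (inv⇒opp xh)) (inv⇒opp yh)) o)) ,
        (λ s → inj₁ (c , same⇒¬inv s)) ]′ (same? x h∈)

      -- A hyperplane crossed by `y` but not by `x` separates the two, so `facet` yields a neighbour
      -- of `x` across some separating `h`. As `x` is below `y`, `x` has not crossed `h`, so the
      -- step goes up and stays below `y`.
      step-up : ∀ x y → x ⊑ y → ¬ y ⊑ x → ∃₂ λ x′ h → Ascends x x′ h × x′ ⊑ y × Inv (proj₁ y) h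
      step-up x y x⊑y y⋢x = go (not-below y x y⋢x)
        where
        go : (∃ λ i → i ∈ ⊤ × Inv (proj₁ y) i × ¬ Inv (proj₁ x) i) → _
        go (i , i∈ , yi , ¬xi) = build
          (facet (ν 𝓗) {⊤} (λ i j _ _ → distinct i j) (proj₁ x) (proj₁ y) (proj₂ x) (proj₂ y)
            (i , i∈ , same-opp (same-sym (¬inv⇒same x i∈ ¬xi)) (inv⇒opp yi)))
          where
          build : _ → ∃₂ λ x′ h → Ascends x x′ h × x′ ⊑ y × Inv (proj₁ y) h
          build (z , h , h∈ , oy , oz , same) = x′ , h , asc , x′⊑y , yh
            where
            z∉ : ∀ {i} → i ∈ ⊤ → ¬ ν 𝓗 i $ z ≈ 0#
            z∉ {i} i∈ e = side (i Fin.≟ h)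
              where
              side : Dec (i ≡ h) → ⊥
              side (yes ≡.refl) = irrefl (trans (*-congˡ e) (zeroʳ _)) oz
              side (no i≢h) = same⇒≉ʳ (same i i∈ i≢h) e
            x′ : Region 𝓗 ⊤
            x′ = z , z∉
            ¬xh : ¬ Inv (proj₁ x) h
            ¬xh xh = asym (opp-trans (opp-sym (inv⇒opp xh)) (inv⇒opp (x⊑y h∈ xh))) oy
            yh : Inv (proj₁ y) h
            yh = opp⇒inv (same-opp (¬inv⇒same x h∈ ¬xh) oy)
            asc : Ascends x x′ h
            asc = (h∈ , oz , λ i∈ i≢h → same _ i∈ i≢h) , ¬xh
            x′⊑y : x′ ⊑ y
            x′⊑y {i} i∈ o = side (i Fin.≟ h)
              where
              side : Dec (i ≡ h) → Inv (proj₁ y) i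
              side (yes ≡.refl) = yh
              side (no i≢h)     = x⊑y i∈ (inv-same (same-sym (same i i∈ i≢h)) o)

      data Chain : Region 𝓗 ⊤ → Region 𝓗 ⊤ → Set where
        done : ∀ {x y} → Alike ⊤ x y → Chain x y
        up   : ∀ {x y z h} → Ascends x y h → Chain y z → Chain x z

      Gap : Region 𝓗 ⊤ → Region 𝓗 ⊤ → Pred (Fin size) 0ℓ
      Gap x y i = Inv (proj₁ y) i × ¬ Inv (proj₁ x) i

      chain : ∀ m x y → x ⊑ y → card (Gap x y) ≡ m → Chain x y
      chain m x y x⊑y m≡ = go m m≡ em
        where
        go : ∀ m → card (Gap x y) ≡ m → Dec (y ⊑ x) → Chain x y
        go m m≡ (yes y⊑x) = done ((λ {i} → x⊑y {i}) , λ {i} → y⊑x {i})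
        go m m≡ (no y⋢x) = rec m m≡ (step-up x y x⊑y y⋢x)
          where
          rec : ∀ m → card (Gap x y) ≡ m → (∃₂ λ x′ h → Ascends x x′ h × x′ ⊑ y × Inv (proj₁ y) h) → Chain x y
          rec m m≡ (x′ , h , asc@((_ , _ , same) , ¬xh) , x′⊑y , yh) = down m (≡.trans (≡.sym m≡) fewer)
            where
            fewer : card (Gap x y) ≡ ℕ.suc (card (Gap x′ y))
            fewer = card-insert {P = Gap x′ y} {Q = Gap x y} h (λ (_ , ¬o) → ¬o (crossed x x′ asc)) (yh , ¬xh)
              (λ i i≢h (yi , ¬o) → yi , λ xi → ¬o (inv-same (same ∈⊤ i≢h) xi))
              (λ i i≢h (yi , ¬o) → yi , λ xi → ¬o (inv-same (same-sym (same ∈⊤ i≢h)) xi))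
            down : ∀ m → m ≡ ℕ.suc (card (Gap x′ y)) → Chain x y
            down (ℕ.suc m) e = up asc (chain m x′ y x′⊑y (≡.sym (ℕ.suc-injective e)))

      RegionWalk : Region 𝓗 ⊤ → Region 𝓗 ⊤ → ℕ → Set₁
      RegionWalk = Walk (SameRegion 𝓗 ⊤) (Adjacent 𝓗 ⊤)

      height-alike : ∀ x y → Alike ⊤ x y → height x ≡ height y
      height-alike x y (f , g) = card-cong ((λ {i} → f (∈⊤ {x = i})) , λ {i} → g (∈⊤ {x = i}))

      walk-height : ∀ {x y k} → RegionWalk x y k → height y ℕ.≤ k ℕ.+ height x
      walk-height {x} {y} (nil r) = ℕ.≤-reflexive (≡.sym (height-alike x y (sameRegion⇒alike x y r)))
      walk-height {x} (cons {y = y} {n = n} a w) = go (crosses-cases x y (proj₂ (adjacent⇒crosses x y a)))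
        where
        go : _ → _
        go (inj₁ asc) = ℕ.≤-trans (walk-height w)
          (ℕ.≤-reflexive (≡.trans (≡.cong (n ℕ.+_) (ascends-height x y asc)) (ℕ.+-suc n (height x))))
        go (inj₂ desc) = ℕ.≤-trans (walk-height w) (ℕ.≤-trans
          (ℕ.+-monoʳ-≤ n (ℕ.≤-trans (ℕ.n≤1+n (height y)) (ℕ.≤-reflexive (≡.sym (ascends-height y x desc)))))
          (ℕ.n≤1+n (n ℕ.+ height x)))

      chain-walk : ∀ {x y} → Chain x y → ∃ λ k → RegionWalk x y k × height y ≡ k ℕ.+ height x
      chain-walk {x} {y} (done a) = 0 , nil (alike⇒sameRegion x y a) , height-alike y x (proj₂ a , proj₁ a)
      chain-walk {x} (up {y = y} asc c) =
        let k , w , e = chain-walk c in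
        ℕ.suc k , cons (crosses⇒adjacent x y (proj₁ asc)) w ,
        ≡.trans e (≡.trans (≡.cong (k ℕ.+_) (ascends-height x y asc)) (ℕ.+-suc k (height x)))

      height-R₀ : height R₀ ≡ 0
      height-R₀ = card-empty {P = Inv x₀} λ i → inv-x₀

      -- An edge changes the number of hyperplanes separating a region from `x₀` by exactly one, so
      -- no walk is shorter than this number; a chain of ascents from `R₀` attains it.
      rank-height : ∀ x → RegionRank 𝓗 R₀ x (height x)
      rank-height x =
        let k , w , e = chain-walk (chain _ R₀ x (R₀-least x) ≡.refl) in
        ≡.subst (RegionWalk R₀ x) (≡.sym (≡.trans e (drop k))) w ,
        λ l w′ → ℕ.≤-trans (walk-height w′) (ℕ.≤-reflexive (drop l))
        where
        drop : ∀ k → k ℕ.+ height R₀ ≡ k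
        drop k = ≡.trans (≡.cong (k ℕ.+_) height-R₀) (ℕ.+-identityʳ k)

      rank-unique : ∀ {x k l} → RegionRank 𝓗 R₀ x k → RegionRank 𝓗 R₀ x l → k ≡ l
      rank-unique (w , least) (w′ , least′) = ℕ.≤-antisym (least _ w′) (least′ _ w)

      ascends⇒upward : ∀ x y {h} → Ascends x y h → UpwardEdge 𝓗 R₀ x y
      ascends⇒upward x y asc = crosses⇒adjacent x y (proj₁ asc) , height x , height y , rank-height x ,
        rank-height y ,
        ℕ.≤-reflexive (≡.sym (ascends-height x y asc))

      upward⇒below : ∀ x y → UpwardEdge 𝓗 R₀ x y → x ⊑ y
      upward⇒below x y (a , k , l , rk , rl , k<l) = go (crosses-cases x y (proj₂ (adjacent⇒crosses x y a)))
        where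
        heights : height x ℕ.< height y
        heights = ≡.subst₂ ℕ._<_ (rank-unique rk (rank-height x)) (rank-unique rl (rank-height y)) k<l
        go : _ → x ⊑ y
        go (inj₁ asc)  = ascends⇒below x y asc
        go (inj₂ desc) = contradiction heights
          (ℕ.<-asym (ℕ.≤-reflexive (≡.sym (ascends-height y x desc))))

      order⇒below : ∀ {x y} → RegionOrder 𝓗 R₀ x y → x ⊑ y
      order⇒below {x} {y} (Closure.refl r) = proj₁ (sameRegion⇒alike x y r)
      order⇒below {x} {z} (Closure.step {y = y} e c) i∈ o = order⇒below c i∈ (upward⇒below x y e i∈ o)

      chain⇒order : ∀ {x y} → Chain x y → RegionOrder 𝓗 R₀ x y
      chain⇒order {x} {y} (done a) = Closure.refl (alike⇒sameRegion x y a)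
      chain⇒order {x} (up {y = y} asc c) = Closure.step (ascends⇒upward x y asc) (chain⇒order c)

      below⇒order : ∀ {x y} → x ⊑ y → RegionOrder 𝓗 R₀ x y
      below⇒order {x} {y} x⊑y = chain⇒order (chain _ x y x⊑y ≡.refl)

-- Towers from canonical regions

x∈p─q⇒x∉q : ∀ {n} {x : Fin n} (p q : Subset n) → x ∈ p ─ q → x ∉ q
x∈p─q⇒x∉q (_ ∷ p) (outside ∷ q) here ()
x∈p─q⇒x∉q (_ ∷ p) (outside ∷ q) (there x∈) (there x∈q) = x∈p─q⇒x∉q p q x∈ x∈q
x∈p─q⇒x∉q (_ ∷ p) (inside ∷ q) (there x∈) (there x∈q) = x∈p─q⇒x∉q p q x∈ x∈q

module CanonicalTowers (em : ∀ {ℓ} → ExcludedMiddle ℓ) (ℝ : CompleteOrderedField) where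
  open Forms em ℝ
  open LinearAlgebra em ℝ
  open Towers em ℝ using (module Chambers)
  open Topology em ℝ
  open RegionOrders em ℝ
  open HyperplaneArrangements ℝ
  open Algebra.Properties.Semiring.Sum semiring using (sum; sum-cong-≋)

  negate : ∀ {d} → Point d → Point d
  negate v = comb (- 1#) v 0# v

  negate-form : ∀ {d} (f : Form d) v → f $ negate v ≈ - (f $ v)
  negate-form f v = trans (linear f (- 1#) v 0# v)
    (solve 1 (λ a → :- con (+ 1) :* a :+ con (+ 0) :* a := :- a) refl (f $ v))

  same-negate : ∀ {a b} → Opposite a b → Same a (- b)
  same-negate {a} {b} o = <-respʳ-≈ (solve 2 (λ a b → :- (a :* b) := a :* :- b) refl a b) (neg-pos o)

  opposite-negate : ∀ {a b} → Same a b → Opposite a (- b)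
  opposite-negate {a} {b} s = <-respˡ-≈ (solve 2 (λ a b → :- (a :* b) := a :* :- b) refl a b) (neg-neg s)

  module _ {d : ℕ} (𝓗 : Arrangement d) (R₀ : Region 𝓗 ⊤) where
    open Arrangement 𝓗
    open BasedAt 𝓗 R₀

    private
      μ : Fin size → Form d
      μ = ν 𝓗

    normal∈span : ∀ {S i} → i ∈ S → SpanOfNormals 𝓗 S (normal i)
    normal∈span {S} {i} i∈S = δ i , (λ k k∉S → δ-≢ i k λ { ≡.refl → k∉S i∈S }) ,
      λ j → sym (sum-δ i (λ k → normal k j))

    -- Evaluation at `x₀`, which is on neither hyperplane, shows that a nonzero coefficient forces
    -- the other to be nonzero; with both nonzero, the two kernels would coincide.
    independent₂ : ∀ {i j} → i ≢ j → ∀ {a b} → (∀ x → a * (μ i $ x) + b * (μ j $ x) ≈ 0#) → a ≈ 0# × b ≈ 0#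
    independent₂ {i} {j} i≢j {a} {b} eq = ≈-stable a≉0⇒⊥ , ≈-stable b≉0⇒⊥
      where
      a≉0⇒b≉0 : ¬ a ≈ 0# → ¬ b ≈ 0#
      a≉0⇒b≉0 ne e = *-≉0 ne (x₀∉ i)
        (trans (solve 3 (λ p q b → p := p :+ q :- q) refl (a * (μ i $ x₀)) (b * (μ j $ x₀)) b)
        (trans (+-cong (eq x₀) (-‿cong (trans (*-congʳ e) (zeroˡ _))))
          (solve 0 (con (+ 0) :- con (+ 0) := con (+ 0)) refl)))
      b≉0⇒a≉0 : ¬ b ≈ 0# → ¬ a ≈ 0#
      b≉0⇒a≉0 ne e = *-≉0 ne (x₀∉ j)
        (trans (solve 2 (λ p q → q := p :+ q :- p) refl (a * (μ i $ x₀)) (b * (μ j $ x₀)))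
        (trans (+-cong (eq x₀) (-‿cong (trans (*-congʳ e) (zeroˡ _))))
          (solve 0 (con (+ 0) :- con (+ 0) := con (+ 0)) refl)))
      both⇒⊥ : ¬ a ≈ 0# → ¬ b ≈ 0# → ⊥
      both⇒⊥ a≉0 b≉0 = distinct i j i≢j
        ( (λ {x} e → *-cancel-0 b≉0 (trans
          (solve 2 (λ p q → q := p :+ q :- p) refl (a * (μ i $ x)) (b * (μ j $ x)))
            (trans (+-cong (eq x) (-‿cong (trans (*-congˡ e) (zeroʳ _))))
              (solve 0 (con (+ 0) :- con (+ 0) := con (+ 0)) refl))))
        , (λ {x} e → *-cancel-0 a≉0 (trans
          (solve 2 (λ p q → p := p :+ q :- q) refl (a * (μ i $ x)) (b * (μ j $ x)))
            (trans (+-cong (eq x) (-‿cong (trans (*-congˡ e) (zeroʳ _))))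
              (solve 0 (con (+ 0) :- con (+ 0) := con (+ 0)) refl)))) )
      a≉0⇒⊥ : ¬ ¬ a ≈ 0#
      a≉0⇒⊥ ne = both⇒⊥ ne (a≉0⇒b≉0 ne)
      b≉0⇒⊥ : ¬ ¬ b ≈ 0#
      b≉0⇒⊥ ne = both⇒⊥ (b≉0⇒a≉0 ne) ne

    -- Three normals in dimension at most two are dependent. The coefficient of `h` cannot vanish,
    -- as `i` and `j` are independent, so `h` is a combination of the other two.
    rank2-modular : ∀ {S n} → HasRank 𝓗 S n → n ℕ.≤ 2 → ∀ {h i j} → h ∈ S → i ∈ S → j ∈ S → i ≢ j →
                    ∀ x → μ i $ x ≈ 0# → μ j $ x ≈ 0# → μ h $ x ≈ 0#
    rank2-modular {S} {n} (b , _ , _ , spans) n≤2 {h} {i} {j} h∈S i∈S j∈S i≢j x xi xj =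
      go (dependent (ℕ.s≤s n≤2) b u u∈span)
      where
      u : Fin 3 → Point d
      u 0F = normal h
      u 1F = normal i
      u 2F = normal j
      u∈span : ∀ l → Span b (u l)
      u∈span 0F = spans _ (normal∈span h∈S)
      u∈span 1F = spans _ (normal∈span i∈S)
      u∈span 2F = spans _ (normal∈span j∈S)
      go : (∃ λ (c : Fin 3 → Carrier) → (∃ λ l → ¬ c l ≈ 0#) × (∀ x → sum (λ l → c l * ⟨ u l , x ⟩) ≈ 0#)) →
        μ h $ x ≈ 0#
      go (c , c≉0 , eq) = case (c 0F ≈? 0#)
        where
        sum₃ : ∀ y → c 0F * (μ h $ y) + (c 1F * (μ i $ y) + c 2F * (μ j $ y)) ≈ 0#
        sum₃ y = trans (solve 3 (λ p q r → p :+ (q :+ r) := p :+ (q :+ (r :+ con (+ 0)))) refl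
          (c 0F * (μ h $ y)) (c 1F * (μ i $ y)) (c 2F * (μ j $ y))) (eq y)
        case : Dec (c 0F ≈ 0#) → μ h $ x ≈ 0#
        case (no ne) = *-cancel-0 ne (trans
          (sym (trans (+-congˡ (trans (+-cong (trans (*-congˡ xi) (zeroʳ _)) (trans (*-congˡ xj) (zeroʳ _)))
            (+-identityˡ _))) (+-identityʳ _)))
          (sum₃ x))
        case (yes e) = contradiction (zeros c≉0) λ ()
          where
          pair : c 1F ≈ 0# × c 2F ≈ 0#
          pair = independent₂ i≢j λ y → trans
            (sym (trans (+-congʳ (trans (*-congʳ e) (zeroˡ _))) (+-identityˡ _))) (sum₃ y)
          zeros : (∃ λ l → ¬ c l ≈ 0#) → ⊥
          zeros (0F , ne) = ne e
          zeros (1F , ne) = ne (proj₁ pair)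
          zeros (2F , ne) = ne (proj₂ pair)

    -- A wall h of the base chamber, found by walking towards the antipode,
    -- contains a point v around which all other hyperplanes look as from x₀.
    small-tower : ∀ {S n} → HasRank 𝓗 S n → n ℕ.≤ 2 → Tower S
    small-tower {S} rank n≤2 with em {P = Nonempty S}
    ... | no empty = ground λ i∈S → empty (_ , i∈S)
    ... | yes (i₀ , i₀∈S) = build (facet μ {S} (λ i j _ _ → distinct i j) x₀ (negate x₀) (λ {i} _ → x₀∉ i)
        (λ {i} _ e → x₀∉ i (trans (solve 1 (λ a → a := :- :- a) refl (μ i $ x₀))
          (trans (-‿cong (trans (sym (negate-form (μ i) x₀)) e)) (solve 0 (:- con (+ 0) := con (+ 0)) refl))))
        (i₀ , i₀∈S , <-respˡ-≈ (*-congˡ (sym (negate-form (μ i₀) x₀))) (opposite-negate (same-refl (x₀∉ i₀)))))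
      where
      build : _ → Tower S
      build (z , h , h∈S , _ , opp , same) = storey {S₀ = ⁅ h ⁆} {S₁ = S ─ ⁅ h ⁆} {v = v}
        (record
          { split = λ {i} i∈S → splits i∈S (i Fin.≟ h)
          ; S₀⊆S = λ i∈ → ≡.subst (_∈ S) (≡.sym (x∈⁅y⁆⇒x≡y h i∈)) h∈S
          ; S₁⊆S = p─q⊆p S ⁅ h ⁆
          ; parallel = λ i∈ → ≡.subst (λ i → μ i $ v ≈ 0#) (≡.sym (x∈⁅y⁆⇒x≡y h i∈)) on-wall
          ; crossing = λ {j} j∈ → beside j (p─q⊆p S ⁅ h ⁆ j∈) (j≢h j∈)
          ; modular = λ i∈ j∈ i≢j → h , x∈⁅x⁆ h ,
              rank2-modular rank n≤2 h∈S (p─q⊆p S ⁅ h ⁆ i∈) (p─q⊆p S ⁅ h ⁆ j∈) i≢j })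
        -- A single hyperplane over the empty arrangement, with `x₀` itself as the direction.
        (storey {S₀ = ∅} {S₁ = ⁅ h ⁆} {v = x₀}
          (record
            { split = inj₂ ; S₀⊆S = λ i∈ → contradiction i∈ ∉⊥ ; S₁⊆S = id
            ; parallel = λ i∈ → contradiction i∈ ∉⊥
            ; crossing = λ {j} _ → same-refl (x₀∉ j)
            ; modular = λ i∈ j∈ i≢j → contradiction (≡.trans (x∈⁅y⁆⇒x≡y h i∈) (≡.sym (x∈⁅y⁆⇒x≡y h j∈))) i≢j })
          (ground ∉⊥))
        where
        a b : Carrier
        a = μ h $ x₀
        b = μ h $ z
        -- The combination `a z - b x₀` lies on the wall. Multiplying it by `a` makes both
        -- coefficients positive, since `a` and `b` have opposite signs.
        v : Point d
        v = comb (a * a) z (- (a * b)) x₀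
        on-wall : μ h $ v ≈ 0#
        on-wall = trans (linear (μ h) _ _ _ _)
          (solve 2 (λ a b → a :* a :* b :+ :- (a :* b) :* a := con (+ 0)) refl a b)
        j≢h : ∀ {j} → j ∈ S ─ ⁅ h ⁆ → j ≢ h
        j≢h j∈ ≡.refl = x∈p─q⇒x∉q S ⁅ h ⁆ j∈ (x∈⁅x⁆ h)
        beside : ∀ j → j ∈ S → j ≢ h → Same (μ j $ x₀) (μ j $ v)
        beside j j∈S j≢h = <-respʳ-≈
          (trans (solve 4 (λ p q x z → p :* (x :* z) :+ q :* (x :* x) := x :* (p :* z :+ q :* x)) refl (a * a)
            (- (a * b)) (μ j $ x₀) (μ j $ z))
            (*-congˡ (sym (linear (μ j) _ _ _ _))))
          (+-pos (*-pos (sq-pos (x₀∉ h)) (same j j∈S j≢h)) (*-pos (neg-pos opp) (sq-pos (x₀∉ j))))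
        splits : ∀ {i} → i ∈ S → Dec (i ≡ h) → i ∈ ⁅ h ⁆ ⊎ i ∈ S ─ ⁅ h ⁆
        splits i∈S (yes ≡.refl) = inj₁ (x∈⁅x⁆ h)
        splits i∈S (no i≢h)     = inj₂ (x∈p∧x≢y⇒x∈p-y i∈S i≢h)

    module _ {S S₀ S₁ : Subset size} (S₀∪S₁≡S : S₀ ∪ S₁ ≡ S) (disjoint : Empty (S₀ ∩ S₁))
             (modular : ∀ i j → i ∈ S₁ → j ∈ S₁ → i ≢ j → ∃ λ k → k ∈ S₀ ×
               (∀ {x} → μ i $ x ≈ 0# × μ j $ x ≈ 0# → μ k $ x ≈ 0#)) where

      splits : ∀ {i} → i ∈ S → i ∈ S₀ ⊎ i ∈ S₁
      splits i∈S = x∈p∪q⁻ S₀ S₁ (≡.subst (_ ∈_) (≡.sym S₀∪S₁≡S) i∈S)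

      S₀⊆S : ∀ {i} → i ∈ S₀ → i ∈ S
      S₀⊆S i∈ = ≡.subst (_ ∈_) S₀∪S₁≡S (x∈p∪q⁺ (inj₁ i∈))

      S₁⊆S : ∀ {i} → i ∈ S₁ → i ∈ S
      S₁⊆S i∈ = ≡.subst (_ ∈_) S₀∪S₁≡S (x∈p∪q⁺ (inj₂ i∈))

      record Direction (v : Point d) : Set where
        field
          parallel : ∀ {k} → k ∈ S₀ → μ k $ v ≈ 0#
          crossing : ∀ {j} → j ∈ S₁ → ¬ μ j $ v ≈ 0#

      -- For `x` on `Hₖ`, the point `(μ i $ x₀) x - (μ i $ x) x₀` lies on `Hᵢ`, hence on `Hₖ`, which
      -- forces `μ i $ x` to vanish. Inclusion of hyperplanes is thus equality.
      kernel-equal : ∀ {i k} → (∀ x → μ i $ x ≈ 0# → μ k $ x ≈ 0#) → i ≢ k → ⊥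
      kernel-equal {i} {k} sub i≢k = distinct i k i≢k ((λ {x} → sub x) , λ {x} kx≈0 →
        *-cancel-0 (x₀∉ k) (trans (solve 4 (λ p q r s → q :* p := r :* s :- (r :* s :+ :- p :* q)) refl
          (μ i $ x) (μ k $ x₀) (μ i $ x₀) (μ k $ x))
          (trans (+-cong (trans (*-congˡ kx≈0) (zeroʳ _))
            (-‿cong (trans (sym (linear (μ k) (μ i $ x₀) x (- (μ i $ x)) x₀))
              (sub (comb (μ i $ x₀) x (- (μ i $ x)) x₀) (trans (linear (μ i) _ x _ x₀)
                (solve 2 (λ p q → q :* p :+ :- p :* q := con (+ 0)) refl (μ i $ x) (μ i $ x₀)))))))
            (solve 0 (con (+ 0) :- con (+ 0) := con (+ 0)) refl))))

      -- Orthogonality to a basis of the span of the `S₀`-normals is `r` equations in the `r + 1`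
      -- coordinates of `v` in the span of the `S`-normals. If every form of `S` vanished at `v`,
      -- then `⟨ v , v ⟩ = 0` and all coordinates would be zero.
      direction : ∀ {r} → HasRank 𝓗 S (ℕ.suc r) → HasRank 𝓗 S₀ r → ∃ Direction
      direction {r} (b , b∈ , independent , _) (b₀ , _ , _ , spans₀) =
        build (underdetermined (ℕ.n<1+n r) (λ k l → ⟨ b l , b₀ k ⟩))
        where
        build : (∃ λ (c : Fin (ℕ.suc r) → Carrier) →
          (∃ λ l → ¬ c l ≈ 0#) × (∀ k → sum (λ l → c l * ⟨ b l , b₀ k ⟩) ≈ 0#)) → ∃ Direction
        build (c , (l , cl≉0) , eqs) = v , record { parallel = parallel ; crossing = λ {j} → crossing {j} }
          where
          v : Point d
          v = lincomb c b
          parallel : ∀ {k} → k ∈ S₀ → μ k $ v ≈ 0#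
          parallel {k} k∈S₀ = let c₀ , e = spans₀ (normal k) (normal∈span k∈S₀) in
            trans (ip-congˡ v e) (trans (ip-lincomb c₀ b₀ v) (sum-zero _ λ m → trans
              (*-congˡ (trans (ip-comm (b₀ m) v) (trans (ip-lincomb c b (b₀ m)) (eqs m)))) (zeroʳ (c₀ m))))
          some : ∃ λ j → j ∈ S × ¬ μ j $ v ≈ 0#
          some with em {P = ∃ λ j → j ∈ S × ¬ μ j $ v ≈ 0#}
          ... | yes p = p
          ... | no np = contradiction (independent c (ip-definite v vv≈0) l) cl≉0
            where
            vanish : ∀ {j} → j ∈ S → μ j $ v ≈ 0#
            vanish j∈S = ≈-stable λ ne → np (_ , j∈S , ne)
            bv≈0 : ∀ m → ⟨ b m , v ⟩ ≈ 0#
            bv≈0 m = let e , outside≈0 , eq = b∈ m in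
              trans (ip-congˡ v eq) (trans (ip-lincomb e normal v) (sum-zero _ λ i → term e outside≈0 i em))
              where
              term : ∀ e → (∀ i → i ∉ S → e i ≈ 0#) → ∀ i → Dec (i ∈ S) → e i * ⟨ normal i , v ⟩ ≈ 0#
              term e out i (yes i∈S) = trans (*-congˡ (vanish i∈S)) (zeroʳ (e i))
              term e out i (no i∉S)  = trans (*-congʳ (out i i∉S)) (zeroˡ _)
            vv≈0 : ⟨ v , v ⟩ ≈ 0#
            vv≈0 = trans (ip-lincomb c b v) (sum-zero _ λ m → trans (*-congˡ (bv≈0 m)) (zeroʳ (c m)))
          j₀ = proj₁ some
          j₀v≉0 = proj₂ (proj₂ some)
          j₀∈S₁ : j₀ ∈ S₁
          j₀∈S₁ = Sum.[ (λ j∈S₀ → contradiction (parallel j∈S₀) j₀v≉0) , id ]′ (splits (proj₁ (proj₂ some)))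
          -- If `v` were on `Hᵢ`, each point of `Hᵢ` could, up to scaling, be moved along `v` into
          -- hyperplane `j₀` within `Hᵢ`, hence into `Hₖ`. As `v` is parallel to `Hₖ`, the point was
          -- there already, so `Hᵢ ⊆ Hₖ`.
          crossing : ∀ {i} → i ∈ S₁ → ¬ μ i $ v ≈ 0#
          crossing {i} i∈S₁ iv≈0 = go (modular i j₀ i∈S₁ j₀∈S₁ λ { ≡.refl → j₀v≉0 iv≈0 })
            where
            go : (∃ λ k → k ∈ S₀ × (∀ {x} → μ i $ x ≈ 0# × μ j₀ $ x ≈ 0# → μ k $ x ≈ 0#)) → ⊥
            go (k , k∈S₀ , meet) = kernel-equal sub λ { ≡.refl → disjoint (k , x∈p∩q⁺ (k∈S₀ , i∈S₁)) }
              where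
              sub : ∀ x → μ i $ x ≈ 0# → μ k $ x ≈ 0#
              sub x ix≈0 = *-cancel-0 j₀v≉0 (trans
                (sym (trans (linear (μ k) _ x _ v)
                  (trans (+-congˡ (trans (*-congˡ (parallel k∈S₀)) (zeroʳ _))) (+-identityʳ _))))
                (meet {comb (μ j₀ $ v) x (- (μ j₀ $ x)) v}
                  ( trans (linear (μ i) _ x _ v)
                    (trans (+-cong (trans (*-congˡ ix≈0) (zeroʳ _)) (trans (*-congˡ iv≈0) (zeroʳ _)))
                    (+-identityˡ _))
                  , trans (linear (μ j₀) _ x _ v)
                    (solve 2 (λ p q → p :* q :+ :- q :* p := con (+ 0)) refl (μ j₀ $ v) (μ j₀ $ x)))))

      negate-direction : ∀ {v} → Direction v → Direction (negate v)
      negate-direction {v} D = record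
        { parallel = λ {k} k∈S₀ → trans (negate-form (μ k) v)
          (trans (-‿cong (Direction.parallel D k∈S₀)) (solve 0 (:- con (+ 0) := con (+ 0)) refl))
        ; crossing = λ {j} j∈S₁ e → Direction.crossing D j∈S₁
            (trans (solve 1 (λ a → a := :- :- a) refl (μ j $ v))
              (trans (-‿cong (trans (sym (negate-form (μ j) v)) e))
              (solve 0 (:- con (+ 0) := con (+ 0)) refl))) }

      module _ (x₀∉S : Complement 𝓗 S x₀) where
        private
          R : Region 𝓗 S
          R = x₀ , x₀∉S

        -- The target `y = v + ε x₀` has the signs of `x₀` on `S₀` and, for small `ε`, those of `v`
        -- on `S₁`. The walk towards it leaves the base region through a hyperplane of `S₁` that
        -- separates `x₀` from `v`.
        escape : ∀ {v} → Direction v → ∀ {j} → j ∈ S₁ → Opposite (μ j $ x₀) (μ j $ v) →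
                 ∃₂ λ (x : Region 𝓗 S) h → h ∈ S₁ × Opposite (μ h $ x₀) (μ h $ v) × Crosses 𝓗 R x h
        escape {v} D {j} j∈S₁ opp = build (facet μ {S} (λ i j _ _ → distinct i j) x₀ y x₀∉S y∉
            (j , S₁⊆S j∈S₁ , opp-sym (same-opp (same-sym (kept j∈S₁)) (opp-sym opp))))
          where
          open Direction D
          nudged = nudge (List.tabulate μ) v x₀
          ε-data = dense (proj₁ (proj₂ nudged))
          ε = proj₁ ε-data
          y : Point d
          y = comb 1# v ε x₀
          kept : ∀ {j} → j ∈ S₁ → Same (μ j $ v) (μ j $ y)
          kept {j} j∈S₁ = All.tabulate⁻ (proj₂ (proj₂ nudged) ε (proj₁ (proj₂ ε-data)) (proj₂ (proj₂ ε-data)))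
            j (crossing j∈S₁)
          fixed : ∀ {k} → k ∈ S₀ → Same (μ k $ x₀) (μ k $ y)
          fixed {k} k∈S₀ = <-respʳ-≈
            (trans (solve 2 (λ e x → e :* (x :* x) := x :* (con (+ 0) :+ e :* x)) refl ε (μ k $ x₀))
              (*-congˡ (sym (trans (step (μ k) v ε x₀) (+-congʳ (parallel k∈S₀))))))
            (*-pos (proj₁ (proj₂ ε-data)) (sq-pos (x₀∉ k)))
          y∉ : ∀ {i} → i ∈ S → ¬ μ i $ y ≈ 0#
          y∉ i∈S = Sum.[ (λ k∈S₀ → same⇒≉ʳ (fixed k∈S₀)) , (λ j∈S₁ → same⇒≉ʳ (kept j∈S₁)) ]′ (splits i∈S)
          build : _ → ∃₂ λ (x : Region 𝓗 S) h → h ∈ S₁ × Opposite (μ h $ x₀) (μ h $ v) × Crosses 𝓗 R x h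
          build (z , h , h∈S , oy , oz , same) = (z , z∉) , h , h∈S₁ ,
            opp-sym (same-opp (kept h∈S₁) (opp-sym oy)) , h∈S , oz , λ {i} → same i
            where
            h∈S₁ : h ∈ S₁
            h∈S₁ = Sum.[ (λ h∈S₀ → contradiction oy (asym (fixed h∈S₀))) , id ]′ (splits h∈S)
            z∉ : ∀ {i} → i ∈ S → ¬ μ i $ z ≈ 0#
            z∉ {i} i∈S e = side (i Fin.≟ h)
              where
              side : Dec (i ≡ h) → ⊥
              side (yes ≡.refl) = irrefl (trans (*-congˡ e) (zeroʳ _)) oz
              side (no i≢h) = same⇒≉ʳ (same i i∈S i≢h) e

        module _ {n : ℕ} {p : Fin (ℕ.suc n) → Region 𝓗 S}
                 (path : IsInducedPath (SameRegion 𝓗 S) (Adjacent 𝓗 S)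
                           (λ R′ → SameRegion 𝓗 S₀ (ρ 𝓗 S₀ S₁ S₀∪S₁≡S R′) (ρ 𝓗 S₀ S₁ S₀∪S₁≡S R)) p)
                 (end : SameRegion 𝓗 S R (p zero) ⊎ SameRegion 𝓗 S R (p (fromℕ n))) where
          open IsInducedPath path

          -- R is an end of the path, so it has only one neighbour on it.
          unique-neighbour : ∀ {x y : Region 𝓗 S} {h k} → h ∈ S₁ → k ∈ S₁ → h ≢ k → Crosses 𝓗 R x h →
            Crosses 𝓗 R y k → ⊥
          unique-neighbour {x} {y} {h} {k} h∈S₁ k∈S₁ h≢k cx cy =
            go (covering x (in-fibre x h∈S₁ cx)) (covering y (in-fibre y k∈S₁ cy)) end
            where
            in-fibre : ∀ x {h} → h ∈ S₁ → Crosses 𝓗 R x h →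
              SameRegion 𝓗 S₀ (ρ 𝓗 S₀ S₁ S₀∪S₁≡S x) (ρ 𝓗 S₀ S₁ S₀∪S₁≡S R)
            in-fibre x h∈S₁ (_ , _ , same) =
              same⇒sameRegion 𝓗 {x = ρ 𝓗 S₀ S₁ S₀∪S₁≡S x} {ρ 𝓗 S₀ S₁ S₀∪S₁≡S R} λ k∈S₀ → same-sym
              (same (S₀⊆S k∈S₀) λ { ≡.refl → disjoint (_ , x∈p∩q⁺ (k∈S₀ , h∈S₁)) })

            move : ∀ {R′ x x′ h} → SameRegion 𝓗 S R R′ → SameRegion 𝓗 S x′ x → Crosses 𝓗 R x h →
              Adjacent 𝓗 S R′ x′
            move {R′} {x} {x′} {h} r s (h∈S , o , same) = crosses⇒adjacent 𝓗 R′ x′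
              ( h∈S , opp-sym (same-opp (S′ h∈S) (opp-sym (same-opp (same-sym (R≈ h∈S)) o)))
              , λ i∈S i≢h → same-trans (same-sym (R≈ i∈S)) (same-trans (same i∈S i≢h) (same-sym (S′ i∈S))))
              where
              R≈ : ∀ {i} → i ∈ S → Same (μ i $ x₀) (μ i $ proj₁ R′)
              R≈ = sameRegion⇒same 𝓗 {x = R} {R′} r
              S′ : ∀ {i} → i ∈ S → Same (μ i $ proj₁ x′) (μ i $ proj₁ x)
              S′ = sameRegion⇒same 𝓗 {x = x′} {x} s

            clash : ∀ a b → SameRegion 𝓗 S (p a) x → SameRegion 𝓗 S (p b) y → a ≡ b → ⊥
            clash a _ ax by ≡.refl = asym
              (same-trans (proj₂ (proj₂ cy) (proj₁ cx) h≢k) (same-trans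
                (same-sym (sameRegion⇒same 𝓗 {x = p a} {y} by (proj₁ cx)))
                  (sameRegion⇒same 𝓗 {x = p a} {x} ax (proj₁ cx))))
              (proj₁ (proj₂ cx))

            after-zero : ∀ {a : Fin (ℕ.suc n)} → toℕ a ≡ 1 ⊎ 0 ≡ ℕ.suc (toℕ a) → toℕ a ≡ 1
            after-zero (inj₁ e) = e

            before-last : ∀ (a : Fin (ℕ.suc n)) →
              toℕ a ≡ ℕ.suc (toℕ (fromℕ n)) ⊎ toℕ (fromℕ n) ≡ ℕ.suc (toℕ a) →
                          ℕ.suc (toℕ a) ≡ n
            before-last a (inj₁ e) = contradiction (Fin.toℕ<n a)
              (ℕ.<-irrefl (≡.trans e (≡.cong ℕ.suc (Fin.toℕ-fromℕ n))))
            before-last a (inj₂ e) = ≡.trans (≡.sym e) (Fin.toℕ-fromℕ n)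

            go : (∃ λ a → SameRegion 𝓗 S (p a) x) → (∃ λ b → SameRegion 𝓗 S (p b) y) →
                 SameRegion 𝓗 S R (p zero) ⊎ SameRegion 𝓗 S R (p (fromℕ n)) → ⊥
            go (a , ax) (b , by) (inj₁ r) = clash a b ax by (Fin.toℕ-injective (≡.trans
              (after-zero {a} (Equivalence.to (induced zero a) (move {p zero} {x} {p a} r ax cx)))
              (≡.sym (after-zero {b} (Equivalence.to (induced zero b) (move {p zero} {y} {p b} r by cy))))))
            go (a , ax) (b , by) (inj₂ r) = clash a b ax by (Fin.toℕ-injective (ℕ.suc-injective (≡.trans
              (before-last a (Equivalence.to (induced (fromℕ n) a) (move {p (fromℕ n)} {x} {p a} r ax cx)))
              (≡.sym (before-last b (Equivalence.to (induced (fromℕ n) b)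
                (move {p (fromℕ n)} {y} {p b} r by cy)))))))

          -- If `v` were on the base side of some hyperplane of `S₁` and beyond another, `escape`
          -- for `v` and for `negate v` would find two different exits from the base region, against
          -- `unique-neighbour`.
          orient : ∀ {v} → Direction v → ∃ λ v → Direction v × (∀ {j} → j ∈ S₁ → Same (μ j $ x₀) (μ j $ v))
          orient {v} D with em {P = ∃ λ j → j ∈ S₁ × Opposite (μ j $ x₀) (μ j $ v)}
          ... | no none-opposite = v , D , λ {j} j∈S₁ →
            Sum.[ (λ o → contradiction (j , j∈S₁ , o) none-opposite) ,
              id ]′ (same-or-opp (x₀∉ j) (Direction.crossing D j∈S₁))
          ... | yes (j , j∈S₁ , o) = negate v , negate-direction D , λ {i} i∈S₁ →
            Sum.[ (λ o → same-cong refl (sym (negate-form (μ i) v)) (same-negate o)) ,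
              (λ s → ⊥-elim (both i i∈S₁ s)) ]′
              (same-or-opp (x₀∉ i) (Direction.crossing D i∈S₁))
            where
            both : ∀ i → i ∈ S₁ → Same (μ i $ x₀) (μ i $ v) → ⊥
            both i i∈S₁ s = clash (escape D j∈S₁ o)
              (escape (negate-direction D) i∈S₁
                (<-respˡ-≈ (*-congˡ (sym (negate-form (μ i) v))) (opposite-negate s)))
              where
              clash : (∃₂ λ (x : Region 𝓗 S) h → h ∈ S₁ × Opposite (μ h $ x₀) (μ h $ v) × Crosses 𝓗 R x h) →
                      (∃₂ λ (x : Region 𝓗 S) h → h ∈ S₁ × Opposite (μ h $ x₀) (μ h $ negate v) × Crosses 𝓗 R x
                        h) → ⊥
              clash (x , h , h∈ , oh , cx) (y , k , k∈ , ok , cy) = unique-neighbour {x} {y} h∈ k∈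
                (λ { ≡.refl → asym (same-negate oh) (<-respˡ-≈ (*-congˡ (negate-form (μ h) v)) ok) }) cx cy

    -- Since `ρ` keeps the representing point, `x₀` is the base at every level; only the proof that
    -- it avoids the hyperplanes changes in the recursive call.
    canonical-tower : ∀ {S} (D : Decomposition 𝓗 S) (x₀∉S : Complement 𝓗 S x₀) → IsCanonical 𝓗 D (x₀ , x₀∉S) →
      Tower S
    canonical-tower (rank≤2 rank n≤2) _ _ = small-tower rank n≤2
    canonical-tower (rank≥3 {ℕ.suc r} rank _ S₀ S₁ eq disjoint _ _ rank₀ modular D₀) x₀∉S
      (canonical₀ , _ , _ , path , end) =
      let _ , D , same = orient eq disjoint modular x₀∉S path end (proj₂ (direction eq disjoint modular rank rank₀)) in
      storey (record
        { split = splits eq disjoint modular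
        ; S₀⊆S = S₀⊆S eq disjoint modular
        ; S₁⊆S = S₁⊆S eq disjoint modular
        ; parallel = Direction.parallel D
        ; crossing = same
        ; modular = λ {i} {j} i∈ j∈ i≢j → let k , k∈ , meet = modular i j i∈ j∈ i≢j in k , k∈ , λ x a b → meet (a , b) })
        (canonical-tower D₀ _ canonical₀)

-- Transport along equivalent relations, and the theorem

CoverPair-transport : {A : Set ℓ₀} {_≈_ : Rel A ℓ} {_≤_ : Rel A ℓ₁} {_≤′_ : Rel A ℓ₂} → _≤_ ⇒ _≤′_ →
  _≤′_ ⇒ _≤_ →
                      CoverPair _≈_ _≤_ ⇒ CoverPair _≈_ _≤′_
CoverPair-transport f g ((x≤y , x≉y) , none) = (f x≤y , x≉y) ,
  λ { (z , (x≤z , x≉z) , (z≤y , z≉y)) → none (z , (g x≤z , x≉z) , (g z≤y , z≉y)) }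

CoverGraph-transport : {A : Set ℓ₀} {_≈_ : Rel A ℓ} {_≤_ : Rel A ℓ₁} {_≤′_ : Rel A ℓ₂} → _≤_ ⇒ _≤′_ →
  _≤′_ ⇒ _≤_ →
                       CoverGraph _≈_ _≤_ ⇒ CoverGraph _≈_ _≤′_
CoverGraph-transport {_≈_ = _≈_} f g =
  Sum.map (CoverPair-transport {_≈_ = _≈_} f g) (CoverPair-transport {_≈_ = _≈_} f g)

QuotientOrder-map : {A : Set ℓ₀} {_≤_ : Rel A ℓ₁} {_≤′_ : Rel A ℓ₂} {_∼_ : Rel A ℓ₃} → _≤_ ⇒ _≤′_ →
                    QuotientOrder _≤_ _∼_ ⇒ QuotientOrder _≤′_ _∼_
QuotientOrder-map f (x , y , p , q , x≤y) = x , y , p , q , f x≤y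

isLattice-transport : {A : Set ℓ₀} {_≈_ : Rel A ℓ} {_≈′_ : Rel A ℓ₁} {_≤_ : Rel A ℓ₂} {_≤′_ : Rel A ℓ₃}
  {_∨_ _∧_ : A → A → A} →
                      _≈_ ⇒ _≈′_ → _≈′_ ⇒ _≈_ → _≤_ ⇒ _≤′_ → _≤′_ ⇒ _≤_ →
                      IsLattice _≈_ _≤_ _∨_ _∧_ → IsLattice _≈′_ _≤′_ _∨_ _∧_
isLattice-transport e e⁻ f f⁻ L = record
  { isPartialOrder = record
      { isPreorder = record
          { isEquivalence = record
              { refl = e Eq.refl ; sym = λ p → e (Eq.sym (e⁻ p)) ; trans = λ p q → e (Eq.trans (e⁻ p) (e⁻ q)) }
          ; reflexive = λ p → f (reflexive (e⁻ p))
          ; trans = λ p q → f (trans (f⁻ p) (f⁻ q)) }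
      ; antisym = λ p q → e (antisym (f⁻ p) (f⁻ q)) }
  ; supremum = λ x y → f (x≤x∨y x y) , f (y≤x∨y x y) , λ z p q → f (∨-least (f⁻ p) (f⁻ q))
  ; infimum = λ x y → f (x∧y≤x x y) , f (x∧y≤y x y) , λ z p q → f (∧-greatest (f⁻ p) (f⁻ q)) }
  where open IsLattice L

HamiltonianList-transport : {A : Set ℓ₀} {_∼_ : Rel A ℓ} {_≤_ : Rel A ℓ₁} {_≤′_ : Rel A ℓ₂} → _≤_ ⇒ _≤′_ →
  _≤′_ ⇒ _≤_ →
  HamiltonianList _∼_ (CoverGraph _∼_ (QuotientOrder _≤_ _∼_)) →
  HamiltonianList _∼_ (CoverGraph _∼_ (QuotientOrder _≤′_ _∼_))
HamiltonianList-transport {_∼_ = _∼_} f g H = record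
  { path = mapPath (CoverGraph-transport {_≈_ = _∼_} (QuotientOrder-map {_∼_ = _∼_} f)
    (QuotientOrder-map {_∼_ = _∼_} g)) path
  ; covering = covering
  ; distinct = distinct }
  where open HamiltonianList H

theorem1p2 : (∀ {ℓ} → ExcludedMiddle ℓ) →
    (ℝ : CompleteOrderedField) →
    let open HyperplaneArrangements ℝ in
    (d : ℕ) (𝓗 : Arrangement d) (D : Decomposition 𝓗 ⊤)
    (R₀ : Region 𝓗 ⊤) → IsCanonical 𝓗 D R₀ →
    (c : Level) →
    let _≈_ = SameRegion 𝓗 ⊤
        _≤_ = RegionOrder 𝓗 R₀ in
    ∃₂ λ _∨_ _∧_ →
      IsLattice _≈_ _≤_ _∨_ _∧_ ×
      ((_∼_ : Rel (Region 𝓗 ⊤) c) → IsLatticeCongruence _≈_ _∨_ _∧_ _∼_ →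
        HasHamiltonianPath _∼_ (CoverGraph _∼_ (QuotientOrder _≤_ _∼_)))
theorem1p2 em ℝ d 𝓗 D R₀ canonical c = assemble
  (tower-lattice c (canonical-tower 𝓗 R₀ D (proj₂ R₀) canonical))
  where
  open HyperplaneArrangements ℝ
  open RegionOrders em ℝ
  open BasedAt 𝓗 R₀
  open CanonicalTowers em ℝ

  _≈_ : Rel (Region 𝓗 ⊤) _
  _≈_ = SameRegion 𝓗 ⊤

  _≤_ : Rel (Region 𝓗 ⊤) _
  _≤_ = RegionOrder 𝓗 R₀

  ≈⇒alike : _≈_ ⇒ Alike ⊤
  ≈⇒alike {x} {y} = sameRegion⇒alike x y

  alike⇒≈ : Alike ⊤ ⇒ _≈_
  alike⇒≈ {x} {y} = alike⇒sameRegion x y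

  ≤⇒below : _≤_ ⇒ Below ⊤
  ≤⇒below {x} {y} p {i} = order⇒below p {i}

  below⇒≤ : Below ⊤ ⇒ _≤_
  below⇒≤ {x} {y} = below⇒order {x} {y}

  assemble : (∃₂ λ _∨_ _∧_ → IsLattice (Alike ⊤) (Below ⊤) _∨_ _∧_ × HasHamiltonianQuotients c _∨_ _∧_) →
    ∃₂ λ _∨_ _∧_ →
      IsLattice _≈_ _≤_ _∨_ _∧_ ×
      ((_∼_ : Rel (Region 𝓗 ⊤) c) → IsLatticeCongruence _≈_ _∨_ _∧_ _∼_ →
        HasHamiltonianPath _∼_ (CoverGraph _∼_ (QuotientOrder _≤_ _∼_)))
  assemble (_∨_ , _∧_ , L , H) = _∨_ , _∧_ ,
    isLattice-transport (λ {x} {y} → alike⇒≈ {x} {y}) (λ {x} {y} → ≈⇒alike {x} {y})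
      (λ {x} {y} → below⇒≤ {x} {y}) (λ {x} {y} → ≤⇒below {x} {y}) L ,
    λ _∼_ C → let open IsLatticeCongruence C in
      hasHamiltonianPath isEquivalence
        (HamiltonianList-transport (λ {x} {y} → below⇒≤ {x} {y}) (λ {x} {y} → ≤⇒below {x} {y})
        (H _∼_ (record
          { isEquivalence = isEquivalence ; respects = λ {x} {y} a → respects (alike⇒≈ {x} {y} a)
          ; ∧-cong = ∧-cong ; ∨-cong = ∨-cong })))
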